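{- Let $l\ge 1$, let $\lambda=(1^l)=(1,\ldots,1)$ ($l$ ones), and write $\mathcal{A}_n$ for the intrinsic hyperplane arrangement of the irreducible $\mathfrak{S}_n$-representation attached to $\lambda[n]=(n-l,1^l)$. Then there exists a function $f_l:\mathbb{N}\to\mathbb{N}$ such that for all $n\ge 0$, $f_l(n)$ is a lower bound on the first Kazhdan–Lusztig coefficient of $\mathcal{A}_n$ (the coefficient of $t$ in the Kazhdan–Lusztig polynomial $p_{\mathcal{A}_n}(t)$), and $$\lim_{n\to\infty}\frac{f_l(n)\,(l+1)!}{(l+1)^n}=1.$$
   Context: Representations. $[n]=\{1,\dots,n\}$. For a partition $\mu$ of $n$, $S^\mu$ is the complex irreducible representation (Specht module) of the symmetric group $\mathfrak{S}_n$ attached to $\mu$, with $S^{(n)}$ trivial. For $n\ge l+1$ put $S^\lambda_n:=S^{(n-l,1^l)}$ (this is $\bigwedge^l$ of the standard representation $S^{(n-1,1)}$); for $n<l+1$ one sets $S^\lambda_n=0$, with the empty arrangement. Intrinsic arrangement. Let $\mu$ be a partition of $n$ and $\mu^\dagger$ its conjugate (transposed) partition. Let $\mathbb{P}_n(\mu^\dagger)$ be the set of set partitions $\alpha$ of $[n]$ whose block sizes are the parts of $\mu^\dagger$. For $\alpha=\{\alpha_1,\alpha_2,\dots\}\in\mathbb{P}_n(\mu^\dagger)$ let $\mathfrak{S}_\alpha=\prod_j\mathfrak{S}_{\alpha_j}\subseteq\mathfrak{S}_n$ and let $T_\alpha$ be a set of transpositions generating $\mathfrak{S}_\alpha$. Put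 $H_\alpha:=\sum_{\tau\in T_\alpha}(S^\mu)^\tau$, where $(S^\mu)^\tau$ is the subspace fixed by $\tau$. It is known (Tsilevich–Vershik–Yuzvinsky) that $H_\alpha$ is a hyperplane in $S^\mu$ independent of the choice of $T_\alpha$. The intrinsic hyperplane arrangement of $S^\mu$ is $\{H_\alpha\mid\alpha\in\mathbb{P}_n(\mu^\dagger)\}$. For $\mu=(n-l,1^l)$ the index set is in bijection with subsets of $[n]$ of size $l+1$ (the non-singleton block). Kazhdan–Lusztig polynomial. Let $\mathcal{A}$ be a finite central hyperplane arrangement in a complex vector space $V$; choose for each $H\in\mathcal{A}$ a normal vector $a(H)$. The complement $\mathcal{M}(\mathcal{A})=\{v\in V\mid\langle v,a(H)\rangle\ne 0\ \forall H\in\mathcal{A}\}$ is embedded in the torus $(\mathbb{C}^\times)^{\mathcal{A}}$ via the coordinates $\langle a(H),\cdot\rangle$. Let $\mathcal{M}^{ -1}(\mathcal{A})$ be the image of $\mathcal{M}(\mathcal{A})$ under inversion of every coordinate of the torus; the reciprocal plane $X_{\mathcal{A}}$ is the closure of $\mathcal{M}^{ -1}(\mathcal{A})$ in $\mathbb{C}^{\mathcal{A}}$. The Kazhdan–Lusztig polynomial $p_{\mathcal{A}}(t)$ is the polynomial whose coefficient of $t^i$ is $\dim_{\mathbb{C}}IH^{2i}(X_{\mathcal{A}};\mathbb{C})$ (intersection cohomology). Equivalently (Elias–Proudfoot–Wakefield), $p_{\mathcal{A}}$ is the Kazhdan–Lusztig polynomial of the matroid of $\mathcal{A}$, defined recursively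 from its lattice of flats: $P_M(t)=1$ if $\operatorname{rk}M=0$; $\deg P_M<\tfrac12\operatorname{rk}M$ if $\operatorname{rk}M>0$; and $t^{\operatorname{rk}M}P_M(t^{ -1})=\sum_F\chi_{M_F}(t)P_{M^F}(t)$, the sum being over flats $F$, where $M_F$ is the matroid with lattice of flats the interval $[\hat 0,F]$, $M^F$ the one with lattice of flats $[F,\hat 1]$, and $\chi$ the characteristic polynomial. -}

module Defs where

open import Algebra.Apartness.Bundles using (HeytingCommutativeRing; HeytingField)
open import Algebra.Bundles using (CommutativeRing)
import Algebra.Definitions.RawMonoid as RawMonoidOps
open import Data.Bool.Base using (if_then_else_)
open import Data.Bool.Properties using () renaming (_≟_ to _≟ᵇ_)
open import Data.Fin.Base using (Fin; zero; suc)
open import Data.Fin.Permutation using (Permutation′; transpose; _⟨$⟩ʳ_)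
open import Data.Fin.Subset using (Subset; inside; outside; ∣_∣; ⁅_⁆; ⊤)
  renaming (_∈_ to _∈ₛ_; _⊆_ to _⊆ₛ_)
open import Data.Fin.Subset.Properties using (_⊆?_; _⊂?_) renaming (_∈?_ to _∈ₛ?_)
open import Data.Integer.Base as ℤ using (ℤ; 0ℤ; 1ℤ)
open import Data.List.Base
  using (List; []; _∷_; _++_; map; filter; foldr; length; lookup; upTo; allFin; replicate)
open import Data.List.Extrema.Nat using (max)
open import Data.List.Membership.Propositional using (_∈_)
open import Data.List.Relation.Unary.Any using (Any)
open import Data.List.Relation.Unary.Unique.Propositional using (Unique)
open import Data.Nat.Base as ℕ using (ℕ; zero; suc; _∸_)
open import Data.Nat.Properties using (_≤?_; _<?_) renaming (_≟_ to _≟ⁿ_)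
open import Data.Product.Base using (Σ; Σ-syntax; ∃; ∃-syntax; _×_; _,_; proj₁; proj₂)
open import Data.Vec.Base using ([]; _∷_)
open import Data.Vec.Functional using (Vector; head; tail)
open import Data.Vec.Properties using (≡-dec)
open import Function.Base using (_∘_)
open import Function.Bundles using (_↔_; _⇔_; Inverse)
open import Level using (Level; _⊔_; 0ℓ) renaming (suc to lsuc)
open import Relation.Binary.PropositionalEquality using (_≡_; _≢_; _≗_)
open import Relation.Nullary using (Dec; yes; no; ¬?)
open import Relation.Nullary.Decidable using (⌊_⌋; _×-dec_)
open import Relation.Unary using (Pred)

private
  variable
    a c ℓ ℓ₁ ℓ₂ : Level
    m n : ℕ

------------------------------------------------------------------------
-- Partitions, given by their lists of parts

-- The part of index j of the conjugate partition (counted from 0) is the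
-- number of parts of μ that exceed j.
conjugate : List ℕ → List ℕ
conjugate μ = map (λ j → length (filter (j <?_) μ)) (upTo (max 0 μ))

-- (n − l , 1ˡ); a partition of n when l < n.
hook : ℕ → ℕ → List ℕ
hook l n = (n ∸ l) ∷ replicate l 1

------------------------------------------------------------------------
-- Integer polynomials, as sequences of coefficients

Poly : Set
Poly = ℕ → ℤ

∑ℤ : {A : Set a} → List A → (A → ℤ) → ℤ
∑ℤ xs f = foldr (λ x s → f x ℤ.+ s) 0ℤ xs

-- c · t ^ d
monomial : ℤ → ℕ → Poly
monomial c d k = if ⌊ d ≟ⁿ k ⌋ then c else 0ℤ

_*ₚ_ : Poly → Poly → Poly
(p *ₚ q) k = ∑ℤ (upTo (suc k)) λ i → p i ℤ.* q (k ∸ i)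

∑ₚ : {A : Set a} → List A → (A → Poly) → Poly
∑ₚ xs f k = ∑ℤ xs λ x → f x k

-- t ^ r · p (t⁻¹), for p of degree at most r.
reverse : ℕ → Poly → Poly
reverse r p k = if ⌊ k ≤? r ⌋ then p (r ∸ k) else 0ℤ

------------------------------------------------------------------------
-- Kazhdan–Lusztig polynomials from a lattice of flats

-- A lattice of flats is given by a duplicate-free list L of subsets of the
-- ground set Fin m, ordered by inclusion.

module Flats (L : List (Subset m)) where

  infix 4 _≟_
  _≟_ : (F G : Subset m) → Dec (F ≡ G)
  _≟_ = ≡-dec _≟ᵇ_

  [_,_] : Subset m → Subset m → List (Subset m)
  [ F , G ] = filter (λ H → (F ⊆? H) ×-dec (H ⊆? G)) L

  [_,_⟩ : Subset m → Subset m → List (Subset m)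
  [ F , G ⟩ = filter (λ H → (F ⊆? H) ×-dec (H ⊂? G)) L

  -- The recursions below descend along proper inclusions H ⊂ G. Their first
  -- argument bounds the depth; since ∣ H ∣ < ∣ G ∣, the bound ∣ G ∣ is never
  -- exhausted before an empty half-open interval is reached.

  height : ℕ → Subset m → Subset m → ℕ
  height zero    F G = 0
  height (suc d) F G = max 0 (map (λ H → suc (height d F H)) [ F , G ⟩)

  -- The rank of the interval [F , G]: the length of its longest chain.
  rk : Subset m → Subset m → ℕ
  rk F G = height ∣ G ∣ F G

  möbius : ℕ → Subset m → Subset m → ℤ
  möbius d F G with F ≟ G
  möbius d       F G | yes _ = 1ℤ
  möbius zero    F G | no  _ = 0ℤ
  möbius (suc d) F G | no  _ = ℤ.- ∑ℤ [ F , G ⟩ (möbius d F)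

  μ : Subset m → Subset m → ℤ
  μ F G = möbius ∣ G ∣ F G

  -- The characteristic polynomial of the matroid with lattice of flats [F , G].
  χ : Subset m → Subset m → Poly
  χ F G = ∑ₚ [ F , G ] λ H → monomial (μ F H) (rk H G)

  -- P F is the Kazhdan–Lusztig polynomial of the matroid M^F with lattice of
  -- flats [F , ⊤], for every flat F: the defining recursion, applied to M^F,
  -- whose localisation and contraction at a flat G ⊇ F have lattices of flats
  -- [F , G] and [G , ⊤].
  record IsKLFamily (P : Subset m → Poly) : Set where
    field
      rank-0    : ∀ {F} → F ∈ L → rk F ⊤ ≡ 0 → P F ≗ monomial 1ℤ 0
      degree    : ∀ {F} → F ∈ L → 0 ℕ.< rk F ⊤ →
                  ∀ i → rk F ⊤ ℕ.≤ 2 ℕ.* i → P F i ≡ 0ℤ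
      recursion : ∀ {F} → F ∈ L →
                  reverse (rk F ⊤) (P F) ≗ ∑ₚ [ F , ⊤ ] (λ G → χ F G *ₚ P G)

------------------------------------------------------------------------
-- Hyperplane arrangements and their Kazhdan–Lusztig polynomials

-- An arrangement in the subspace `space` of V, indexed by Fin size. All
-- subspaces are predicates on the ambient type V.
record Arrangement {v} (V : Set v) ℓ : Set (v ⊔ lsuc ℓ) where
  field
    space      : Pred V ℓ
    size       : ℕ
    hyperplane : Fin size → Pred V ℓ

module _ {v} {V : Set v} (𝓐 : Arrangement V ℓ) where
  open Arrangement 𝓐

  ⋂ : Subset size → Pred V ℓ
  ⋂ F x = space x × (∀ j → j ∈ₛ F → hyperplane j x)

  IsFlat : Subset size → Set (v ⊔ ℓ)
  IsFlat F = ∀ i → (∀ x → ⋂ F x → hyperplane i x) → i ∈ₛ F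

  record IsLatticeOfFlats (L : List (Subset size)) : Set (v ⊔ ℓ) where
    field
      unique   : Unique L
      complete : ∀ F → F ∈ L ⇔ IsFlat F

  record IsKLPolynomial (p : Poly) : Set (v ⊔ ℓ) where
    field
      flats      : List (Subset size)
      isLattice  : IsLatticeOfFlats flats
      family     : Subset size → Poly
      isKLFamily : Flats.IsKLFamily flats family
      bottom     : Subset size
      bottom∈    : bottom ∈ flats
      bottom⊆    : ∀ {F} → F ∈ flats → bottom ⊆ₛ F
      value      : p ≗ family bottom

------------------------------------------------------------------------
-- Subsets and set partitions of Fin n

allSubsets : ∀ n → List (Subset n)
allSubsets zero    = [] ∷ []
allSubsets (suc n) = map (outside ∷_) (allSubsets n) ++ map (inside ∷_) (allSubsets n)

subsetsOfSize : ℕ → ∀ n → List (Subset n)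
subsetsOfSize k n = filter (λ A → ∣ A ∣ ≟ⁿ k) (allSubsets n)

-- The set partition, as its list of blocks, with block A and all other blocks
-- singletons.
blocks : Subset n → List (Subset n)
blocks {n} A = A ∷ map ⁅_⁆ (filter (λ x → ¬? (x ∈ₛ? A)) (allFin n))

------------------------------------------------------------------------
-- Specht modules and intrinsic arrangements

module Representations (K : HeytingField c ℓ₁ ℓ₂) where

  open HeytingField K using (heytingCommutativeRing)
  open CommutativeRing (HeytingCommutativeRing.commutativeRing heytingCommutativeRing)
  open RawMonoidOps *-rawMonoid using () renaming (sum to ∏)
  open RawMonoidOps +-rawMonoid using () renaming (_×_ to _×ⁿ_)

  CharacteristicZero : Set ℓ₂
  CharacteristicZero = ∀ k → HeytingField._#_ K (suc k ×ⁿ 1#) 0#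

  -- Polynomials in n variables over the infinite field K are identified with
  -- polynomial functions Kⁿ → K; Fun n is an ambient space for these.
  Fun : ℕ → Set c
  Fun n = Vector Carrier n → Carrier

  infix 4 _≋_
  _≋_ : Fun n → Fun n → Set (c ⊔ ℓ₁)
  f ≋ g = ∀ x → f x ≈ g x

  0ᶠ : Fun n
  0ᶠ x = 0#

  _⊕_ : Fun n → Fun n → Fun n
  (f ⊕ g) x = f x + g x

  _•_ : Carrier → Fun n → Fun n
  (k • f) x = k * f x

  -- Permutation of the variables.
  _·_ : Permutation′ n → Fun n → Fun n
  (σ · f) x = f (λ i → x (σ ⟨$⟩ʳ i))

  -- The sum of a family of subspaces.
  SumOf : {I : Set a} → (I → Pred (Fun n) ℓ) → Pred (Fun n) (a ⊔ c ⊔ ℓ₁ ⊔ ℓ)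
  SumOf {I = I} W f =
    Σ[ gs ∈ List (Σ[ i ∈ I ] ∃ (W i)) ] f ≋ foldr (λ g s → proj₁ (proj₂ g) ⊕ s) 0ᶠ gs

  Span : {I : Set a} → (I → Fun n) → Pred (Fun n) (a ⊔ c ⊔ ℓ₁)
  Span e = SumOf λ i g → ∃[ k ] g ≋ (k • e i)

  -- ∏_{i < j} (yᵢ − yⱼ)
  Δ : ∀ {k} → Vector Carrier k → Carrier
  Δ {zero}  y = 1#
  Δ {suc k} y = ∏ (λ j → head y - tail y j) * Δ (tail y)

  -- The cells of a Young diagram with the given column lengths: (j , i) lies
  -- in column j and row i.
  Cell : List ℕ → Set
  Cell ν = Σ[ j ∈ Fin (length ν) ] Fin (lookup ν j)

  Tableau : List ℕ → ℕ → Set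
  Tableau μ n = Cell (conjugate μ) ↔ Fin n

  -- The Specht polynomial of a tableau: the product over its columns of the
  -- Vandermonde products in the variables indexed by the column's entries.
  specht : (μ : List ℕ) → Tableau μ n → Fun n
  specht μ t x = ∏ λ j → Δ λ i → x (Inverse.to t (j , i))

  -- Specht's realisation of S^μ inside the polynomials.
  Specht : (μ : List ℕ) → ∀ n → Pred (Fun n) (c ⊔ ℓ₁)
  Specht μ n = Span (specht {n} μ)

  -- S^(n−l,1ˡ), which is 0 by convention unless l < n.
  Sλ : ℕ → ∀ n → Pred (Fun n) (c ⊔ ℓ₁)
  Sλ l n with l <? n
  ... | yes _ = Specht (hook l n) n
  ... | no  _ = _≋ 0ᶠ

  Fixed : Pred (Fun n) ℓ → Permutation′ n → Pred (Fun n) (c ⊔ ℓ₁ ⊔ ℓ)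
  Fixed U σ f = U f × (σ · f) ≋ f

  -- T_α, taken to consist of all transpositions in 𝔖_α.
  Transposition : List (Subset n) → Set
  Transposition {n} α =
    Σ[ (i , j) ∈ Fin n × Fin n ] i ≢ j × Any (λ B → i ∈ₛ B × j ∈ₛ B) α

  H : Pred (Fun n) ℓ → List (Subset n) → Pred (Fun n) (c ⊔ ℓ₁ ⊔ ℓ)
  H U α = SumOf {I = Transposition α} λ ((i , j) , _) → Fixed U (transpose i j)

  -- The set partitions of Fin n with block sizes the conjugate (l + 1 , 1ⁿ⁻ˡ⁻¹)
  -- of (n − l , 1ˡ) are indexed by their block of size l + 1.
  intrinsicArrangement : ℕ → ∀ n → Arrangement (Fun n) (c ⊔ ℓ₁)
  intrinsicArrangement l n = record
    { space      = Sλ l n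
    ; size       = length (subsetsOfSize (suc l) n)
    ; hyperplane = λ i → H (Sλ l n) (blocks (lookup (subsetsOfSize (suc l) n) i))
    }

-- The recursion gives the first Kazhdan–Lusztig coefficient of a matroid as the
-- number of its coatoms minus the number of its atoms. There is at most one atom
-- for each of the C(n, l+1) hyperplanes. For the coatoms, evaluate a polynomial f
-- of the Specht module at the points supported on the l-subsets of [n], with
-- coordinates 1, …, l there. This gives a cochain z f, and H_α consists of the f
-- for which the coboundary φ f = δ (z f) vanishes at the block of size l + 1 of α;
-- that no further condition is needed rests on the Vandermonde identity
-- Σ (-1)ⁱ Δ(y ∖ yᵢ) = 0. Each partition of [n] into l + 1 blocks yields a coatom:
-- the sets meeting some block twice. It is a flat, because the sum of the Specht
-- polynomials of all transversals lies exactly in the hyperplanes of these sets,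
-- and it is maximal, because δ φ = 0 carries the vanishing of φ from one
-- transversal to all others. So f n = S(n, l+1) - C(n, l+1), with S the Stirling
-- number of the second kind, is a lower bound.

module Submission where

open import Defs
open import Algebra.Apartness.Bundles using (HeytingCommutativeRing; HeytingField)
open import Algebra.Bundles using (CommutativeRing)
import Algebra.Definitions.RawMonoid as RawMonoidOps
open import Data.Fin.Base using (Fin; zero; suc)
open import Data.Fin.Permutation using (transpose)
import Data.Fin.Permutation.Components as PC
import Data.Fin.Properties as Fin
open import Data.Fin.Subset as Subset using (Subset; inside; outside; ⊤; _∩_) renaming (_∈_ to _∈ₛ_; _⊆_ to _⊆ₛ_; _⊂_ to _⊂ₛ_; _∉_ to _∉ₛ_)
open import Data.Fin.Subset.Properties using (⊆-antisym; ⊆-refl; ⊆-trans; ⊆⊤; _⊆?_; _⊂?_; ⊂-⊆-trans; ⊆-⊂-trans; p⊂q⇒p⊆q; p⊂q⇒∣p∣<∣q∣; p∩q⊆p; p∩q⊆q; x∈p∩q⁺; ∈⊤; ∣p∣≤n; x∈⁅y⁆⇒x≡y; x∈p∩q⁻; ∣⊤∣≡n) renaming (_∈?_ to _∈ₛ?_)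
open import Data.Integer.Base as ℤ using (ℤ; +_; 0ℤ; 1ℤ; -[1+_]; +<+)
import Data.Integer.Properties as ℤ
open import Data.List.Base using (List; []; _∷_; _++_; map; filter; foldr; length; lookup; upTo; allFin; replicate; cartesianProductWith; applyUpTo; tabulate)
open import Data.List.Extrema.Nat using (max; v≤max⁺; argmax-sel; max≤v⁺)
import Data.List.Membership.DecPropositional as DecPropositional
open import Data.List.Membership.Propositional using (_∈_; _∉_; lose)
open import Data.List.Membership.Propositional.Properties using (∈-∃++; ∈-++⁻; ∈-++⁺ˡ; ∈-++⁺ʳ; ∈-lookup; ∈-map⁺; ∈-map⁻; ∈-filter⁺; ∈-filter⁻; ∈-allFin; ∈-upTo⁺; ∈-upTo⁻; ∈-insert; ∈-cartesianProductWith⁺; ∈-cartesianProductWith⁻)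
open import Data.List.Properties using (length-map; length-++; length-tabulate; filter-accept; filter-reject; map-cong-local; map-++; map-∘; map-cong; map-id-local; ++-identityʳ; ∷-injective; ∷-injectiveˡ; ∷-injectiveʳ; map-injective; ++-assoc; map-tabulate; tabulate-lookup; filter-none; map-applyUpTo; filter-++)
open import Data.List.Relation.Binary.Permutation.Propositional as Perm using (_↭_; ↭-sym; ↭-trans)
open import Data.List.Relation.Binary.Permutation.Propositional.Properties using (shift; ↭-length; ∈-resp-↭; ++⁺ˡ; ↭-map-inv)
open import Data.List.Relation.Unary.All as All using (All; []; _∷_)
import Data.List.Relation.Unary.All.Properties as All
open import Data.List.Relation.Unary.AllPairs using ([]; _∷_)
open import Data.List.Relation.Unary.Any using (Any; here; there; satisfied; index)
open import Data.List.Relation.Unary.Any.Properties using (map⁻; lookup-index)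
open import Data.List.Relation.Unary.Unique.Propositional using (Unique)
open import Data.List.Relation.Unary.Unique.Propositional.Properties using (filter⁺; upTo⁺; cartesianProductWith⁺; allFin⁺; tabulate⁺; ++⁺) renaming (map⁻ to map⁻-unique)
open import Data.Maybe.Base using (Maybe; just; nothing)
open import Data.Nat.Base as ℕ using (ℕ; zero; suc; _≤_; _<_; z≤n; s≤s; _∸_)
open import Data.Nat.Properties as ℕ using (m^n≢0)
open import Data.Nat.Tactic.RingSolver using (solve-∀)
open import Data.Product.Base using (Σ-syntax; ∃; ∃-syntax; _×_; _,_; proj₁; proj₂)
import Data.Rational.Properties as ℚ
open import Data.Rational.Unnormalised.Base as ℚᵘ using (ℚᵘ; mkℚᵘ; *<*)
import Data.Rational.Unnormalised.Properties as ℚᵘ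
open import Data.Sign.Base as Sign using (Sign)
open import Data.Sum.Base using (_⊎_; inj₁; inj₂)
open import Data.Vec.Base as Vec using ([]; _∷_; Vec)
open import Data.Vec.Functional using (Vector; head; tail)
open import Data.Vec.Properties as Vec using (lookup∘tabulate; lookup⇒[]=; []=⇒lookup; lookup-map)
open import Function.Base using (_∘_; id; case_of_)
open import Function.Bundles using (Equivalence; _↔_; Inverse; Injection; mk↔ₛ′)
open import Function.Properties.Inverse using (↔⇒↣)
open import Level using (Level; _⊔_)
open import Relation.Binary.Definitions using (tri<; tri≈; tri>)
open import Relation.Binary.PropositionalEquality as ≡ using (_≡_; _≢_)
open import Relation.Nullary using (¬_; Dec; yes; no; does; contradiction)
open import Relation.Nullary.Decidable using (¬?; _×-dec_; decidable-stable; dec-true; ¬¬-excluded-middle)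
open import Relation.Unary using (Pred)

-- Lists and subsets

private
  variable
    α β γ : Level
    A : Set α
    B : Set β
    n : ℕ

Unique-resp-↭ : {xs ys : List A} → xs ↭ ys → Unique xs → Unique ys
Unique-resp-↭ Perm.refl u = u
Unique-resp-↭ (Perm.prep x p) (x≢ ∷ u) =
  All.tabulate (λ y∈ x≡y → All.lookup x≢ (∈-resp-↭ (↭-sym p) y∈) x≡y) ∷ Unique-resp-↭ p u
Unique-resp-↭ (Perm.swap x y p) ((x≢y ∷ x≢) ∷ y≢ ∷ u) =
  (x≢y ∘ ≡.sym ∷ All.tabulate (λ z∈ → All.lookup y≢ (∈-resp-↭ (↭-sym p) z∈)))
  ∷ All.tabulate (λ z∈ → All.lookup x≢ (∈-resp-↭ (↭-sym p) z∈)) ∷ Unique-resp-↭ p u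
Unique-resp-↭ (Perm.trans p q) u = Unique-resp-↭ q (Unique-resp-↭ p u)

Unique-∉ : {x : A} {xs : List A} → Unique (x ∷ xs) → x ∉ xs
Unique-∉ (x≢ ∷ _) x∈ = All.lookup x≢ x∈ ≡.refl

∉-Unique : {x : A} {xs : List A} → x ∉ xs → Unique xs → Unique (x ∷ xs)
∉-Unique x∉ u = All.tabulate (λ { y∈ ≡.refl → x∉ y∈ }) ∷ u

∈-↭ : {x : A} {xs : List A} → x ∈ xs → ∃[ ys ] xs ↭ x ∷ ys
∈-↭ x∈ with ys , zs , ≡.refl ← ∈-∃++ x∈ = ys ++ zs , shift _ ys zs

≢-∈-tail : {x y : A} {ys : List A} → y ≢ x → y ∈ x ∷ ys → y ∈ ys
≢-∈-tail y≢x (here y≡x) = contradiction y≡x y≢x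
≢-∈-tail y≢x (there y∈) = y∈

Unique-⊆-↭ : {xs ys : List A} → Unique xs → (∀ {x} → x ∈ xs → x ∈ ys) → ∃[ zs ] ys ↭ xs ++ zs
Unique-⊆-↭ {xs = []} _ _ = _ , Perm.refl
Unique-⊆-↭ {xs = x ∷ xs} u@(_ ∷ u′) xs⊆ with ys′ , p ← ∈-↭ (xs⊆ (here ≡.refl))
  with zs , q ← Unique-⊆-↭ {ys = ys′} u′ (λ y∈ → ≢-∈-tail (λ { ≡.refl → Unique-∉ u y∈ }) (∈-resp-↭ p (xs⊆ (there y∈))))
  = zs , ↭-trans p (Perm.prep x q)

Unique-⊆-≥⇒↭ : {xs ys : List A} → Unique xs → (∀ {x} → x ∈ xs → x ∈ ys) → length ys ≤ length xs → ys ↭ xs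
Unique-⊆-≥⇒↭ {xs = xs} {ys} u xs⊆ len with Unique-⊆-↭ u xs⊆
... | [] , p = ≡.subst (ys ↭_) (++-identityʳ xs) p
  where open import Data.List.Properties using (++-identityʳ)
... | z ∷ zs , p = contradiction len (ℕ.<⇒≱ (≡.subst (length xs <_) (≡.sym (≡.trans (↭-length p) (length-++ xs))) (ℕ.m<m+n _ (s≤s z≤n))))

Unique-⊆-length : {xs ys : List A} → Unique xs → (∀ {x} → x ∈ xs → x ∈ ys) → length xs ≤ length ys
Unique-⊆-length {xs = xs} u xs⊆ with zs , p ← Unique-⊆-↭ u xs⊆ =
  ≡.subst (length xs ≤_) (≡.sym (≡.trans (↭-length p) (length-++ xs))) (ℕ.m≤m+n _ _)

Unique-map-∈ : (f : A → B) {xs : List A} → (∀ {x y} → x ∈ xs → y ∈ xs → f x ≡ f y → x ≡ y) → Unique xs → Unique (map f xs)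
Unique-map-∈ f {[]} inj [] = []
Unique-map-∈ f {x ∷ xs} inj u@(_ ∷ u′) =
  ∉-Unique (λ fx∈ → let y , y∈ , eq = ∈-map⁻ f fx∈ in
                    Unique-∉ u (≡.subst (_∈ xs) (≡.sym (inj (here ≡.refl) (there y∈) eq)) y∈))
           (Unique-map-∈ f (λ x∈ y∈ → inj (there x∈) (there y∈)) u′)

++-disjoint : ∀ xs {ys : List A} {x} → Unique (xs ++ ys) → x ∈ xs → x ∉ ys
++-disjoint (y ∷ ys) u (here ≡.refl) x∈ = Unique-∉ u (∈-++⁺ʳ ys x∈)
++-disjoint (y ∷ ys) (_ ∷ u) (there x∈) x∈′ = ++-disjoint ys u x∈ x∈′

Unique-++ˡ : ∀ xs {ys : List A} → Unique (xs ++ ys) → Unique xs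
Unique-++ˡ [] _ = []
Unique-++ˡ (x ∷ xs) u@(_ ∷ u′) = ∉-Unique (λ x∈ → Unique-∉ u (∈-++⁺ˡ x∈)) (Unique-++ˡ xs u′)

Unique-++ʳ : ∀ xs {ys : List A} → Unique (xs ++ ys) → Unique ys
Unique-++ʳ [] u = u
Unique-++ʳ (x ∷ xs) (_ ∷ u) = Unique-++ʳ xs u

filter-↭ : {P : A → Set γ} (P? : ∀ x → Dec (P x)) → ∀ xs → xs ↭ filter (λ x → ¬? (P? x)) xs ++ filter P? xs
filter-↭ P? [] = Perm.refl
filter-↭ P? (x ∷ xs) with P? x
... | yes _ = ↭-trans (Perm.prep x (filter-↭ P? xs)) (↭-sym (shift x (filter (λ x → ¬? (P? x)) xs) (filter P? xs)))
... | no _ = Perm.prep x (filter-↭ P? xs)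

record Overlap {A : Set α} (xs ys : List A) : Set α where
  field
    {left both right} : List A
    xs↭ : xs ↭ left ++ both
    ys↭ : ys ↭ both ++ right
    left∉ : ∀ {x} → x ∈ left → x ∉ ys
    right∉ : ∀ {y} → y ∈ right → y ∉ xs

compare : (∀ (x y : A) → Dec (x ≡ y)) → {xs ys : List A} → Unique xs → Unique ys → Overlap xs ys
compare _≟_ {xs} {ys} uxs uys with _∈?_ ← DecPropositional._∈?_ _≟_
  with zs , p ← Unique-⊆-↭ (filter⁺ (_∈? ys) uxs) (λ x∈ → proj₂ (∈-filter⁻ (_∈? ys) {xs = xs} x∈)) = record
  { xs↭ = filter-↭ (_∈? ys) xs
  ; ys↭ = p
  ; left∉ = λ x∈ → proj₂ (∈-filter⁻ (λ x → ¬? (x ∈? ys)) {xs = xs} x∈)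
  ; right∉ = λ y∈ y∈xs → ++-disjoint (filter (_∈? ys) xs) (Unique-resp-↭ p uys)
      (∈-filter⁺ (_∈? ys) y∈xs (∈-resp-↭ (↭-sym p) (∈-++⁺ʳ _ y∈))) y∈
  }

⊆∧⊉⇒⊂ : {F G : Subset n} → F ⊆ₛ G → ¬ (G ⊆ₛ F) → F ⊂ₛ G
⊆∧⊉⇒⊂ {F = F} {G} F⊆G ¬G⊆F with Fin.any? (λ i → (i ∈ₛ? G) ×-dec ¬? (i ∈ₛ? F))
... | yes p = F⊆G , p
... | no ¬p = contradiction (λ {i} i∈G → decidable-stable (i ∈ₛ? F) (λ i∉F → ¬p (i , i∈G , i∉F))) ¬G⊆F

⊆∧≢⇒⊂ : {F G : Subset n} → F ⊆ₛ G → F ≢ G → F ⊂ₛ G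
⊆∧≢⇒⊂ F⊆G F≢G = ⊆∧⊉⇒⊂ F⊆G (F≢G ∘ ⊆-antisym F⊆G)

⊂⇒≢ : {F G : Subset n} → F ⊂ₛ G → F ≢ G
⊂⇒≢ (_ , _ , x∈ , x∉) ≡.refl = x∉ x∈

∑ℤ-cong : (xs : List A) {f g : A → ℤ} → (∀ {x} → x ∈ xs → f x ≡ g x) → ∑ℤ xs f ≡ ∑ℤ xs g
∑ℤ-cong [] _ = ≡.refl
∑ℤ-cong (x ∷ xs) eq = ≡.cong₂ ℤ._+_ (eq (here ≡.refl)) (∑ℤ-cong xs (eq ∘ there))

∑ℤ-mono : (xs : List A) {f g : A → ℤ} → (∀ {x} → x ∈ xs → f x ℤ.≤ g x) → ∑ℤ xs f ℤ.≤ ∑ℤ xs g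
∑ℤ-mono [] _ = ℤ.≤-refl
∑ℤ-mono (x ∷ xs) le = ℤ.+-mono-≤ (le (here ≡.refl)) (∑ℤ-mono xs (le ∘ there))

∑ℤ-0 : (xs : List A) → ∑ℤ xs (λ _ → 0ℤ) ≡ 0ℤ
∑ℤ-0 [] = ≡.refl
∑ℤ-0 (x ∷ xs) = ≡.trans (ℤ.+-identityˡ _) (∑ℤ-0 xs)

∑ℤ-const : (xs : List A) (c : ℤ) → ∑ℤ xs (λ _ → c) ≡ + length xs ℤ.* c
∑ℤ-const [] c = ≡.sym (ℤ.*-zeroˡ c)
∑ℤ-const (x ∷ xs) c = ≡.trans (≡.cong (ℤ._+_ c) (∑ℤ-const xs c)) (≡.sym (ℤ.suc-* (+ length xs) c))

∑ℤ-↭ : {xs ys : List A} (f : A → ℤ) → xs ↭ ys → ∑ℤ xs f ≡ ∑ℤ ys f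
∑ℤ-↭ f Perm.refl = ≡.refl
∑ℤ-↭ f (Perm.prep x p) = ≡.cong (ℤ._+_ (f x)) (∑ℤ-↭ f p)
∑ℤ-↭ f (Perm.swap x y p) = begin
  f x ℤ.+ (f y ℤ.+ _) ≡⟨ ≡.cong (λ s → f x ℤ.+ (f y ℤ.+ s)) (∑ℤ-↭ f p) ⟩
  f x ℤ.+ (f y ℤ.+ _) ≡⟨ ℤ.+-assoc (f x) (f y) _ ⟨
  (f x ℤ.+ f y) ℤ.+ _ ≡⟨ ≡.cong (ℤ._+ _) (ℤ.+-comm (f x) (f y)) ⟩
  (f y ℤ.+ f x) ℤ.+ _ ≡⟨ ℤ.+-assoc (f y) (f x) _ ⟩
  f y ℤ.+ (f x ℤ.+ _) ∎
  where open ≡.≡-Reasoning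
∑ℤ-↭ f (Perm.trans p q) = ≡.trans (∑ℤ-↭ f p) (∑ℤ-↭ f q)

∑ℤ-++ : (xs {ys} : List A) (f : A → ℤ) → ∑ℤ (xs ++ ys) f ≡ ∑ℤ xs f ℤ.+ ∑ℤ ys f
∑ℤ-++ [] f = ≡.sym (ℤ.+-identityˡ _)
∑ℤ-++ (x ∷ xs) f = ≡.trans (≡.cong (ℤ._+_ (f x)) (∑ℤ-++ xs f)) (≡.sym (ℤ.+-assoc (f x) _ _))

∑ℤ-⊆ : {xs ys : List A} {f : A → ℤ} → Unique xs → Unique ys → (∀ {y} → y ∈ ys → y ∈ xs) →
       (∀ {x} → x ∈ xs → x ∉ ys → 0ℤ ℤ.≤ f x) → ∑ℤ ys f ℤ.≤ ∑ℤ xs f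
∑ℤ-⊆ {xs = xs} {ys} {f} uxs uys ys⊆ nonneg with zs , p ← Unique-⊆-↭ uys ys⊆ = begin
  ∑ℤ ys f               ≡⟨ ℤ.+-identityʳ _ ⟨
  ∑ℤ ys f ℤ.+ 0ℤ        ≡⟨ ≡.cong (ℤ._+_ (∑ℤ ys f)) (∑ℤ-0 zs) ⟨
  ∑ℤ ys f ℤ.+ ∑ℤ zs (λ _ → 0ℤ) ≤⟨ ℤ.+-monoʳ-≤ (∑ℤ ys f) (∑ℤ-mono zs λ z∈ →
     nonneg (∈-resp-↭ (↭-sym p) (∈-++⁺ʳ ys z∈)) (λ z∈ys → ++-disjoint ys (Unique-resp-↭ p uxs) z∈ys z∈)) ⟩
  ∑ℤ ys f ℤ.+ ∑ℤ zs f   ≡⟨ ∑ℤ-++ ys f ⟨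
  ∑ℤ (ys ++ zs) f       ≡⟨ ∑ℤ-↭ f p ⟨
  ∑ℤ xs f               ∎
  where
  open ℤ.≤-Reasoning

∑ℤ-single : {xs : List A} {x : A} (f : A → ℤ) → Unique xs → x ∈ xs → (∀ {y} → y ∈ xs → y ≢ x → f y ≡ 0ℤ) → ∑ℤ xs f ≡ f x
∑ℤ-single {xs = xs} {x} f u x∈ vanish with ys , p ← ∈-↭ x∈ = begin
  ∑ℤ xs f            ≡⟨ ∑ℤ-↭ f p ⟩
  f x ℤ.+ ∑ℤ ys f    ≡⟨ ≡.cong (ℤ._+_ (f x)) (≡.trans (∑ℤ-cong ys λ y∈ → vanish (∈-resp-↭ (↭-sym p) (there y∈))
                          (λ { ≡.refl → Unique-∉ (Unique-resp-↭ p u) y∈ })) (∑ℤ-0 ys)) ⟩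
  f x ℤ.+ 0ℤ         ≡⟨ ℤ.+-identityʳ (f x) ⟩
  f x                ∎
  where open ≡.≡-Reasoning

unique-representatives : {R : A → B → Set γ} {xs : List A} → (∀ {x y i} → x ∈ xs → y ∈ xs → R x i → R y i → x ≡ y) →
  Unique xs → (∀ {x} → x ∈ xs → ∃ (R x)) →
  ∃[ is ] Unique is × length is ≡ length xs × (∀ {i} → i ∈ is → ∃[ x ] x ∈ xs × R x i)
unique-representatives {xs = []} _ _ _ = [] , [] , ≡.refl , λ ()
unique-representatives {xs = x ∷ xs} inj u@(_ ∷ u′) ex
  with is , uis , len , back ← unique-representatives {xs = xs} (λ x∈ y∈ → inj (there x∈) (there y∈)) u′ (ex ∘ there)
     | i , Rxi ← ex (here ≡.refl)
  = i ∷ is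
  , ∉-Unique (λ i∈ → let y , y∈ , Ryi = back i∈ in
      Unique-∉ u (≡.subst (_∈ xs) (inj (there y∈) (here ≡.refl) Ryi Rxi) y∈)) uis
  , ≡.cong suc len
  , λ { (here ≡.refl) → x , here ≡.refl , Rxi ; (there i∈) → let y , y∈ , Ryi = back i∈ in y , there y∈ , Ryi }

select : {P : Fin n → Set γ} → (∀ i → Dec (P i)) → Subset n
select P? = Vec.tabulate (does ∘ P?)

∈-select⁺ : {P : Fin n → Set γ} (P? : ∀ i → Dec (P i)) → ∀ {i} → P i → i ∈ₛ select P?
∈-select⁺ P? {i} Pi = lookup⇒[]= i (select P?) (≡.trans (lookup∘tabulate (does ∘ P?) i) (dec-true (P? i) Pi))

∈-select⁻ : {P : Fin n → Set γ} (P? : ∀ i → Dec (P i)) → ∀ {i} → i ∈ₛ select P? → P i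
∈-select⁻ P? {i} i∈ with P? i | ≡.trans (≡.sym (lookup∘tabulate (does ∘ P?) i)) ([]=⇒lookup i∈)
... | yes Pi | _ = Pi
... | no _ | ()

¬¬-∀ : {P : Fin n → Set γ} → (∀ i → ¬ ¬ P i) → ¬ ¬ (∀ i → P i)
¬¬-∀ {zero} _ k = k λ ()
¬¬-∀ {suc n} h k = h zero λ P0 → ¬¬-∀ (h ∘ suc) λ Ps → k λ { zero → P0 ; (suc i) → Ps i }

elements : Subset n → List (Fin n)
elements [] = []
elements (inside ∷ p) = zero ∷ map suc (elements p)
elements (outside ∷ p) = map suc (elements p)

length-elements : (p : Subset n) → length (elements p) ≡ Subset.∣ p ∣
length-elements [] = ≡.refl
length-elements (inside ∷ p) = ≡.cong suc (≡.trans (length-map suc (elements p)) (length-elements p))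
length-elements (outside ∷ p) = ≡.trans (length-map suc (elements p)) (length-elements p)

elements-unique : (p : Subset n) → Unique (elements p)
elements-unique [] = []
elements-unique (inside ∷ p) = ∉-Unique (λ 0∈ → case ∈-map⁻ suc 0∈ of λ { (_ , _ , ()) }) (Unique-map-∈ suc (λ _ _ → Fin.suc-injective) (elements-unique p))
elements-unique (outside ∷ p) = Unique-map-∈ suc (λ _ _ → Fin.suc-injective) (elements-unique p)

∈-elements⁺ : {p : Subset n} {i : Fin n} → i ∈ₛ p → i ∈ elements p
∈-elements⁺ {p = inside ∷ p} Vec.here = here ≡.refl
∈-elements⁺ {p = inside ∷ p} (Vec.there i∈) = there (∈-map⁺ suc (∈-elements⁺ i∈))
∈-elements⁺ {p = outside ∷ p} (Vec.there i∈) = ∈-map⁺ suc (∈-elements⁺ i∈)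

∈-elements⁻ : {p : Subset n} {i : Fin n} → i ∈ elements p → i ∈ₛ p
∈-elements⁻ {p = inside ∷ p} (here ≡.refl) = Vec.here
∈-elements⁻ {p = inside ∷ p} (there i∈) with j , j∈ , ≡.refl ← ∈-map⁻ suc i∈ = Vec.there (∈-elements⁻ j∈)
∈-elements⁻ {p = outside ∷ p} i∈ with j , j∈ , ≡.refl ← ∈-map⁻ suc i∈ = Vec.there (∈-elements⁻ j∈)

∈-allSubsets : (p : Subset n) → p ∈ allSubsets n
∈-allSubsets [] = here ≡.refl
∈-allSubsets (outside ∷ p) = ∈-++⁺ˡ (∈-map⁺ (outside ∷_) (∈-allSubsets p))
∈-allSubsets {suc n} (inside ∷ p) = ∈-++⁺ʳ (map (outside ∷_) (allSubsets n)) (∈-map⁺ (inside ∷_) (∈-allSubsets p))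

∣select-∈∣ : {xs : List (Fin n)} (∈? : ∀ i → Dec (i ∈ xs)) → Unique xs → Subset.∣ select ∈? ∣ ≡ length xs
∣select-∈∣ {xs = xs} ∈? u = ≡.trans (≡.sym (length-elements (select ∈?))) (ℕ.≤-antisym
  (Unique-⊆-length (elements-unique (select ∈?)) (λ i∈ → ∈-select⁻ ∈? (∈-elements⁻ i∈)))
  (Unique-⊆-length u (λ i∈ → ∈-elements⁺ (∈-select⁺ ∈? i∈))))

Unique-map-injective : (f : A → B) {xs : List A} → Unique (map f xs) → ∀ {x y} → x ∈ xs → y ∈ xs → f x ≡ f y → x ≡ y
Unique-map-injective f u (here ≡.refl) (here ≡.refl) eq = ≡.refl
Unique-map-injective f u (here ≡.refl) (there y∈) eq = contradiction (≡.subst (_∈ map f _) (≡.sym eq) (∈-map⁺ f y∈)) (Unique-∉ u)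
Unique-map-injective f u (there x∈) (here ≡.refl) eq = contradiction (≡.subst (_∈ map f _) eq (∈-map⁺ f x∈)) (Unique-∉ u)
Unique-map-injective f (_ ∷ u) (there x∈) (there y∈) eq = Unique-map-injective f u x∈ y∈ eq

-- Kazhdan–Lusztig polynomials of lattices of flats

monomial-≡ : ∀ c d → monomial c d d ≡ c
monomial-≡ c d with d ℕ.≟ d
... | yes _ = ≡.refl
... | no d≢d = contradiction ≡.refl d≢d

monomial-≢ : ∀ c {d k} → d ≢ k → monomial c d k ≡ 0ℤ
monomial-≢ c {d} {k} d≢k with d ℕ.≟ k
... | yes d≡k = contradiction d≡k d≢k
... | no _ = ≡.refl

reverse-≤ : ∀ {r k} (p : Poly) → k ≤ r → reverse r p k ≡ p (r ∸ k)
reverse-≤ {r} {k} p k≤r with k ℕ.≤? r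
... | yes _ = ≡.refl
... | no k≰r = contradiction k≤r k≰r

module Lattice {m} {L : List (Subset m)} (unique : Unique L) (⊤∈ : ⊤ ∈ L)
  (∩∈ : ∀ {F G} → F ∈ L → G ∈ L → F ∩ G ∈ L) where

  open Flats L
  open ≡ using (refl; sym; trans; cong; cong₂; subst; subst₂)
  open import Data.Nat.Base using (_+_; _*_)
  open Subset using (∣_∣)

  private
    variable
      F G H X : Subset m
      j k : ℕ

  data Chain : Subset m → Subset m → ℕ → Set where
    nil  : F ⊆ₛ G → Chain F G 0
    cons : F ⊂ₛ H → H ∈ L → Chain H G k → Chain F G (suc k)

  Chain-⊆ : Chain F G k → F ⊆ₛ G
  Chain-⊆ (nil F⊆G) = F⊆G
  Chain-⊆ (cons F⊂H _ c) = Chain-⊆ c ∘ p⊂q⇒p⊆q F⊂H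

  extend : F ⊆ₛ G → Chain G H k → Chain F H k
  extend F⊆G (nil G⊆H) = nil (⊆-trans F⊆G G⊆H)
  extend F⊆G (cons G⊂X X∈ c) = cons (⊆-⊂-trans F⊆G G⊂X) X∈ c

  append : Chain F G j → Chain G H k → Chain F H (j + k)
  append (nil F⊆G) d = extend F⊆G d
  append (cons F⊂X X∈ c) d = cons F⊂X X∈ (append c d)

  snoc : Chain F G k → G ⊂ₛ H → H ∈ L → Chain F H (suc k)
  snoc {k = k} c G⊂H H∈ = subst (Chain _ _) (ℕ.+-comm k 1) (append c (cons G⊂H H∈ (nil id)))

  unsnoc : F ∈ L → Chain F G (suc k) → ∃[ H ] H ∈ L × H ⊂ₛ G × Chain F H k
  unsnoc F∈ (cons F⊂H H∈ (nil H⊆G)) = _ , F∈ , ⊂-⊆-trans F⊂H H⊆G , nil ⊆-refl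
  unsnoc F∈ (cons F⊂H H∈ c@(cons _ _ _)) with X , X∈ , X⊂G , d ← unsnoc H∈ c =
    X , X∈ , X⊂G , cons F⊂H H∈ d

  ∈-[⟩⁻ : H ∈ [ F , G ⟩ → H ∈ L × F ⊆ₛ H × H ⊂ₛ G
  ∈-[⟩⁻ {F = F} {G} = ∈-filter⁻ (λ H → (F ⊆? H) ×-dec (H ⊂? G))

  ∈-[⟩⁺ : H ∈ L → F ⊆ₛ H → H ⊂ₛ G → H ∈ [ F , G ⟩
  ∈-[⟩⁺ {F = F} {G} H∈ F⊆H H⊂G = ∈-filter⁺ (λ H → (F ⊆? H) ×-dec (H ⊂? G)) H∈ (F⊆H , H⊂G)

  ∈-[]⁻ : H ∈ [ F , G ] → H ∈ L × F ⊆ₛ H × H ⊆ₛ G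
  ∈-[]⁻ {F = F} {G} = ∈-filter⁻ (λ H → (F ⊆? H) ×-dec (H ⊆? G))

  ∈-[]⁺ : H ∈ L → F ⊆ₛ H → H ⊆ₛ G → H ∈ [ F , G ]
  ∈-[]⁺ {F = F} {G} H∈ F⊆H H⊆G = ∈-filter⁺ (λ H → (F ⊆? H) ×-dec (H ⊆? G)) H∈ (F⊆H , H⊆G)

  []-unique : Unique [ F , G ]
  []-unique {F} {G} = filter⁺ (λ H → (F ⊆? H) ×-dec (H ⊆? G)) unique

  [⟩-unique : Unique [ F , G ⟩
  [⟩-unique {F} {G} = filter⁺ (λ H → (F ⊆? H) ×-dec (H ⊂? G)) unique

  height-chain : ∀ d → G ∈ L → F ⊆ₛ G → Chain F G (height d F G)
  height-chain zero G∈ F⊆G = nil F⊆G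
  height-chain {G} {F} (suc d) G∈ F⊆G with argmax-sel id 0 (map (λ H → suc (height d F H)) [ F , G ⟩)
  ... | inj₁ eq rewrite eq = nil F⊆G
  ... | inj₂ mem with H , H∈ , eq ← ∈-map⁻ (λ H → suc (height d F H)) mem rewrite eq
      with H∈L , F⊆H , H⊂G ← ∈-[⟩⁻ H∈ = snoc (height-chain d H∈L F⊆H) H⊂G G∈

  chain-height : ∀ d → ∣ G ∣ ≤ d → F ∈ L → Chain F G k → k ≤ height d F G
  chain-height {k = zero} _ _ _ _ = z≤n
  chain-height {G} {F} {k = suc k} d le F∈ c with H , H∈ , H⊂G , c′ ← unsnoc F∈ c with d
  ... | zero = contradiction (ℕ.<-≤-trans (p⊂q⇒∣p∣<∣q∣ H⊂G) le) ℕ.n≮0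
  ... | suc d = v≤max⁺ 0 _ (inj₂ (lose (∈-map⁺ (λ H → suc (height d F H)) (∈-[⟩⁺ H∈ (Chain-⊆ c′) H⊂G))
                  (s≤s (chain-height d (ℕ.≤-pred (ℕ.<-≤-trans (p⊂q⇒∣p∣<∣q∣ H⊂G) le)) F∈ c′))))

  rk-chain : G ∈ L → F ⊆ₛ G → Chain F G (rk F G)
  rk-chain {G} = height-chain ∣ G ∣

  chain-rk : F ∈ L → Chain F G k → k ≤ rk F G
  chain-rk {G = G} = chain-height ∣ G ∣ ℕ.≤-refl

  rk-+ : F ∈ L → G ∈ L → H ∈ L → F ⊆ₛ G → G ⊆ₛ H → rk F G + rk G H ≤ rk F H
  rk-+ F∈ G∈ H∈ F⊆G G⊆H = chain-rk F∈ (append (rk-chain G∈ F⊆G) (rk-chain H∈ G⊆H))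

  rk-pos : F ∈ L → G ∈ L → F ⊂ₛ G → 0 < rk F G
  rk-pos F∈ G∈ F⊂G = chain-rk F∈ (cons F⊂G G∈ (nil id))

  rk-≡ : F ∈ L → rk F F ≡ 0
  rk-≡ {F} F∈ with rk F F in eq | rk-chain F∈ (⊆-refl {x = F})
  ... | zero | _ = refl
  ... | suc _ | cons F⊂H _ c = contradiction (⊂-⊆-trans F⊂H (Chain-⊆ c)) (λ F⊂F → ⊂⇒≢ F⊂F refl)

  rk-2 : F ∈ L → G ∈ L → H ∈ L → F ⊂ₛ G → G ⊂ₛ H → 2 ≤ rk F H
  rk-2 F∈ G∈ H∈ F⊂G G⊂H = chain-rk F∈ (cons F⊂G G∈ (cons G⊂H H∈ (nil id)))

  rk-coatom-1 : G ∈ L → G ⊂ₛ ⊤ → (∀ {H} → H ∈ L → G ⊂ₛ H → H ≡ ⊤) → rk G ⊤ ≡ 1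
  rk-coatom-1 {G} G∈ G⊂⊤ top = ℕ.≤-antisym (at-most (rk-chain ⊤∈ ⊆⊤)) (rk-pos G∈ ⊤∈ G⊂⊤)
    where
    at-most : ∀ {k} → Chain G ⊤ k → k ≤ 1
    at-most (nil _) = z≤n
    at-most (cons _ _ (nil _)) = s≤s z≤n
    at-most (cons G⊂H H∈ (cons H⊂X _ _)) with refl ← top H∈ G⊂H | _ , _ , _ , x∉ ← H⊂X = contradiction ∈⊤ x∉

  monomial-nonneg : ∀ {c d k} → (d ≡ k → 0ℤ ℤ.≤ c) → 0ℤ ℤ.≤ monomial c d k
  monomial-nonneg {c} {d} {k} nn with d ℕ.≟ k
  ... | yes eq = nn eq
  ... | no _ = ℤ.≤-refl

  möbius-refl : ∀ F d → möbius d F F ≡ 1ℤ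
  möbius-refl F d with F ≟ F
  möbius-refl F zero | yes _ = refl
  möbius-refl F (suc _) | yes _ = refl
  möbius-refl F d | no F≢F = contradiction refl F≢F

  μ-refl : ∀ F → μ F F ≡ 1ℤ
  μ-refl F = möbius-refl F ∣ F ∣

  χ-zero : F ∈ L → G ∈ L → F ⊆ₛ G → rk F G < k → χ F G k ≡ 0ℤ
  χ-zero {F} {G} {k} F∈ G∈ F⊆G lt = trans (∑ℤ-cong [ F , G ] {λ H → monomial (μ F H) (rk H G) k} vanish) (∑ℤ-0 [ F , G ])
    where
    vanish : ∀ {H} → H ∈ [ F , G ] → monomial (μ F H) (rk H G) k ≡ 0ℤ
    vanish {H} H∈′ with H∈ , F⊆H , H⊆G ← ∈-[]⁻ H∈′ = monomial-≢ _ (ℕ.<⇒≢ (ℕ.≤-<-trans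
      (ℕ.≤-trans (ℕ.m≤n+m (rk H G) (rk F H)) (rk-+ F∈ H∈ G∈ F⊆H H⊆G)) lt))

  χ-term-nonneg : F ∈ L → G ∈ L → rk F G ≤ k → H ∈ [ F , G ] → 0ℤ ℤ.≤ monomial (μ F H) (rk H G) k
  χ-term-nonneg {F} {G} {k} {H} F∈ G∈ le H∈′ with H∈ , F⊆H , H⊆G ← ∈-[]⁻ H∈′ = cases (F ≟ H)
    where
    cases : Dec (F ≡ H) → 0ℤ ℤ.≤ monomial (μ F H) (rk H G) k
    cases (yes refl) = monomial-nonneg (λ _ → subst (0ℤ ℤ.≤_) (sym (μ-refl F)) (ℤ.+≤+ z≤n))
    cases (no F≢H) = ℤ.≤-reflexive (sym (monomial-≢ _ (ℕ.<⇒≢ (ℕ.<-≤-trans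
      (ℕ.<-≤-trans (ℕ.+-monoˡ-≤ (rk H G) (rk-pos F∈ H∈ (⊆∧≢⇒⊂ F⊆H F≢H))) (rk-+ F∈ H∈ G∈ F⊆H H⊆G)) le))))

  χ-nonneg : F ∈ L → G ∈ L → rk F G ≤ k → 0ℤ ℤ.≤ χ F G k
  χ-nonneg {F} {G} F∈ G∈ le = subst (ℤ._≤ χ F G _) (∑ℤ-0 [ F , G ]) (∑ℤ-mono [ F , G ] (χ-term-nonneg F∈ G∈ le))

  χ-lead : F ∈ L → G ∈ L → F ⊆ₛ G → rk F G ≡ k → 1ℤ ℤ.≤ χ F G k
  χ-lead {F} {G} F∈ G∈ F⊆G refl = subst (ℤ._≤ χ F G (rk F G))
    (trans (ℤ.+-identityʳ _) (trans (monomial-≡ (μ F F) (rk F G)) (μ-refl F)))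
    (∑ℤ-⊆ {ys = F ∷ []} []-unique ([] ∷ []) (λ { (here refl) → ∈-[]⁺ F∈ ⊆-refl F⊆G })
      (λ H∈ _ → χ-term-nonneg F∈ G∈ ℕ.≤-refl H∈))

  Unique-const : ∀ {xs : List (Subset m)} {x} → Unique xs → (∀ {y} → y ∈ xs → y ≡ x) → (f : Subset m → ℤ) → 0ℤ ℤ.≤ f x → ∑ℤ xs f ℤ.≤ f x
  Unique-const {[]} _ _ f 0≤ = 0≤
  Unique-const {y ∷ []} _ eq f _ rewrite eq (here refl) = ℤ.≤-reflexive (ℤ.+-identityʳ _)
  Unique-const {y ∷ z ∷ _} ((y≢z ∷ _) ∷ _) eq f _ = contradiction (trans (eq (here refl)) (sym (eq (there (here refl))))) y≢z

  μ-atom : F ∈ L → G ∈ L → rk F G ≤ 1 → ℤ.- 1ℤ ℤ.≤ μ F G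
  μ-atom {F} {G} F∈ G∈ le = go ∣ G ∣
    where
    go : ∀ d → ℤ.- 1ℤ ℤ.≤ möbius d F G
    go d with F ≟ G
    go zero | yes _ = ℤ.-≤+
    go (suc _) | yes _ = ℤ.-≤+
    go zero | no _ = ℤ.-≤+
    go (suc d) | no _ = ℤ.neg-mono-≤ (subst (∑ℤ [ F , G ⟩ (möbius d F) ℤ.≤_) (möbius-refl F d)
      (Unique-const [⟩-unique only (möbius d F) (subst (0ℤ ℤ.≤_) (sym (möbius-refl F d)) (ℤ.+≤+ z≤n))))
      where
      only : ∀ {H} → H ∈ [ F , G ⟩ → H ≡ F
      only {H} H∈′ with H∈ , F⊆H , H⊂G ← ∈-[⟩⁻ H∈′ | H ≟ F
      ... | yes eq = eq
      ... | no H≢F = contradiction (rk-2 F∈ H∈ G∈ (⊆∧≢⇒⊂ F⊆H (H≢F ∘ sym)) H⊂G) (ℕ.<⇒≱ (s≤s le))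

  module _ {P : Subset m → Poly} (kl : IsKLFamily P) where
    open IsKLFamily kl

    conv-const : ∀ {p q : Poly} {k} → (∀ {j} → 0 < j → q j ≡ 0ℤ) → (p *ₚ q) k ≡ p k ℤ.* q 0
    conv-const {p} {q} {k} q≡0 = trans
      (∑ℤ-single (λ i → p i ℤ.* q (k ∸ i)) (upTo⁺ (suc k)) (∈-upTo⁺ ℕ.≤-refl) vanish)
      (cong (λ j → p k ℤ.* q j) (ℕ.n∸n≡0 k))
      where
      vanish : ∀ {i} → i ∈ upTo (suc k) → i ≢ k → p i ℤ.* q (k ∸ i) ≡ 0ℤ
      vanish {i} i∈ i≢k = trans (cong (ℤ._*_ (p i)) (q≡0 (ℕ.m<n⇒0<n∸m (ℕ.≤∧≢⇒< (ℕ.≤-pred (∈-upTo⁻ i∈)) i≢k)))) (ℤ.*-zeroʳ (p i))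

    P⊤ : ∀ {j} → P ⊤ j ≡ monomial 1ℤ 0 j
    P⊤ {j} = rank-0 ⊤∈ (rk-≡ ⊤∈) j

    ⊤-term : (χ F ⊤ *ₚ P ⊤) k ≡ χ F ⊤ k
    ⊤-term {F} {k} = trans (conv-const {χ F ⊤} {P ⊤} (λ { {suc j} _ → P⊤ })) (trans (cong (ℤ._*_ (χ F ⊤ k)) (P⊤ {0})) (ℤ.*-identityʳ _))

    degree-1 : G ∈ L → rk G ⊤ ≡ 1 → ∀ {j} → 0 < j → P G j ≡ 0ℤ
    degree-1 {G} G∈ eq {j} 0<j = degree G∈ (subst (0 <_) (sym eq) (s≤s z≤n)) j
      (subst (_≤ 2 * j) (sym eq) (ℕ.≤-trans 0<j (ℕ.m≤m+n j _)))

    rk-⊤ : G ∈ L → G ≢ ⊤ → 0 < rk G ⊤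
    rk-⊤ G∈ G≢⊤ = rk-pos G∈ ⊤∈ (⊆∧≢⇒⊂ ⊆⊤ G≢⊤)

    coefficient-0 : G ∈ L → rk G ⊤ ≡ 1 → 1ℤ ℤ.≤ P G 0
    coefficient-0 {G} G∈ eq = begin
      1ℤ                                ≤⟨ χ-lead G∈ ⊤∈ ⊆⊤ eq ⟩
      χ G ⊤ 1                           ≡⟨ trans (ℤ.+-identityʳ _) ⊤-term ⟨
      ∑ℤ (⊤ ∷ []) (λ X → (χ G X *ₚ P X) 1) ≤⟨ ∑ℤ-⊆ []-unique ([] ∷ []) (λ { (here refl) → ∈-[]⁺ ⊤∈ ⊆⊤ id })
                                              (λ X∈ X∉ → ℤ.≤-reflexive (sym (vanish X∈ (X∉ ∘ here)))) ⟩
      ∑ℤ [ G , ⊤ ] (λ X → (χ G X *ₚ P X) 1) ≡⟨ recursion G∈ 1 ⟨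
      reverse (rk G ⊤) (P G) 1          ≡⟨ cong (λ r → reverse r (P G) 1) eq ⟩
      P G 0                             ∎
      where
      open ℤ.≤-Reasoning
      vanish : ∀ {X} → X ∈ [ G , ⊤ ] → X ≢ ⊤ → (χ G X *ₚ P X) 1 ≡ 0ℤ
      vanish {X} X∈′ X≢⊤ with X∈ , G⊆X , X⊆⊤ ← ∈-[]⁻ X∈′ | G ≟ X
      ... | yes refl = trans (conv-const {χ G G} {P G} (degree-1 G∈ eq)) (cong (ℤ._* P G 0)
                         (χ-zero G∈ G∈ id (subst (_< 1) (sym (rk-≡ G∈)) (s≤s z≤n))))
      ... | no G≢X = contradiction (rk-2 G∈ X∈ ⊤∈ (⊆∧≢⇒⊂ G⊆X G≢X) (⊆∧≢⇒⊂ ⊆⊤ X≢⊤)) (ℕ.<⇒≱ (subst (_< 2) (sym eq) ℕ.≤-refl))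

    count-monomial : ∀ {a} {A : Set a} (d : A → ℕ) k xs → ∑ℤ xs (λ x → monomial (ℤ.- 1ℤ) (d x) k) ≡ ℤ.- (+ length (filter (λ x → d x ℕ.≟ k) xs))
    count-monomial d k [] = refl
    count-monomial d k (x ∷ xs) = cases (d x ℕ.≟ k)
      where
      Q? = λ x → d x ℕ.≟ k
      cases : Dec (d x ≡ k) → monomial (ℤ.- 1ℤ) (d x) k ℤ.+ ∑ℤ xs (λ x → monomial (ℤ.- 1ℤ) (d x) k) ≡ ℤ.- (+ length (filter Q? (x ∷ xs)))
      cases (yes refl) rewrite filter-accept Q? {x} {xs} refl =
        trans (cong₂ ℤ._+_ (monomial-≡ (ℤ.- 1ℤ) k) (count-monomial d k xs)) (sym (ℤ.neg-distrib-+ 1ℤ (+ length (filter Q? xs))))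
      cases (no dx≢k) rewrite filter-reject Q? {x} {xs} dx≢k =
        trans (cong₂ ℤ._+_ (monomial-≢ (ℤ.- 1ℤ) dx≢k) (count-monomial d k xs)) (ℤ.+-identityˡ _)

    module _ {B : Subset m} (B∈ : B ∈ L) (B⊆ : ∀ {F} → F ∈ L → B ⊆ₛ F) {r : ℕ} (rk-B : rk B ⊤ ≡ suc r) where

      rk-bound : G ∈ L → rk B G + rk G ⊤ ≤ suc r
      rk-bound {G} G∈ = subst (rk B G + rk G ⊤ ≤_) rk-B (rk-+ B∈ G∈ ⊤∈ (B⊆ G∈) ⊆⊤)

      Atom? : ∀ H → Dec (rk H ⊤ ≡ r)
      Atom? H = rk H ⊤ ℕ.≟ r

      rk-atom : H ∈ L → rk H ⊤ ≡ r → rk B H ≤ 1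
      rk-atom {H} H∈ eq = ℕ.+-cancelʳ-≤ r (rk B H) 1 (subst (λ s → rk B H + s ≤ suc r) eq (rk-bound H∈))

      atom-unique : ∀ {i} → H ∈ L → G ∈ L → rk H ⊤ ≡ r → i ∈ₛ H → i ∉ₛ B → i ∈ₛ G → H ⊆ₛ G
      atom-unique {H} {G} H∈ G∈ H-atom i∈H i∉B i∈G with H ≟ H ∩ G
      ... | yes H≡ = subst (_⊆ₛ G) (sym H≡) (p∩q⊆q H G)
      ... | no H≢ = contradiction
        (rk-2 B∈ (∩∈ H∈ G∈) H∈ (B⊆ (∩∈ H∈ G∈) , _ , x∈p∩q⁺ (i∈H , i∈G) , i∉B) (⊆∧≢⇒⊂ (p∩q⊆p H G) (H≢ ∘ sym)))
        (ℕ.<⇒≱ (s≤s (rk-atom H∈ H-atom)))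

      atoms : List (Subset m)
      atoms = filter Atom? [ B , ⊤ ]

      ∈-atoms : H ∈ atoms → H ∈ L × rk H ⊤ ≡ r
      ∈-atoms H∈′ with H∈ , eq ← ∈-filter⁻ Atom? H∈′ = proj₁ (∈-[]⁻ H∈) , eq

      atoms-≤ : length atoms ≤ m
      atoms-≤ with is , uis , len , _ ← unique-representatives {R = λ H i → i ∈ₛ H × i ∉ₛ B}
                     (λ H∈′ G∈′ (i∈H , i∉B) (i∈G , _) → let H∈ , H-atom = ∈-atoms H∈′ ; G∈ , G-atom = ∈-atoms G∈′ in
                        ⊆-antisym (atom-unique H∈ G∈ H-atom i∈H i∉B i∈G) (atom-unique G∈ H∈ G-atom i∈G i∉B i∈H))
                     (filter⁺ Atom? []-unique)
                     (λ H∈′ → let H∈ , H-atom = ∈-atoms H∈′ in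
                        proj₂ (⊆∧≢⇒⊂ (B⊆ H∈) (λ { refl → contradiction (trans (sym H-atom) rk-B) (ℕ.<⇒≢ ℕ.≤-refl) })))
        = subst₂ _≤_ len (length-tabulate id) (Unique-⊆-length {ys = allFin m} uis (λ {i} _ → ∈-allFin i))

      ⊤-coefficient : ℤ.- (+ m) ℤ.≤ χ B ⊤ r
      ⊤-coefficient = begin
        ℤ.- (+ m)                    ≤⟨ ℤ.neg-mono-≤ (ℤ.+≤+ atoms-≤) ⟩
        ℤ.- (+ length atoms)         ≡⟨ count-monomial (λ H → rk H ⊤) r [ B , ⊤ ] ⟨
        ∑ℤ [ B , ⊤ ] (λ H → monomial (ℤ.- 1ℤ) (rk H ⊤) r) ≤⟨ ∑ℤ-mono [ B , ⊤ ] (λ {H} → term H) ⟩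
        χ B ⊤ r                      ∎
        where
        open ℤ.≤-Reasoning
        term : ∀ H → H ∈ [ B , ⊤ ] → monomial (ℤ.- 1ℤ) (rk H ⊤) r ℤ.≤ monomial (μ B H) (rk H ⊤) r
        term H H∈ with rk H ⊤ ℕ.≟ r
        ... | yes eq = μ-atom B∈ (proj₁ (∈-[]⁻ H∈)) (rk-atom (proj₁ (∈-[]⁻ H∈)) eq)
        ... | no _ = ℤ.≤-refl

      coatom-term : G ∈ L → rk G ⊤ ≡ 1 → (χ B G *ₚ P G) r ≡ χ B G r ℤ.* P G 0
      coatom-term {G} G∈ eq = conv-const {χ B G} {P G} (degree-1 G∈ eq)

      low-term : G ∈ L → 2 ≤ rk G ⊤ → (χ B G *ₚ P G) r ≡ 0ℤ
      low-term {G} G∈ 2≤ = trans (∑ℤ-cong (upTo (suc r)) {λ i → χ B G i ℤ.* P G (r ∸ i)} vanish) (∑ℤ-0 (upTo (suc r)))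
        where
        2*-≥ : ∀ {c j} → 2 ≤ c → c ≤ suc j → c ≤ 2 * j
        2*-≥ {suc (suc c)} {suc j} _ (s≤s c≤j) = ℕ.≤-trans (s≤s c≤j) (ℕ.m<m+n (suc j) (s≤s z≤n))
        2*-≥ {suc (suc c)} {zero} _ (s≤s ())
        2*-≥ {suc zero} (s≤s ())
        vanish : ∀ {i} → i ∈ upTo (suc r) → χ B G i ℤ.* P G (r ∸ i) ≡ 0ℤ
        vanish {i} i∈ with ℕ.<-cmp i (suc (rk B G))
        ... | tri≈ _ refl _ = cong (ℤ._* P G (r ∸ i)) (χ-zero B∈ G∈ (B⊆ G∈) ℕ.≤-refl)
        ... | tri> _ _ gt = cong (ℤ._* P G (r ∸ i)) (χ-zero B∈ G∈ (B⊆ G∈) (ℕ.<-trans ℕ.≤-refl gt))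
        ... | tri< (s≤s i≤) _ _ = trans (cong (ℤ._*_ (χ B G i)) (degree G∈ (ℕ.<-trans (s≤s z≤n) 2≤) (r ∸ i)
              (2*-≥ 2≤ (ℕ.≤-trans (ℕ.m+n≤o⇒m≤o∸n (rk G ⊤) (subst (_≤ suc r) (ℕ.+-comm i (rk G ⊤)) (ℕ.≤-trans (ℕ.+-monoˡ-≤ (rk G ⊤) i≤) (rk-bound G∈)))) (ℕ.≤-reflexive (ℕ.+-∸-assoc 1 (ℕ.≤-pred (∈-upTo⁻ i∈))))))))
              (ℤ.*-zeroʳ (χ B G i))

      first-coefficient-≥ : ∀ {Gs} → Unique Gs → (∀ {G} → G ∈ Gs → G ∈ L × rk G ⊤ ≡ 1 × r ≤ rk B G) →
        + length Gs ℤ.- + m ℤ.≤ P B 1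
      first-coefficient-≥ {Gs} uGs coatoms = begin
        + length Gs ℤ.- + m         ≡⟨ ℤ.+-comm (+ length Gs) (ℤ.- (+ m)) ⟩
        ℤ.- (+ m) ℤ.+ + length Gs   ≤⟨ ℤ.+-mono-≤ (subst (ℤ.- (+ m) ℤ.≤_) (sym ⊤-term) ⊤-coefficient)
                                        (subst (ℤ._≤ ∑ℤ Gs term) (trans (∑ℤ-const Gs 1ℤ) (ℤ.*-identityʳ _)) (∑ℤ-mono Gs coatom-≥1)) ⟩
        ∑ℤ (⊤ ∷ Gs) term            ≤⟨ ∑ℤ-⊆ []-unique (∉-Unique ⊤∉ uGs)
                                        (λ { (here refl) → ∈-[]⁺ ⊤∈ ⊆⊤ id ; (there G∈) → let G∈L , _ = coatoms G∈ in ∈-[]⁺ G∈L (B⊆ G∈L) ⊆⊤ })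
                                        (λ X∈ X∉ → nonneg (proj₁ (∈-[]⁻ X∈)) (X∉ ∘ here)) ⟩
        ∑ℤ [ B , ⊤ ] term           ≡⟨ recursion B∈ r ⟨
        reverse (rk B ⊤) (P B) r    ≡⟨ cong (λ s → reverse s (P B) r) rk-B ⟩
        reverse (suc r) (P B) r     ≡⟨ reverse-≤ (P B) (ℕ.n≤1+n r) ⟩
        P B (suc r ∸ r)             ≡⟨ cong (P B) (ℕ.m+n∸n≡m 1 r) ⟩
        P B 1                       ∎
        where
        open ℤ.≤-Reasoning
        term : Subset m → ℤ
        term G = (χ B G *ₚ P G) r
        ⊤∉ : ⊤ ∉ Gs
        ⊤∉ ⊤∈Gs with _ , eq , _ ← coatoms ⊤∈Gs = contradiction (trans (sym (rk-≡ ⊤∈)) eq) λ ()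
        *-mono : ∀ {a b} → 0ℤ ℤ.≤ a → 1ℤ ℤ.≤ b → a ℤ.≤ a ℤ.* b
        *-mono {a} {b} 0≤a 1≤b = subst (ℤ._≤ a ℤ.* b) (ℤ.*-identityʳ a) (ℤ.*-monoˡ-≤-nonNeg a {{ℤ.nonNegative 0≤a}} 1≤b)
        coatom-≥1 : ∀ {G} → G ∈ Gs → 1ℤ ℤ.≤ term G
        coatom-≥1 {G} G∈′ with G∈ , eq , r≤ ← coatoms G∈′ = subst (1ℤ ℤ.≤_) (sym (coatom-term G∈ eq))
          (ℤ.≤-trans lead (*-mono (ℤ.≤-trans (ℤ.+≤+ z≤n) lead) (coefficient-0 G∈ eq)))
          where
          rk-G : rk B G ≡ r
          rk-G = ℕ.≤-antisym (ℕ.≤-pred (ℕ.≤-trans (ℕ.≤-reflexive (trans (ℕ.+-comm 1 _) (cong (_+_ (rk B G)) (sym eq)))) (rk-bound G∈))) r≤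
          lead : 1ℤ ℤ.≤ χ B G r
          lead = χ-lead B∈ G∈ (B⊆ G∈) rk-G
        nonneg : ∀ {X} → X ∈ L → X ≢ ⊤ → 0ℤ ℤ.≤ term X
        nonneg {X} X∈ X≢⊤ with ℕ.<-cmp (rk X ⊤) 1
        ... | tri< lt _ _ = contradiction (rk-⊤ X∈ X≢⊤) (ℕ.<⇒≱ lt)
        ... | tri> _ _ gt = ℤ.≤-reflexive (sym (low-term X∈ gt))
        ... | tri≈ _ eq _ = subst (0ℤ ℤ.≤_) (sym (coatom-term X∈ eq)) (ℤ.≤-trans χ≥0 (*-mono χ≥0 (coefficient-0 X∈ eq)))
          where
          χ≥0 : 0ℤ ℤ.≤ χ B X r
          χ≥0 = χ-nonneg B∈ X∈ (ℕ.≤-pred (ℕ.≤-trans (ℕ.≤-reflexive (trans (ℕ.+-comm 1 _) (cong (_+_ (rk B X)) (sym eq)))) (rk-bound X∈)))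

  closure : Subset m → Fin m → Subset m
  closure F e = foldr _∩_ ⊤ (filter (λ X → (F ⊆? X) ×-dec (e ∈ₛ? X)) L)

  closure-∈ : ∀ F e → closure F e ∈ L
  closure-∈ F e = go _ (λ X∈ → proj₁ (∈-filter⁻ (λ X → (F ⊆? X) ×-dec (e ∈ₛ? X)) X∈))
    where
    go : ∀ Xs → (∀ {X} → X ∈ Xs → X ∈ L) → foldr _∩_ ⊤ Xs ∈ L
    go [] _ = ⊤∈
    go (X ∷ Xs) Xs⊆ = ∩∈ (Xs⊆ (here refl)) (go Xs (Xs⊆ ∘ there))

  ∈-closure : ∀ {F e i} → (∀ {X} → X ∈ L → F ⊆ₛ X → e ∈ₛ X → i ∈ₛ X) → i ∈ₛ closure F e
  ∈-closure {F} {e} {i} all = go _ (λ X∈ → let X∈L , F⊆X , e∈X = ∈-filter⁻ (λ X → (F ⊆? X) ×-dec (e ∈ₛ? X)) X∈ in all X∈L F⊆X e∈X)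
    where
    go : ∀ Xs → (∀ {X} → X ∈ Xs → i ∈ₛ X) → i ∈ₛ foldr _∩_ ⊤ Xs
    go [] _ = ∈⊤
    go (X ∷ Xs) i∈ = x∈p∩q⁺ (i∈ (here refl) , go Xs (i∈ ∘ there))

  closure-⊇ : ∀ {F e} → F ⊆ₛ closure F e
  closure-⊇ i∈F = ∈-closure (λ _ F⊆X _ → F⊆X i∈F)

  closure-∋ : ∀ {F e} → e ∈ₛ closure F e
  closure-∋ = ∈-closure (λ _ _ e∈X → e∈X)

  closure-⊆ : ∀ {F e} → X ∈ L → F ⊆ₛ X → e ∈ₛ X → closure F e ⊆ₛ X
  closure-⊆ {X} {F} {e} X∈ F⊆X e∈X = go (∈-filter⁺ (λ X → (F ⊆? X) ×-dec (e ∈ₛ? X)) X∈ (F⊆X , e∈X))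
    where
    go : ∀ {Xs} → X ∈ Xs → foldr _∩_ ⊤ Xs ⊆ₛ X
    go (here refl) = p∩q⊆p X _
    go {Y ∷ _} (there X∈) = go X∈ ∘ p∩q⊆q Y _

  module Matroid (exchange : ∀ {F e b} → F ∈ L → b ∉ₛ F → b ∈ₛ closure F e → e ∈ₛ closure F b) where

    closure-chain : ∀ e → F ∈ L → Chain F ⊤ (suc k) → Chain (closure F e) ⊤ k
    closure-chain {k = zero} e F∈ c = nil ⊆⊤
    closure-chain {F} {k = suc k} e F∈ (cons {H = H} F⊂H H∈ c) with e ∈ₛ? H
    ... | yes e∈H = extend (closure-⊆ H∈ (p⊂q⇒p⊆q F⊂H) e∈H) c
    ... | no e∉H = cons (⊆∧⊉⇒⊂ cF⊆cH cH⊈cF) (closure-∈ H e) (closure-chain e H∈ c)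
      where
      F⊆H : F ⊆ₛ H
      F⊆H = p⊂q⇒p⊆q F⊂H
      cF⊆cH : closure F e ⊆ₛ closure H e
      cF⊆cH = closure-⊆ (closure-∈ H e) (closure-⊇ ∘ F⊆H) closure-∋
      cH⊈cF : ¬ (closure H e ⊆ₛ closure F e)
      cH⊈cF cH⊆cF = let _ , b , b∈H , b∉F = F⊂H in
        e∉H (closure-⊆ H∈ F⊆H b∈H (exchange F∈ b∉F (cH⊆cF (closure-⊇ b∈H))))

    rk-closure : ∀ e → F ∈ L → rk F ⊤ ≤ suc (rk (closure F e) ⊤)
    rk-closure {F} e F∈ with rk F ⊤ | rk-chain {F = F} ⊤∈ ⊆⊤
    ... | zero | _ = z≤n
    ... | suc r | c = s≤s (chain-rk (closure-∈ F e) (closure-chain e F∈ c))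

    rk-coatom : F ∈ L → G ∈ L → F ⊆ₛ G → rk G ⊤ ≡ 1 → rk F ⊤ ≤ suc (rk F G)
    rk-coatom {F} {G} F∈ G∈ F⊆G eq = go m F∈ F⊆G (ℕ.m∸n≤m m ∣ F ∣)
      where
      go : ∀ d {F} → F ∈ L → F ⊆ₛ G → m ∸ ∣ F ∣ ≤ d → rk F ⊤ ≤ suc (rk F G)
      go d {F} F∈ F⊆G le with F ≟ G
      go d F∈ F⊆G le | yes refl = ℕ.≤-trans (ℕ.≤-reflexive eq) (s≤s z≤n)
      go d {F} F∈ F⊆G le | no F≢G with _ , e , e∈G , e∉F ← ⊆∧≢⇒⊂ F⊆G F≢G with d
      ... | zero = contradiction (ℕ.m∸n≡0⇒m≤n (ℕ.n≤0⇒n≡0 le))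
        (ℕ.<⇒≱ (ℕ.<-≤-trans (p⊂q⇒∣p∣<∣q∣ (closure-⊇ , e , closure-∋ , e∉F)) (∣p∣≤n (closure F e))))
      ... | suc d = begin
        rk F ⊤                             ≤⟨ rk-closure e F∈ ⟩
        suc (rk (closure F e) ⊤)           ≤⟨ s≤s (go d cF∈ cF⊆G (ℕ.≤-pred (ℕ.<-≤-trans
                                                (ℕ.∸-monoʳ-< (p⊂q⇒∣p∣<∣q∣ F⊂cF) (∣p∣≤n (closure F e))) le))) ⟩
        suc (suc (rk (closure F e) G))     ≤⟨ s≤s (ℕ.+-monoˡ-≤ (rk (closure F e) G) (rk-pos F∈ cF∈ F⊂cF)) ⟩
        suc (rk F (closure F e) + rk (closure F e) G) ≤⟨ s≤s (rk-+ F∈ cF∈ G∈ closure-⊇ cF⊆G) ⟩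
        suc (rk F G)                       ∎
        where
        open ℕ.≤-Reasoning
        cF∈ : closure F e ∈ L
        cF∈ = closure-∈ F e
        F⊂cF : F ⊂ₛ closure F e
        F⊂cF = closure-⊇ , e , closure-∋ , e∉F
        cF⊆G : closure F e ⊆ₛ G
        cF⊆G = closure-⊆ G∈ F⊆G e∈G

-- Ring identities

-- With integer coefficients the normaliser can cancel, for which a coefficient
-- ring with decidable equality is required.
module IntegerRingSolver {c ℓ} (R : CommutativeRing c ℓ) where

  open CommutativeRing R
  open import Algebra.Properties.Ring ring using (-‿distribˡ-*; -‿involutive; -0#≈0#; -1*x≈-x)
  open import Algebra.Properties.AbelianGroup +-abelianGroup using (⁻¹-∙-comm)
  open import Algebra.Properties.Semiring.Mult.TCOptimised semiring using (×1-homo-*; 1+×) renaming (_×_ to _×ⁿ_)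
  open import Algebra.Properties.Monoid.Mult.TCOptimised +-monoid using (×-homo-+)
  open import Algebra.Properties.CommutativeSemigroup *-commutativeSemigroup using (interchange)
  open import Algebra.Properties.CommutativeSemigroup +-commutativeSemigroup using () renaming (interchange to +-interchange)
  open import Algebra.Solver.Ring.AlmostCommutativeRing using (fromCommutativeRing; _-Raw-AlmostCommutative⟶_; AlmostCommutativeRing)
  open import Relation.Binary.Reasoning.Setoid setoid

  private
    ⟦_⟧ : ℤ → Carrier
    ⟦ + n ⟧ = n ×ⁿ 1#
    ⟦ -[1+ n ] ⟧ = - (suc n ×ⁿ 1#)

    ⊖-homo : ∀ m n → ⟦ m ℤ.⊖ n ⟧ ≈ m ×ⁿ 1# - n ×ⁿ 1#
    ⊖-homo m zero = sym (trans (+-congˡ -0#≈0#) (+-identityʳ _))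
    ⊖-homo zero (suc n) = sym (+-identityˡ _)
    ⊖-homo (suc m) (suc n) = begin
      ⟦ suc m ℤ.⊖ suc n ⟧                   ≡⟨ ≡.cong ⟦_⟧ (ℤ.[1+m]⊖[1+n]≡m⊖n m n) ⟩
      ⟦ m ℤ.⊖ n ⟧                           ≈⟨ ⊖-homo m n ⟩
      m ×ⁿ 1# - n ×ⁿ 1#                       ≈⟨ +-identityˡ _ ⟨
      0# + (m ×ⁿ 1# - n ×ⁿ 1#)                ≈⟨ +-congʳ (-‿inverseʳ 1#) ⟨
      (1# - 1#) + (m ×ⁿ 1# - n ×ⁿ 1#)         ≈⟨ +-interchange 1# (- 1#) (m ×ⁿ 1#) (- (n ×ⁿ 1#)) ⟩
      (1# + m ×ⁿ 1#) + (- 1# - n ×ⁿ 1#)       ≈⟨ +-congˡ (⁻¹-∙-comm 1# (n ×ⁿ 1#)) ⟩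
      (1# + m ×ⁿ 1#) - (1# + n ×ⁿ 1#)         ≈⟨ +-cong (1+× m 1#) (-‿cong (1+× n 1#)) ⟨
      suc m ×ⁿ 1# - suc n ×ⁿ 1#               ∎

    +-homo : ∀ i j → ⟦ i ℤ.+ j ⟧ ≈ ⟦ i ⟧ + ⟦ j ⟧
    +-homo (+ m) (+ n) = ×-homo-+ 1# m n
    +-homo (+ m) -[1+ n ] = ⊖-homo m (suc n)
    +-homo -[1+ m ] (+ n) = trans (⊖-homo n (suc m)) (+-comm _ _)
    +-homo -[1+ m ] -[1+ n ] = begin
      - (suc (suc (m ℕ.+ n)) ×ⁿ 1#)          ≡⟨ ≡.cong (λ k → - (k ×ⁿ 1#)) (≡.cong suc (ℕ.+-suc m n)) ⟨
      - ((suc m ℕ.+ suc n) ×ⁿ 1#)            ≈⟨ -‿cong (×-homo-+ 1# (suc m) (suc n)) ⟩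
      - (suc m ×ⁿ 1# + suc n ×ⁿ 1#)           ≈⟨ ⁻¹-∙-comm (suc m ×ⁿ 1#) (suc n ×ⁿ 1#) ⟨
      - (suc m ×ⁿ 1#) - suc n ×ⁿ 1#           ∎
      where import Data.Nat.Properties as ℕ

    ⟦_⟧ₛ : Sign → Carrier
    ⟦ Sign.+ ⟧ₛ = 1#
    ⟦ Sign.- ⟧ₛ = - 1#

    ◃-homo : ∀ s n → ⟦ s ℤ.◃ n ⟧ ≈ ⟦ s ⟧ₛ * (n ×ⁿ 1#)
    ◃-homo s zero = sym (zeroʳ _)
    ◃-homo Sign.+ (suc n) = sym (*-identityˡ _)
    ◃-homo Sign.- (suc n) = sym (-1*x≈-x (suc n ×ⁿ 1#))

    ◃-homo⁻ : ∀ i → ⟦ i ⟧ ≈ ⟦ ℤ.sign i ⟧ₛ * (ℤ.∣ i ∣ ×ⁿ 1#)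
    ◃-homo⁻ i = trans (reflexive (≡.cong ⟦_⟧ (≡.sym (ℤ.signᵢ◃∣i∣≡i i)))) (◃-homo (ℤ.sign i) ℤ.∣ i ∣)

    sign-homo : ∀ s t → ⟦ s Sign.* t ⟧ₛ ≈ ⟦ s ⟧ₛ * ⟦ t ⟧ₛ
    sign-homo Sign.+ t = sym (*-identityˡ _)
    sign-homo Sign.- Sign.+ = sym (*-identityʳ _)
    sign-homo Sign.- Sign.- = sym (trans (-1*x≈-x (- 1#)) (-‿involutive 1#))

    *-homo : ∀ i j → ⟦ i ℤ.* j ⟧ ≈ ⟦ i ⟧ * ⟦ j ⟧
    *-homo i j = begin
      ⟦ i ℤ.* j ⟧                                                   ≈⟨ ◃-homo (ℤ.sign i Sign.* ℤ.sign j) (ℤ.∣ i ∣ ℕ.* ℤ.∣ j ∣) ⟩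
      ⟦ ℤ.sign i Sign.* ℤ.sign j ⟧ₛ * ((ℤ.∣ i ∣ ℕ.* ℤ.∣ j ∣) ×ⁿ 1#)   ≈⟨ *-cong (sign-homo (ℤ.sign i) (ℤ.sign j)) (×1-homo-* ℤ.∣ i ∣ ℤ.∣ j ∣) ⟩
      _                                                             ≈⟨ interchange _ _ _ _ ⟩
      _                                                             ≈⟨ *-cong (◃-homo⁻ i) (◃-homo⁻ j) ⟨
      ⟦ i ⟧ * ⟦ j ⟧                                                 ∎

    neg-homo : ∀ i → ⟦ ℤ.- i ⟧ ≈ - ⟦ i ⟧
    neg-homo (+ zero) = sym -0#≈0#
    neg-homo (+ suc n) = refl
    neg-homo -[1+ n ] = sym (-‿involutive _)

    target : AlmostCommutativeRing c ℓ
    target = fromCommutativeRing R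

    morphism : CommutativeRing.rawRing ℤ.+-*-commutativeRing -Raw-AlmostCommutative⟶ target
    morphism = record { ⟦_⟧ = ⟦_⟧ ; +-homo = +-homo ; *-homo = *-homo ; -‿homo = neg-homo ; 0-homo = refl ; 1-homo = refl }

    _coeff≟_ : ∀ i j → Maybe (⟦ i ⟧ ≈ ⟦ j ⟧)
    i coeff≟ j with i ℤ.≟ j
    ... | yes ≡.refl = just refl
    ... | no _ = nothing

  open import Algebra.Solver.Ring (CommutativeRing.rawRing ℤ.+-*-commutativeRing) target morphism _coeff≟_ public
    using (solve; _:=_; _:+_; _:*_; :-_; _:-_; con)

-- Vandermonde products and alternating sums

module Alternants {c ℓ₁ ℓ₂} (K : HeytingField c ℓ₁ ℓ₂) where

  open HeytingField K using (heytingCommutativeRing; _#_; tight; #⇒invertible; #-irrefl)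
  open import Algebra.Apartness.Properties.HeytingCommutativeRing heytingCommutativeRing using (#-congʳ; x#0y#0→xy#0; x-0≈x; 1#0) public
  private
    commutativeRing = HeytingCommutativeRing.commutativeRing heytingCommutativeRing
  open CommutativeRing commutativeRing
  open IntegerRingSolver commutativeRing
  open import Algebra.Properties.Ring ring using (-‿involutive; -0#≈0#; -‿distribˡ-*; -‿distribʳ-*)
  open import Relation.Binary.Reasoning.Setoid setoid
  open RawMonoidOps +-rawMonoid using () renaming (_×_ to _×ⁿ_)

  #-cancel : ∀ {x y} → x # 0# → x * y ≈ 0# → y ≈ 0#
  #-cancel {x} {y} x#0 xy≈0 with x⁻¹ , inverse , _ ← #⇒invertible x#0 = begin
    y                     ≈⟨ *-identityˡ y ⟨
    1# * y                ≈⟨ *-congʳ inverse ⟨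
    (x⁻¹ * (x - 0#)) * y  ≈⟨ *-congʳ (*-congˡ (x-0≈x x)) ⟩
    (x⁻¹ * x) * y         ≈⟨ *-assoc x⁻¹ x y ⟩
    x⁻¹ * (x * y)         ≈⟨ *-congˡ xy≈0 ⟩
    x⁻¹ * 0#              ≈⟨ zeroʳ x⁻¹ ⟩
    0#                    ∎

  #⇒-#0 : ∀ {x y} → x # y → (x - y) # 0#
  #⇒-#0 {x} {y} x#y with x⁻¹ , l , r ← #⇒invertible x#y =
    HeytingField.invertible⇒# K (x⁻¹ , trans (*-congˡ (x-0≈x (x - y))) l , trans (*-congʳ (x-0≈x (x - y))) r)

  ≈-stable : ∀ {x y} → ¬ ¬ (x ≈ y) → x ≈ y
  ≈-stable {x} {y} ¬¬eq = proj₁ (tight x y) (λ x#y → ¬¬eq (λ eq → proj₂ (tight x y) eq x#y))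

  Alternating : (List A → Carrier) → Set _
  Alternating w = ∀ as u v bs → w (as ++ u ∷ v ∷ bs) ≈ - w (as ++ v ∷ u ∷ bs)

  sign : {xs ys : List A} → xs ↭ ys → Carrier
  sign Perm.refl = 1#
  sign (Perm.prep x p) = sign p
  sign (Perm.swap x y p) = - sign p
  sign (Perm.trans p q) = sign p * sign q

  sign-² : {xs ys : List A} (p : xs ↭ ys) → sign p * sign p ≈ 1#
  sign-² Perm.refl = *-identityˡ 1#
  sign-² (Perm.prep x p) = sign-² p
  sign-² (Perm.swap x y p) = trans (solve 1 (λ s → :- s :* :- s := s :* s) refl (sign p)) (sign-² p)
  sign-² (Perm.trans p q) = trans (solve 2 (λ s t → (s :* t) :* (s :* t) := (s :* s) :* (t :* t)) refl (sign p) (sign q))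
    (trans (*-cong (sign-² p) (sign-² q)) (*-identityˡ 1#))

  alternating-↭ : {w : List A → Carrier} → Alternating w → ∀ {xs ys} (p : xs ↭ ys) → w xs ≈ sign p * w ys
  alternating-↭ alt Perm.refl = sym (*-identityˡ _)
  alternating-↭ alt (Perm.prep x p) = alternating-↭ (λ as → alt (x ∷ as)) p
  alternating-↭ {w = w} alt (Perm.swap {xs} {ys} x y p) = begin
    w (x ∷ y ∷ xs)              ≈⟨ alt [] x y xs ⟩
    - w (y ∷ x ∷ xs)            ≈⟨ -‿cong (alternating-↭ (λ as → alt (y ∷ x ∷ as)) p) ⟩
    - (sign p * w (y ∷ x ∷ ys)) ≈⟨ -‿distribˡ-* _ _ ⟩
    - sign p * w (y ∷ x ∷ ys)   ∎
  alternating-↭ {w = w} alt (Perm.trans p q) =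
    trans (alternating-↭ alt p) (trans (*-congˡ (alternating-↭ alt q)) (sym (*-assoc _ _ _)))

  alternating-map : {w : List B → Carrier} (g : A → B) → Alternating w → Alternating (w ∘ map g)
  alternating-map {w = w} g alt as u v bs = begin
    w (map g (as ++ u ∷ v ∷ bs))      ≡⟨ ≡.cong w (map-++ g as _) ⟩
    w (map g as ++ g u ∷ g v ∷ map g bs) ≈⟨ alt (map g as) (g u) (g v) (map g bs) ⟩
    - w (map g as ++ g v ∷ g u ∷ map g bs) ≡⟨ ≡.cong (λ c → - w c) (map-++ g as _) ⟨
    - w (map g (as ++ v ∷ u ∷ bs))    ∎

  parity : List A → Carrier
  parity [] = 1#
  parity (_ ∷ as) = - parity as

  alternating-shift : {w : List A → Carrier} → Alternating w → ∀ as u bs → w (as ++ u ∷ bs) ≈ parity as * w (u ∷ as ++ bs)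
  alternating-shift alt [] u bs = sym (*-identityˡ _)
  alternating-shift {w = w} alt (x ∷ as) u bs = begin
    w (x ∷ as ++ u ∷ bs)               ≈⟨ alternating-shift {w = λ c → w (x ∷ c)} (λ as → alt (x ∷ as)) as u bs ⟩
    parity as * w (x ∷ u ∷ as ++ bs)   ≈⟨ *-congˡ (alt [] x u (as ++ bs)) ⟩
    parity as * - w (u ∷ x ∷ as ++ bs) ≈⟨ solve 2 (λ s t → s :* :- t := :- s :* t) refl _ _ ⟩
    - parity as * w (u ∷ x ∷ as ++ bs) ∎

  -- The alternating sum over the deletions of one entry.
  δ : (List A → Carrier) → List A → Carrier
  δ w [] = 0#
  δ w (u ∷ us) = w us - δ (λ c → w (u ∷ c)) us

  δ-cong : {w w′ : List A → Carrier} → (∀ c → w c ≈ w′ c) → ∀ us → δ w us ≈ δ w′ us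
  δ-cong eq [] = refl
  δ-cong eq (u ∷ us) = +-cong (eq us) (-‿cong (δ-cong (λ c → eq (u ∷ c)) us))

  δ-zero : {w : List A → Carrier} → ∀ us → (∀ as u bs → us ≡ as ++ u ∷ bs → w (as ++ bs) ≈ 0#) → δ w us ≈ 0#
  δ-zero [] _ = refl
  δ-zero (u ∷ us) h = trans (+-cong (h [] u us ≡.refl)
    (trans (-‿cong (δ-zero us (λ as v bs eq → h (u ∷ as) v bs (≡.cong (u ∷_) eq)))) -0#≈0#)) (+-identityˡ 0#)

  δ-+ : (w w′ : List A → Carrier) → ∀ us → δ (λ c → w c + w′ c) us ≈ δ w us + δ w′ us
  δ-+ w w′ [] = sym (+-identityˡ 0#)
  δ-+ w w′ (u ∷ us) = trans (+-congˡ (-‿cong (δ-+ (λ c → w (u ∷ c)) (λ c → w′ (u ∷ c)) us)))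
    (solve 4 (λ a b x y → (a :+ b) :- (x :+ y) := (a :- x) :+ (b :- y)) refl _ _ _ _)

  δ-* : (k : Carrier) (w : List A → Carrier) → ∀ us → δ (λ c → k * w c) us ≈ k * δ w us
  δ-* k w [] = sym (zeroʳ k)
  δ-* k w (u ∷ us) = trans (+-congˡ (-‿cong (δ-* k (λ c → w (u ∷ c)) us)))
    (solve 3 (λ k a x → k :* a :- k :* x := k :* (a :- x)) refl _ _ _)

  δ-neg : (w : List A → Carrier) → ∀ us → δ (λ c → - w c) us ≈ - δ w us
  δ-neg w [] = sym -0#≈0#
  δ-neg w (u ∷ us) = trans (+-congˡ (-‿cong (δ-neg (λ c → w (u ∷ c)) us)))
    (solve 2 (λ a x → :- a :- (:- x) := :- (a :- x)) refl _ _)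

  δ-map : (w : List B → Carrier) (g : A → B) → ∀ us → δ (w ∘ map g) us ≡ δ w (map g us)
  δ-map w g [] = ≡.refl
  δ-map w g (u ∷ us) = ≡.cong (λ d → w (map g us) - d) (δ-map (λ c → w (g u ∷ c)) g us)

  δ-δ : (w : List A → Carrier) → ∀ us → δ (δ w) us ≈ 0#
  δ-δ w [] = refl
  δ-δ w (u ∷ us) = begin
    δ w us - δ (λ c → w c - δ (λ d → w (u ∷ d)) c) us
      ≈⟨ +-congˡ (-‿cong (δ-+ w (λ c → - δ (λ d → w (u ∷ d)) c) us)) ⟩
    δ w us - (δ w us + δ (λ c → - δ (λ d → w (u ∷ d)) c) us)
      ≈⟨ +-congˡ (-‿cong (+-congˡ (trans (δ-neg (δ (λ d → w (u ∷ d))) us) (trans (-‿cong (δ-δ (λ d → w (u ∷ d)) us)) -0#≈0#)))) ⟩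
    δ w us - (δ w us + 0#)
      ≈⟨ solve 1 (λ a → a :- (a :+ con ℤ.0ℤ) := con ℤ.0ℤ) refl _ ⟩
    0# ∎

  δ-alternating : {w : List A → Carrier} → Alternating w → Alternating (δ w)
  δ-alternating {w = w} alt [] u v bs = begin
    w (v ∷ bs) - (w (u ∷ bs) - δ (λ c → w (u ∷ v ∷ c)) bs)
      ≈⟨ +-congˡ (-‿cong (+-congˡ (-‿cong (trans (δ-cong (alt [] u v) bs) (δ-neg (λ c → w (v ∷ u ∷ c)) bs))))) ⟩
    w (v ∷ bs) - (w (u ∷ bs) - - δ (λ c → w (v ∷ u ∷ c)) bs)
      ≈⟨ solve 3 (λ a b x → a :- (b :- :- x) := :- (b :- (a :- x))) refl _ _ _ ⟩
    - (w (u ∷ bs) - (w (v ∷ bs) - δ (λ c → w (v ∷ u ∷ c)) bs)) ∎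
  δ-alternating {w = w} alt (x ∷ as) u v bs = trans
    (+-cong (alt as u v bs) (-‿cong (δ-alternating (λ as → alt (x ∷ as)) as u v bs)))
    (solve 2 (λ a b → :- a :- (:- b) := :- (a :- b)) refl _ _)

  δ-adjacent : {w : List A → Carrier} (pre : List A) {s t : A} (post : List A) →
    (∀ as x bs → pre ≡ as ++ x ∷ bs → w (as ++ bs ++ s ∷ t ∷ post) ≈ 0#) →
    (∀ as x bs → post ≡ as ++ x ∷ bs → w (pre ++ s ∷ t ∷ as ++ bs) ≈ 0#) →
    δ w (pre ++ s ∷ t ∷ post) ≈ 0# → w (pre ++ t ∷ post) ≈ w (pre ++ s ∷ post)
  δ-adjacent {w = w} [] {s} {t} post _ h eq = begin
    w (t ∷ post)                 ≈⟨ solve 3 (λ a b d → a := (a :- (b :- d)) :+ (b :- d)) refl _ (w (s ∷ post)) d ⟩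
    δ w (s ∷ t ∷ post) + (w (s ∷ post) - d) ≈⟨ +-cong eq (+-congˡ (-‿cong (δ-zero post h))) ⟩
    0# + (w (s ∷ post) - 0#)     ≈⟨ trans (+-identityˡ _) (trans (+-congˡ -0#≈0#) (+-identityʳ _)) ⟩
    w (s ∷ post)                 ∎
    where d = δ (λ c → w (s ∷ t ∷ c)) post
  δ-adjacent {w = w} (p ∷ pre) {s} {t} post h h′ eq = δ-adjacent {w = λ c → w (p ∷ c)} pre post
    (λ as x bs eq → h (p ∷ as) x bs (≡.cong (p ∷_) eq)) h′ (begin
      d                                                ≈⟨ solve 2 (λ a d → d := a :- (a :- d)) refl (w (pre ++ s ∷ t ∷ post)) d ⟩
      w (pre ++ s ∷ t ∷ post) - δ w (p ∷ pre ++ s ∷ t ∷ post) ≈⟨ +-cong (h [] p pre ≡.refl) (-‿cong eq) ⟩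
      0# - 0#                                          ≈⟨ -‿inverseʳ 0# ⟩
      0#                                               ∎)
    where d = δ (λ c → w (p ∷ c)) (pre ++ s ∷ t ∷ post)

  difference-product : Carrier → List Carrier → Carrier
  difference-product y [] = 1#
  difference-product y (z ∷ zs) = (y - z) * difference-product y zs

  V : List Carrier → Carrier
  V [] = 1#
  V (y ∷ ys) = difference-product y ys * V ys

  difference-product-swap : ∀ y as u v bs → difference-product y (as ++ u ∷ v ∷ bs) ≈ difference-product y (as ++ v ∷ u ∷ bs)
  difference-product-swap y [] u v bs = solve 3 (λ a b p → a :* (b :* p) := b :* (a :* p)) refl _ _ _
  difference-product-swap y (x ∷ as) u v bs = *-congˡ (difference-product-swap y as u v bs)

  V-alternating : Alternating V
  V-alternating [] u v bs = solve 5 (λ u v p q r → ((u :- v) :* p) :* (q :* r) := :- (((v :- u) :* q) :* (p :* r))) refl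
    u v (difference-product u bs) (difference-product v bs) (V bs)
  V-alternating (x ∷ as) u v bs = trans (*-cong (difference-product-swap x as u v bs) (V-alternating as u v bs)) (sym (-‿distribʳ-* _ _))

  V-repeated : ∀ {y z} → y ≈ z → ∀ zs → V (y ∷ z ∷ zs) ≈ 0#
  V-repeated {y} {z} y≈z zs = trans (*-congʳ (trans (*-congʳ (trans (+-congʳ y≈z) (-‿inverseʳ z))) (zeroˡ _))) (zeroˡ _)

  difference-product-cong : ∀ {u v} → u ≈ v → ∀ ys → difference-product u ys ≈ difference-product v ys
  difference-product-cong u≈v [] = refl
  difference-product-cong u≈v (y ∷ ys) = *-cong (+-congʳ u≈v) (difference-product-cong u≈v ys)

  -- (v - u) = (v - y) - (u - y), applied to the deleted entry y.
  δ-partial-fractions : ∀ u v (g : List Carrier → Carrier) ys → let p = difference-product in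
    (v - u) * δ (λ c → p u c * (p v c * g c)) ys ≈ p v ys * δ (λ c → p u c * g c) ys - p u ys * δ (λ c → p v c * g c) ys
  δ-partial-fractions u v g [] = solve 1 (λ d → d :* con ℤ.0ℤ := con ℤ.1ℤ :* con ℤ.0ℤ :- con ℤ.1ℤ :* con ℤ.0ℤ) refl (v - u)
  δ-partial-fractions u v g (y ∷ ys) = begin
    (v - u) * (p u ys * (p v ys * g ys) - δ (λ c → p u (y ∷ c) * (p v (y ∷ c) * g (y ∷ c))) ys)
      ≈⟨ *-congˡ (+-congˡ (-‿cong (trans (δ-cong (λ c → solve 5 (λ a b p q r → (a :* p) :* ((b :* q) :* r) := (a :* b) :* (p :* (q :* r))) refl (u - y) (v - y) (p u c) (p v c) (g (y ∷ c))) ys)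
           (δ-* ((u - y) * (v - y)) (λ c → p u c * (p v c * g (y ∷ c))) ys)))) ⟩
    (v - u) * (p u ys * (p v ys * g ys) - (u - y) * (v - y) * D)
      ≈⟨ solve 7 (λ u v y pu pv g d → (v :- u) :* (pu :* (pv :* g) :- (u :- y) :* (v :- y) :* d) := (v :- u) :* (pu :* (pv :* g)) :- (u :- y) :* (v :- y) :* ((v :- u) :* d)) refl u v y _ _ _ D ⟩
    (v - u) * (p u ys * (p v ys * g ys)) - (u - y) * (v - y) * ((v - u) * D)
      ≈⟨ +-congˡ (-‿cong (*-congˡ (δ-partial-fractions u v (λ c → g (y ∷ c)) ys))) ⟩
    (v - u) * (p u ys * (p v ys * g ys)) - (u - y) * (v - y) * (p v ys * Du - p u ys * Dv)
      ≈⟨ solve 8 (λ u v y pu pv g du dv → (v :- u) :* (pu :* (pv :* g)) :- (u :- y) :* (v :- y) :* (pv :* du :- pu :* dv)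
           := (v :- y) :* pv :* (pu :* g :- (u :- y) :* du) :- (u :- y) :* pu :* (pv :* g :- (v :- y) :* dv)) refl u v y _ _ _ _ _ ⟩
    p v (y ∷ ys) * (p u ys * g ys - (u - y) * Du) - p u (y ∷ ys) * (p v ys * g ys - (v - y) * Dv)
      ≈⟨ +-cong (*-congˡ (+-congˡ (-‿cong (pull u)))) (-‿cong (*-congˡ (+-congˡ (-‿cong (pull v))))) ⟨
    p v (y ∷ ys) * δ (λ c → p u c * g c) (y ∷ ys) - p u (y ∷ ys) * δ (λ c → p v c * g c) (y ∷ ys) ∎
    where
    p = difference-product
    D = δ (λ c → p u c * (p v c * g (y ∷ c))) ys
    Du = δ (λ c → p u c * g (y ∷ c)) ys
    Dv = δ (λ c → p v c * g (y ∷ c)) ys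
    pull : ∀ t → δ (λ c → p t (y ∷ c) * g (y ∷ c)) ys ≈ (t - y) * δ (λ c → p t c * g (y ∷ c)) ys
    pull t = trans (δ-cong (λ c → *-assoc (t - y) (p t c) (g (y ∷ c))) ys) (δ-* (t - y) (λ c → p t c * g (y ∷ c)) ys)

  -- For u # v, the difference v - u times the sum is a combination of shorter
  -- sums; for u ≈ v the sum vanishes directly. Tightness joins the two cases.
  δ-V : ∀ u v ys → δ V (u ∷ v ∷ ys) ≈ 0#
  δ-V u v [] = solve 0 (con ℤ.1ℤ :* con ℤ.1ℤ :- (con ℤ.1ℤ :* con ℤ.1ℤ :- con ℤ.0ℤ) := con ℤ.0ℤ) refl
  δ-V u v ys@(y ∷ ys′) = ≈-stable λ ≉0 → ≉0 (equal (proj₁ (tight u v) λ u#v → ≉0 (#-cancel (#⇒-#0 (HeytingField.#-sym K u#v)) apart)))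
    where
    p = difference-product
    E = δ (λ c → V (u ∷ c)) ys
    F = δ (λ c → V (v ∷ c)) ys
    both : δ (λ c → V (u ∷ v ∷ c)) ys ≈ (u - v) * δ (λ c → p u c * (p v c * V c)) ys
    both = trans (δ-cong (λ c → *-assoc (u - v) (p u c) (p v c * V c)) ys) (δ-* (u - v) (λ c → p u c * (p v c * V c)) ys)
    equal : u ≈ v → δ V (u ∷ v ∷ ys) ≈ 0#
    equal u≈v = begin
      p v ys * V ys - (p u ys * V ys - δ (λ c → V (u ∷ v ∷ c)) ys)
        ≈⟨ +-congˡ (-‿cong (+-cong (*-congʳ (difference-product-cong u≈v ys)) (-‿cong
             (trans both (trans (*-congʳ (trans (+-congʳ u≈v) (-‿inverseʳ v))) (zeroˡ _)))))) ⟩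
      p v ys * V ys - (p v ys * V ys - 0#)
        ≈⟨ solve 1 (λ a → a :- (a :- con ℤ.0ℤ) := con ℤ.0ℤ) refl _ ⟩
      0# ∎
    apart : (v - u) * δ V (u ∷ v ∷ ys) ≈ 0#
    apart = begin
      (v - u) * (p v ys * V ys - (p u ys * V ys - δ (λ c → V (u ∷ v ∷ c)) ys))
        ≈⟨ *-congˡ (+-congˡ (-‿cong (+-congˡ (-‿cong both)))) ⟩
      (v - u) * (p v ys * V ys - (p u ys * V ys - (u - v) * δ (λ c → p u c * (p v c * V c)) ys))
        ≈⟨ solve 6 (λ u v pv pu w d → (v :- u) :* (pv :* w :- (pu :* w :- (u :- v) :* d)) := (v :- u) :* (pv :* w :- pu :* w) :- (v :- u) :* ((v :- u) :* d)) refl u v _ _ _ _ ⟩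
      (v - u) * (p v ys * V ys - p u ys * V ys) - (v - u) * ((v - u) * δ (λ c → p u c * (p v c * V c)) ys)
        ≈⟨ +-congˡ (-‿cong (*-congˡ (δ-partial-fractions u v V ys))) ⟩
      (v - u) * (p v ys * V ys - p u ys * V ys) - (v - u) * (p v ys * E - p u ys * F)
        ≈⟨ solve 7 (λ u v pv pu w e f → (v :- u) :* (pv :* w :- pu :* w) :- (v :- u) :* (pv :* e :- pu :* f) := (v :- u) :* (pv :* (w :- e) :- pu :* (w :- f))) refl u v _ _ _ E F ⟩
      (v - u) * (p v ys * (V ys - E) - p u ys * (V ys - F))
        ≈⟨ *-congˡ (+-cong (*-congˡ (δ-V u y ys′)) (-‿cong (*-congˡ (δ-V v y ys′)))) ⟩
      (v - u) * (p v ys * 0# - p u ys * 0#)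
        ≈⟨ solve 3 (λ d a b → d :* (a :* con ℤ.0ℤ :- b :* con ℤ.0ℤ) := con ℤ.0ℤ) refl _ _ _ ⟩
      0# ∎

  ι : ℕ → Carrier
  ι k = k ×ⁿ 1#

  ι-+ : ∀ j k → ι (j ℕ.+ k) ≈ ι j + ι k
  ι-+ = Mult.×-homo-+ 1#
    where import Algebra.Properties.Monoid.Mult +-monoid as Mult

  δ-shift : {w : List A → Carrier} {k : Carrier} → ∀ us →
    (∀ as u bs → us ≡ as ++ u ∷ bs → w (as ++ bs) ≈ parity as * k) → δ w us ≈ ι (length us) * k
  δ-shift [] _ = sym (zeroˡ _)
  δ-shift {w = w} {k} (u ∷ us) h = begin
    w us - δ (λ c → w (u ∷ c)) us    ≈⟨ +-cong (h [] u us ≡.refl) (-‿cong (δ-shift us (λ as v bs eq →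
                                          trans (h (u ∷ as) v bs (≡.cong (u ∷_) eq)) (solve 2 (λ s t → :- s :* t := s :* :- t) refl _ k)))) ⟩
    1# * k - ι (length us) * - k     ≈⟨ solve 2 (λ i k → con ℤ.1ℤ :* k :- i :* :- k := (con ℤ.1ℤ :+ i) :* k) refl _ k ⟩
    (1# + ι (length us)) * k         ∎

  range : ℕ → ℕ → List Carrier
  range j zero = []
  range j (suc k) = ι j ∷ range (suc j) k

  module Evaluation (char : Representations.CharacteristicZero K) {n : ℕ} (l : ℕ) where

    open Representations K using (Fun; _≋_; 0ᶠ; _⊕_; _•_; _·_; CharacteristicZero)
    open import Data.List.Relation.Unary.Unique.DecPropositional (Fin._≟_ {n}) using (unique?)

    ι-difference : ∀ j d → (ι j - ι (suc d ℕ.+ j)) # 0#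
    ι-difference j d = #-congʳ (sym (trans (+-congˡ (-‿cong (ι-+ (suc d) j)))
        (solve 2 (λ j d → j :- (d :+ j) := con ℤ.0ℤ :- d) refl (ι j) (ι (suc d)))))
      (#⇒-#0 (HeytingField.#-sym K (char d)))

    difference-product-range : ∀ j d k → difference-product (ι j) (range (suc d ℕ.+ j) k) # 0#
    difference-product-range j d zero = 1#0
    difference-product-range j d (suc k) = x#0y#0→xy#0 (ι-difference j d) (difference-product-range j (suc d) k)

    V-range : ∀ j k → V (range j k) # 0#
    V-range j zero = 1#0
    V-range j (suc k) = x#0y#0→xy#0 (difference-product-range j 0 k) (V-range (suc j) k)

    -- The point with coordinates j, j + 1, … at the entries of the list and 0
    -- elsewhere.
    point : ℕ → List (Fin n) → Vector Carrier n
    point j [] i = 0#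
    point j (b ∷ bs) i with i Fin.≟ b
    ... | yes _ = ι j
    ... | no _ = point (suc j) bs i

    point-∉ : ∀ j {bs i} → i ∉ bs → point j bs i ≡ 0#
    point-∉ j {[]} _ = ≡.refl
    point-∉ j {b ∷ bs} {i} i∉ with i Fin.≟ b
    ... | yes i≡b = contradiction (here i≡b) i∉
    ... | no _ = point-∉ (suc j) (i∉ ∘ there)

    point-tail : ∀ j {b bs i} → i ≢ b → point j (b ∷ bs) i ≡ point (suc j) bs i
    point-tail j {b} {bs} {i} i≢b with i Fin.≟ b
    ... | yes i≡b = contradiction i≡b i≢b
    ... | no _ = ≡.refl

    map-point : ∀ j {bs} → Unique bs → map (point j bs) bs ≡ range j (length bs)
    map-point j {[]} _ = ≡.refl
    map-point j {b ∷ bs} u@(_ ∷ u′) = ≡.cong₂ _∷_ at-head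
      (≡.trans (map-cong-local (All.tabulate λ {i} i∈ → point-tail j {b} {bs} {i} (λ { ≡.refl → Unique-∉ u i∈ }))) (map-point (suc j) u′))
      where
      at-head : point j (b ∷ bs) b ≡ ι j
      at-head with b Fin.≟ b
      ... | yes _ = ≡.refl
      ... | no b≢b = contradiction ≡.refl b≢b

    module _ {τ : Fin n → Fin n} (τ-involutive : ∀ i → τ (τ i) ≡ i) where

      point-∘ : ∀ j bs i → point j bs (τ i) ≡ point j (map τ bs) i
      point-∘ j [] i = ≡.refl
      point-∘ j (b ∷ bs) i with τ i Fin.≟ b | i Fin.≟ τ b
      ... | yes _ | yes _ = ≡.refl
      ... | no _ | no _ = point-∘ (suc j) bs i
      ... | yes τi≡b | no i≢τb = contradiction (≡.trans (≡.sym (τ-involutive i)) (≡.cong τ τi≡b)) i≢τb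
      ... | no τi≢b | yes i≡τb = contradiction (≡.trans (≡.cong τ i≡τb) (τ-involutive b)) τi≢b

      τ-injective : ∀ {i j} → τ i ≡ τ j → i ≡ j
      τ-injective {i} {j} eq = ≡.trans (≡.sym (τ-involutive i)) (≡.trans (≡.cong τ eq) (τ-involutive j))

    Facet : List (Fin n) → Set
    Facet b = Unique b × length b ≡ l

    facet? : ∀ b → Dec (Facet b)
    facet? b = unique? b ×-dec (length b ℕ.≟ l)

    -- The value of f at the point supported on the facet b; zero on lists which
    -- are not facets, so that z f is alternating on all lists for f in the span
    -- of the alternants.
    z : Fun n → List (Fin n) → Carrier
    z f b with facet? b
    ... | yes _ = f (point 1 b)
    ... | no _ = 0#

    φ : Fun n → List (Fin n) → Carrier
    φ f = δ (z f)

    z-yes : ∀ f {b} → Facet b → z f b ≡ f (point 1 b)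
    z-yes f {b} facet with facet? b
    ... | yes _ = ≡.refl
    ... | no ¬facet = contradiction facet ¬facet

    z-cong : ∀ {f g} → f ≋ g → ∀ b → z f b ≈ z g b
    z-cong f≋g b with facet? b
    ... | yes _ = f≋g (point 1 b)
    ... | no _ = refl

    z-⊕ : ∀ f g b → z (f ⊕ g) b ≈ z f b + z g b
    z-⊕ f g b with facet? b
    ... | yes _ = refl
    ... | no _ = sym (+-identityˡ 0#)

    z-• : ∀ k f b → z (k • f) b ≈ k * z f b
    z-• k f b with facet? b
    ... | yes _ = refl
    ... | no _ = sym (zeroʳ k)

    z-0 : ∀ b → z 0ᶠ b ≈ 0#
    z-0 b with facet? b
    ... | yes _ = refl
    ... | no _ = refl

    φ-cong : ∀ {f g} → f ≋ g → ∀ a → φ f a ≈ φ g a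
    φ-cong f≋g = δ-cong (z-cong f≋g)

    φ-⊕ : ∀ f g a → φ (f ⊕ g) a ≈ φ f a + φ g a
    φ-⊕ f g a = trans (δ-cong (z-⊕ f g) a) (δ-+ (z f) (z g) a)

    φ-• : ∀ k f a → φ (k • f) a ≈ k * φ f a
    φ-• k f a = trans (δ-cong (z-• k f) a) (δ-* k (z f) a)

    φ-0 : ∀ a → φ 0ᶠ a ≈ 0#
    φ-0 a = trans (δ-cong z-0 a) (δ-zero a (λ _ _ _ _ → refl))

    φ-φ : ∀ f us → δ (φ f) us ≈ 0#
    φ-φ f = δ-δ (z f)

    -- The Specht polynomial of a tableau with first column T.
    alternant : List (Fin n) → Fun n
    alternant T x = V (map x T)

    alternant-alternating : ∀ x → Alternating (λ T → alternant T x)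
    alternant-alternating x = alternating-map {w = V} x V-alternating

    alternant-↭ : ∀ {T T′} (p : T ↭ T′) → alternant T ≋ (sign p • alternant T′)
    alternant-↭ p x = alternating-↭ {w = λ T → alternant T x} (alternant-alternating x) p

    facet-swap : ∀ as u v bs → Facet (as ++ u ∷ v ∷ bs) → Facet (as ++ v ∷ u ∷ bs)
    facet-swap as u v bs (ub , lenb) = Unique-resp-↭ p ub , ≡.trans (≡.sym (↭-length p)) lenb
      where
      p : as ++ u ∷ v ∷ bs ↭ as ++ v ∷ u ∷ bs
      p = ++⁺ˡ as (Perm.swap u v Perm.refl)

    swap-left : ∀ (i j : Fin n) → PC.transpose i j i ≡ j
    swap-left i j with i Fin.≟ i
    ... | yes _ = ≡.refl
    ... | no i≢i = contradiction ≡.refl i≢i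

    swap-right : ∀ (i j : Fin n) → PC.transpose i j j ≡ i
    swap-right i j with j Fin.≟ i
    ... | yes j≡i = j≡i
    ... | no _ with j Fin.≟ j
    ...   | yes _ = ≡.refl
    ...   | no j≢j = contradiction ≡.refl j≢j

    swap-other : ∀ {i j k : Fin n} → k ≢ i → k ≢ j → PC.transpose i j k ≡ k
    swap-other {i} {j} {k} k≢i k≢j with k Fin.≟ i
    ... | yes k≡i = contradiction k≡i k≢i
    ... | no _ with k Fin.≟ j
    ...   | yes k≡j = contradiction k≡j k≢j
    ...   | no _ = ≡.refl

    module _ {T : List (Fin n)} (uT : Unique T) (lenT : length T ≡ suc l) where

      alternant-swap : ∀ as u v bs → Facet (as ++ u ∷ v ∷ bs) → Facet (as ++ v ∷ u ∷ bs) →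
        alternant T (point 1 (as ++ u ∷ v ∷ bs)) ≈ - alternant T (point 1 (as ++ v ∷ u ∷ bs))
      alternant-swap as u v bs (ub , lenb) (ub′ , lenb′) = cases left right xs↭ ys↭ left∉
        where
        b = as ++ u ∷ v ∷ bs
        b′ = as ++ v ∷ u ∷ bs
        b↭b′ : b′ ↭ b
        b↭b′ = ++⁺ˡ as (Perm.swap v u Perm.refl)
        open Overlap (compare Fin._≟_ uT ub)
        cases : ∀ left right → T ↭ left ++ both → b ↭ both ++ right → (∀ {x} → x ∈ left → x ∉ b) →
          alternant T (point 1 b) ≈ - alternant T (point 1 b′)
        cases [] right T↭ b↭ _ = contradiction (≡.sym (≡.trans (≡.sym lenT) (↭-length T↭)))
          (ℕ.<⇒≢ (s≤s (≡.subst (length both ℕ.≤_) (≡.trans (≡.sym (↭-length b↭)) lenb)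
            (≡.subst (length both ℕ.≤_) (≡.sym (length-++ both)) (ℕ.m≤m+n _ _)))))
        cases (o ∷ []) (r ∷ right) T↭ b↭ _ = contradiction
          (ℕ.+-cancelˡ-≡ (length both) 0 (suc (length right)) (≡.trans (ℕ.+-identityʳ _) (≡.trans
            (ℕ.suc-injective (≡.trans (≡.sym (↭-length T↭)) lenT)) (≡.trans (≡.sym lenb) (≡.trans (↭-length b↭) (length-++ both))))))
          λ ()
        cases (o ∷ []) [] T↭ b↭ o∉ = begin
          alternant T x                 ≈⟨ alternant-↭ p x ⟩
          sign p * alternant (o ∷ b) x  ≡⟨ ≡.cong (λ r → sign p * V r) (map-o∷ ub lenb (o∉ (here ≡.refl))) ⟩
          sign p * V (range 0 (suc l))   ≡⟨ ≡.cong (λ r → sign p * V r) (map-o∷ ub′ lenb′ (o∉ (here ≡.refl) ∘ ∈-resp-↭ b↭b′)) ⟨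
          sign p * alternant (o ∷ b′) x′ ≈⟨ *-congˡ (alternant-alternating x′ (o ∷ as) v u bs) ⟩
          sign p * - alternant (o ∷ b) x′ ≈⟨ -‿distribʳ-* _ _ ⟨
          - (sign p * alternant (o ∷ b) x′) ≈⟨ -‿cong (alternant-↭ p x′) ⟨
          - alternant T x′              ∎
          where
          x = point 1 b
          x′ = point 1 b′
          p : T ↭ o ∷ b
          p = ↭-trans T↭ (Perm.prep o (↭-sym (≡.subst (b ↭_) (++-identityʳ both) b↭)))
          map-o∷ : ∀ {b} → Unique b → length b ≡ l → o ∉ b → map (point 1 b) (o ∷ b) ≡ range 0 (suc l)
          map-o∷ {b} u len o∉ = ≡.cong₂ _∷_ (point-∉ 1 o∉) (≡.trans (map-point 1 u) (≡.cong (range 1) len))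
        cases (o ∷ o′ ∷ left) right T↭ b↭ o∉ = trans (vanish b id) (trans (sym -0#≈0#) (-‿cong (sym (vanish b′ (∈-resp-↭ b↭b′)))))
          where
          vanish : ∀ c → (∀ {i} → i ∈ c → i ∈ b) → alternant T (point 1 c) ≈ 0#
          vanish c c⊆b = trans (alternant-↭ T↭ (point 1 c)) (trans (*-congˡ (V-repeated
            (reflexive (≡.trans (point-∉ 1 (o∉ (here ≡.refl) ∘ c⊆b)) (≡.sym (point-∉ 1 (o∉ (there (here ≡.refl)) ∘ c⊆b))))) (map (point 1 c) (left ++ both)))) (zeroʳ _))

      z-alternant-alternating : Alternating (z (alternant T))
      z-alternant-alternating as u v bs with facet? (as ++ u ∷ v ∷ bs) | facet? (as ++ v ∷ u ∷ bs)
      ... | yes facet | yes facet′ = alternant-swap as u v bs facet facet′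
      ... | no _ | no _ = sym -0#≈0#
      ... | yes facet | no ¬facet = contradiction (facet-swap as u v bs facet) ¬facet
      ... | no ¬facet | yes facet = contradiction (facet-swap as v u bs facet) ¬facet

    swap-involutive : ∀ i j k → PC.transpose i j (PC.transpose i j k) ≡ k
    swap-involutive i j k with k Fin.≟ i
    ... | yes ≡.refl = swap-right k j
    ... | no k≢i with k Fin.≟ j
    ...   | yes ≡.refl = swap-left i k
    ...   | no k≢j = swap-other k≢i k≢j

    alternating-transpose : ∀ {w : List (Fin n) → Carrier} → Alternating w → ∀ {a i j} → Unique a → i ≢ j → i ∈ a → j ∈ a →
      w (map (PC.transpose i j) a) ≈ - w a
    alternating-transpose {w} alt {a} {i} {j} ua i≢j i∈ j∈ with a₁ , p ← ∈-↭ i∈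
      with c , q ← ∈-↭ (≢-∈-tail (i≢j ∘ ≡.sym) (∈-resp-↭ p j∈)) = begin
      w (map τ a)                      ≈⟨ alternating-↭ {w = w ∘ map τ} (alternating-map {w = w} τ alt) r ⟩
      sign r * w (map τ (i ∷ j ∷ c))   ≡⟨ ≡.cong (λ b → sign r * w b) (≡.cong₂ _∷_ (swap-left i j) (≡.cong₂ _∷_ (swap-right i j)
                                           (map-id-local (All.tabulate λ k∈ → swap-other (λ { ≡.refl → i∉ k∈ }) (λ { ≡.refl → j∉ k∈ }))))) ⟩
      sign r * w (j ∷ i ∷ c)           ≈⟨ *-congˡ (alt [] j i c) ⟩
      sign r * - w (i ∷ j ∷ c)         ≈⟨ -‿distribʳ-* _ _ ⟨
      - (sign r * w (i ∷ j ∷ c))       ≈⟨ -‿cong (alternating-↭ alt r) ⟨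
      - w a                            ∎
      where
      τ = PC.transpose i j
      r : a ↭ i ∷ j ∷ c
      r = ↭-trans p (Perm.prep i q)
      u : Unique (i ∷ j ∷ c)
      u = Unique-resp-↭ r ua
      i∉ : i ∉ c
      i∉ i∈c = Unique-∉ u (there i∈c)
      j∉ : j ∉ c
      j∉ with _ ∷ u′ ← u = Unique-∉ u′

    facet-map : ∀ {τ : Fin n → Fin n} → (∀ i → τ (τ i) ≡ i) → ∀ {b} → Facet b → Facet (map τ b)
    facet-map {τ} inv {b} (ub , lenb) = Unique-map-∈ τ (λ _ _ → τ-injective inv) ub , ≡.trans (length-map τ b) lenb

    z-map : ∀ {τ : Fin n → Fin n} → (∀ i → τ (τ i) ≡ i) → ∀ T b → z (alternant (map τ T)) b ≡ z (alternant T) (map τ b)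
    z-map {τ} inv T b with facet? b | facet? (map τ b)
    ... | no _ | no _ = ≡.refl
    ... | yes facet | no ¬facet = contradiction (facet-map inv facet) ¬facet
    ... | no ¬facet | yes facet = contradiction (≡.subst Facet (≡.trans (≡.sym (map-∘ {g = τ} {f = τ} b)) (map-id-local (All.tabulate λ {i} _ → inv i))) (facet-map inv facet)) ¬facet
    ... | yes _ | yes _ = ≡.cong V (≡.trans (≡.sym (map-∘ T)) (map-cong (point-∘ inv 1 b) T))

    φ-transpose : ∀ {T a i j} → Unique T → length T ≡ suc l → Unique a → i ≢ j → i ∈ a → j ∈ a →
      φ (alternant (map (PC.transpose i j) T)) a ≈ - φ (alternant T) a
    φ-transpose {T} {a} {i} {j} uT lenT ua i≢j i∈ j∈ = begin
      δ (z (alternant (map τ T))) a  ≈⟨ δ-cong (λ b → reflexive (z-map (swap-involutive i j) T b)) a ⟩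
      δ (z (alternant T) ∘ map τ) a  ≡⟨ δ-map (z (alternant T)) τ a ⟩
      δ (z (alternant T)) (map τ a)  ≈⟨ alternating-transpose (δ-alternating (z-alternant-alternating uT lenT)) ua i≢j i∈ j∈ ⟩
      - φ (alternant T) a            ∎
      where τ = PC.transpose i j

    φ-alternant : ∀ {a} → Unique a → length a ≡ suc l → φ (alternant a) a # 0#
    φ-alternant {a} ua lena = #-congʳ (sym (trans (δ-shift a face) (*-congʳ (reflexive (≡.cong ι lena)))))
      (x#0y#0→xy#0 (char l) (V-range 0 (suc l)))
      where
      face : ∀ as u bs → a ≡ as ++ u ∷ bs → z (alternant a) (as ++ bs) ≈ parity as * V (range 0 (suc l))
      face as u bs ≡.refl = begin
        z (alternant a) (as ++ bs)                ≡⟨ z-yes (alternant a) facet ⟩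
        alternant a x                             ≈⟨ alternating-shift {w = λ T → alternant T x} (alternant-alternating x) as u bs ⟩
        parity as * alternant (u ∷ as ++ bs) x    ≡⟨ ≡.cong (λ r → parity as * V r) (≡.cong₂ _∷_ (point-∉ 1 (Unique-∉ u′))
                                                       (≡.trans (map-point 1 (proj₁ facet)) (≡.cong (range 1) (proj₂ facet)))) ⟩
        parity as * V (range 0 (suc l))           ∎
        where
        x = point 1 (as ++ bs)
        p : a ↭ u ∷ as ++ bs
        p = shift u as bs
        u′ : Unique (u ∷ as ++ bs)
        u′ = Unique-resp-↭ p ua
        facet : Facet (as ++ bs)
        facet with _ ∷ u″ ← u′ = u″ , ℕ.suc-injective (≡.trans (≡.sym (↭-length p)) lena)

-- The hyperplanes of a Specht module of hook shape

module Sums {c ℓ₁ ℓ₂} (K : HeytingField c ℓ₁ ℓ₂) {n : ℕ} {a ℓ} {I : Set a}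
  {W : I → Pred (Representations.Fun K n) ℓ} where

  open Representations K
  open CommutativeRing (HeytingCommutativeRing.commutativeRing (HeytingField.heytingCommutativeRing K))

  private
    total : List (Σ[ i ∈ I ] ∃ (W i)) → Fun n
    total = foldr (λ g s → proj₁ (proj₂ g) ⊕ s) 0ᶠ

    total-++ : ∀ gs hs → total (gs ++ hs) ≋ (total gs ⊕ total hs)
    total-++ [] hs x = sym (+-identityˡ _)
    total-++ ((_ , g , _) ∷ gs) hs x = trans (+-congˡ (total-++ gs hs x)) (sym (+-assoc _ _ _))

  sum-resp : ∀ {f g} → f ≋ g → SumOf W f → SumOf W g
  sum-resp f≋g (gs , eq) = gs , λ x → trans (sym (f≋g x)) (eq x)

  sum-0 : SumOf W 0ᶠ
  sum-0 = [] , λ _ → refl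

  sum-⊕ : ∀ {f g} → SumOf W f → SumOf W g → SumOf W (f ⊕ g)
  sum-⊕ (gs , eq) (hs , eq′) = gs ++ hs , λ x → trans (+-cong (eq x) (eq′ x)) (sym (total-++ gs hs x))

  sum-• : (∀ {i f} k → W i f → W i (k • f)) → ∀ {f} k → SumOf W f → SumOf W (k • f)
  sum-• W-• k (gs , eq) = map (λ (i , g , w) → i , k • g , W-• k w) gs , λ x → trans (*-congˡ (eq x)) (scale gs x)
    where
    scale : ∀ gs → (k • total gs) ≋ total (map (λ (i , g , w) → i , k • g , W-• k w) gs)
    scale [] x = zeroʳ k
    scale (g ∷ gs) x = trans (distribˡ k _ _) (+-congˡ (scale gs x))

  sum-∋ : ∀ {f} i → W i f → SumOf W f
  sum-∋ i w = (i , _ , w) ∷ [] , λ x → sym (+-identityʳ _)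

  sum-elim : ∀ {q} (Q : Pred (Fun n) q) → (∀ {f g} → f ≋ g → Q f → Q g) → Q 0ᶠ → (∀ {f g} → Q f → Q g → Q (f ⊕ g)) →
    (∀ {i f} → W i f → Q f) → ∀ {f} → SumOf W f → Q f
  sum-elim Q resp Q0 Q⊕ QW (gs , eq) = resp (λ x → sym (eq x)) (go gs)
    where
    go : ∀ gs → Q (total gs)
    go [] = Q0
    go ((_ , _ , w) ∷ gs) = Q⊕ (QW w) (go gs)

module Hyperplanes {c ℓ₁ ℓ₂} (K : HeytingField c ℓ₁ ℓ₂) (char : Representations.CharacteristicZero K) {n : ℕ} (l : ℕ) where

  open Representations K
  open HeytingField K using (heytingCommutativeRing; _#_; tight; #⇒invertible; #-irrefl)
  private
    commutativeRing = HeytingCommutativeRing.commutativeRing heytingCommutativeRing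
  open CommutativeRing commutativeRing
  open IntegerRingSolver commutativeRing
  open import Algebra.Properties.Ring ring using (-‿involutive; -0#≈0#; -‿distribˡ-*; -‿distribʳ-*)
  open import Relation.Binary.Reasoning.Setoid setoid
  open Alternants K
  open Evaluation char {n} l

  record Column (T : List (Fin n)) : Set where
    constructor column
    field
      distinct : Unique T
      height   : length T ≡ suc l
  open Column

  -- In the last case the transposition of i and j fixes the alternant of T.
  data Agreement : List (Fin n) → List (Fin n) → Set where
    equal : ∀ {T} → Agreement T T
    one : ∀ {as s t bs} → t ∉ as ++ s ∷ bs → Agreement (as ++ t ∷ bs) (as ++ s ∷ bs)
    two : ∀ {T b i j} → i ≢ j → i ∈ b → j ∈ b → i ∉ T → j ∉ T → Agreement T b

  module SpechtModule {U : Pred (Fun n) (c ⊔ ℓ₁)}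
    (U-0 : U 0ᶠ)
    (U-⊕ : ∀ {f g} → U f → U g → U (f ⊕ g))
    (U-• : ∀ {f} k → U f → U (k • f))
    (U-alternant : ∀ {T} → Column T → U (alternant T))
    (U-elim : ∀ {q} (Q : Pred (Fun n) q) → (∀ {f g} → f ≋ g → Q f → Q g) → Q 0ᶠ → (∀ {f g} → Q f → Q g → Q (f ⊕ g)) →
       (∀ {f} k → Q f → Q (k • f)) → (∀ {T} → Column T → Q (alternant T)) → ∀ {f} → U f → Q f)
    where

    φ-antisymmetric : ∀ {a i j} → Unique a → i ≢ j → i ∈ a → j ∈ a → ∀ {f} → U f → φ (transpose i j · f) a ≈ - φ f a
    φ-antisymmetric {a} {i} {j} ua i≢j i∈ j∈ = U-elim (λ f → φ (transpose i j · f) a ≈ - φ f a)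
      (λ f≋g eq → trans (φ-cong (λ x → sym (f≋g _)) a) (trans eq (-‿cong (φ-cong f≋g a))))
      (trans (φ-0 a) (trans (sym -0#≈0#) (-‿cong (sym (φ-0 a)))))
      (λ {f} {g} p q → trans (φ-⊕ (transpose i j · f) (transpose i j · g) a) (trans (+-cong p q)
        (trans (solve 2 (λ x y → :- x :+ :- y := :- (x :+ y)) refl _ _) (-‿cong (sym (φ-⊕ f g a))))))
      (λ {f} k p → trans (φ-• k (transpose i j · f) a) (trans (*-congˡ p)
        (trans (sym (-‿distribʳ-* _ _)) (-‿cong (sym (φ-• k f a))))))
      (λ {T} (column uT lenT) → trans (φ-cong (λ x → reflexive (≡.cong V (map-∘ T))) a) (φ-transpose uT lenT ua i≢j i∈ j∈))

    alternant-sum : List (List (Fin n)) → Fun n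
    alternant-sum [] = 0ᶠ
    alternant-sum (T ∷ Ts) = alternant T ⊕ alternant-sum Ts

    alternant-sum-↭ : ∀ {Ts Ts′} → Ts ↭ Ts′ → alternant-sum Ts ≋ alternant-sum Ts′
    alternant-sum-↭ Perm.refl x = refl
    alternant-sum-↭ (Perm.prep T p) x = +-congˡ (alternant-sum-↭ p x)
    alternant-sum-↭ (Perm.swap T T′ p) x = trans (solve 3 (λ a b s → a :+ (b :+ s) := b :+ (a :+ s)) refl _ _ _)
      (+-congˡ (+-congˡ (alternant-sum-↭ p x)))
    alternant-sum-↭ (Perm.trans p q) x = trans (alternant-sum-↭ p x) (alternant-sum-↭ q x)

    alternant-sum-map : ∀ (τ : Fin n → Fin n) Ts x → alternant-sum Ts (x ∘ τ) ≡ alternant-sum (map (map τ) Ts) x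
    alternant-sum-map τ [] x = ≡.refl
    alternant-sum-map τ (T ∷ Ts) x = ≡.cong₂ _+_ (≡.cong V (map-∘ T)) (alternant-sum-map τ Ts x)

    U-alternant-sum : ∀ Ts → (∀ {T} → T ∈ Ts → Column T) → U (alternant-sum Ts)
    U-alternant-sum [] _ = U-0
    U-alternant-sum (T ∷ Ts) h = U-⊕ (U-alternant (h (here ≡.refl))) (U-alternant-sum Ts (h ∘ there))

    module Hyperplane {A : Subset n} {a : List (Fin n)} (ca : Column a)
      (a⊆A : ∀ {i} → i ∈ a → i ∈ₛ A) (A⊆a : ∀ {i} → i ∈ₛ A → i ∈ a) where

      Hᴬ : Pred (Fun n) _
      Hᴬ = H U (blocks A)

      same-block : ∀ {i j} → i ≢ j → Any (λ B → i ∈ₛ B × j ∈ₛ B) (blocks A) → i ∈ₛ A × j ∈ₛ A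
      same-block i≢j (here p) = p
      same-block i≢j (there p) with x , i∈ , j∈ ← satisfied (map⁻ p) =
        contradiction (≡.trans (x∈⁅y⁆⇒x≡y x i∈) (≡.sym (x∈⁅y⁆⇒x≡y x j∈))) i≢j

      H-resp : ∀ {f g} → f ≋ g → Hᴬ f → Hᴬ g
      H-resp = Sums.sum-resp K

      H-0 : Hᴬ 0ᶠ
      H-0 = Sums.sum-0 K

      H-⊕ : ∀ {f g} → Hᴬ f → Hᴬ g → Hᴬ (f ⊕ g)
      H-⊕ = Sums.sum-⊕ K

      H-• : ∀ {f} k → Hᴬ f → Hᴬ (k • f)
      H-• = Sums.sum-• K (λ k (Uf , fixed) → U-• k Uf , λ x → *-congˡ (fixed x))

      H-fixed : ∀ {i j f} → i ≢ j → i ∈ a → j ∈ a → U f → (transpose i j · f) ≋ f → Hᴬ f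
      H-fixed {i} {j} i≢j i∈ j∈ Uf fixed = Sums.sum-∋ K ((i , j) , i≢j , here (a⊆A i∈ , a⊆A j∈)) (Uf , fixed)

      H⇒φ : ∀ {f} → Hᴬ f → φ f a ≈ 0#
      H⇒φ = Sums.sum-elim K (λ f → φ f a ≈ 0#) (λ f≋g eq → trans (φ-cong (λ x → sym (f≋g x)) a) eq) (φ-0 a)
        (λ {f} {g} p q → trans (φ-⊕ f g a) (trans (+-cong p q) (+-identityˡ 0#)))
        λ { {(i , j) , i≢j , same} {f} (Uf , fixed) → let i∈ , j∈ = same-block i≢j same in
          #-cancel (char 1) (begin
            (1# + (1# + 0#)) * φ f a        ≈⟨ solve 1 (λ x → (con ℤ.1ℤ :+ (con ℤ.1ℤ :+ con ℤ.0ℤ)) :* x := x :+ x) refl _ ⟩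
            φ f a + φ f a                   ≈⟨ +-congʳ (φ-cong fixed a) ⟨
            φ (transpose i j · f) a + φ f a ≈⟨ +-congʳ (φ-antisymmetric (distinct ca) i≢j (A⊆a i∈) (A⊆a j∈) Uf) ⟩
            - φ f a + φ f a                 ≈⟨ -‿inverseˡ _ ⟩
            0#                              ∎) }

      infix 4 _∼_
      _∼_ : Fun n → Fun n → Set _
      f ∼ g = Hᴬ (f ⊕ ((- 1#) • g))

      ∼-by : ∀ {f g h} → Hᴬ h → (∀ x → h x ≈ f x + - 1# * g x) → f ∼ g
      ∼-by Hh eq = H-resp eq Hh

      ≋⇒∼ : ∀ {f g} → f ≋ g → f ∼ g
      ≋⇒∼ {f} {g} f≋g = ∼-by H-0 (λ x → trans (solve 1 (λ t → con ℤ.0ℤ := t :+ :- con ℤ.1ℤ :* t) refl (g x)) (+-congʳ (sym (f≋g x))))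

      ∼-sym : ∀ {f g} → f ∼ g → g ∼ f
      ∼-sym {f} {g} p = ∼-by (H-• (- 1#) p) (λ x → solve 2 (λ f g → :- con ℤ.1ℤ :* (f :+ :- con ℤ.1ℤ :* g) := g :+ :- con ℤ.1ℤ :* f) refl (f x) (g x))

      ∼-trans : ∀ {f g h} → f ∼ g → g ∼ h → f ∼ h
      ∼-trans {f} {g} {h} p q = ∼-by (H-⊕ p q) (λ x → solve 3 (λ f g h → (f :+ :- con ℤ.1ℤ :* g) :+ (g :+ :- con ℤ.1ℤ :* h) := f :+ :- con ℤ.1ℤ :* h) refl (f x) (g x) (h x))

      ∼-⊕ : ∀ {f f′ g g′} → f ∼ f′ → g ∼ g′ → (f ⊕ g) ∼ (f′ ⊕ g′)
      ∼-⊕ {f} {f′} {g} {g′} p q = ∼-by (H-⊕ p q) (λ x → solve 4 (λ f f′ g g′ → (f :+ :- con ℤ.1ℤ :* f′) :+ (g :+ :- con ℤ.1ℤ :* g′) := (f :+ g) :+ :- con ℤ.1ℤ :* (f′ :+ g′)) refl (f x) (f′ x) (g x) (g′ x))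

      ∼-• : ∀ {f g} k → f ∼ g → (k • f) ∼ (k • g)
      ∼-• {f} {g} k p = ∼-by (H-• k p) (λ x → solve 3 (λ k f g → k :* (f :+ :- con ℤ.1ℤ :* g) := k :* f :+ :- con ℤ.1ℤ :* (k :* g)) refl k (f x) (g x))

      H⇒∼0 : ∀ {f} g → Hᴬ f → f ∼ (0# • g)
      H⇒∼0 {f} g Hf = ∼-by Hf (λ x → solve 2 (λ f g → f := f :+ :- con ℤ.1ℤ :* (con ℤ.0ℤ :* g)) refl (f x) (g x))

      column-map : ∀ {T} i j → Column T → Column (map (PC.transpose i j) T)
      column-map {T} i j (column u len) = column (Unique-map-∈ _ (λ _ _ → τ-injective (swap-involutive i j)) u) (≡.trans (length-map _ T) len)

      column-↭ : ∀ {T T′} → T ↭ T′ → Column T → Column T′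
      column-↭ p (column u len) = column (Unique-resp-↭ p u) (≡.trans (≡.sym (↭-length p)) len)

      alternant-transpose : ∀ {T i j} → Column T → i ≢ j → i ∈ a → j ∈ a → alternant T ∼ ((- 1#) • alternant (map (PC.transpose i j) T))
      alternant-transpose {T} {i} {j} cT i≢j i∈ j∈ = ∼-by
        (H-fixed i≢j i∈ j∈ (U-⊕ (U-alternant cT) (U-alternant (column-map i j cT)))
          (λ x → trans (+-comm _ _) (+-cong
            (reflexive (≡.cong V (≡.trans (≡.sym (map-∘ T)) (map-cong (λ k → ≡.cong x (swap-involutive i j k)) T))))
            (reflexive (≡.cong V (map-∘ T))))))
        (λ x → solve 2 (λ f g → f :+ g := f :+ :- con ℤ.1ℤ :* (:- con ℤ.1ℤ :* g)) refl _ _)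
        where τ = PC.transpose i j

      -- Moving s through us by transpositions inside A identifies all terms of
      -- the alternating sum, up to the sign they carry.
      δ-exchange : (W : List (Fin n) → Fun n) (s : Fin n) → (∀ x → Alternating (λ T → W T x)) → ∀ us →
        (∀ as u bs → us ≡ as ++ u ∷ bs → W (as ++ s ∷ bs) ∼ ((- 1#) • W (as ++ u ∷ bs))) →
        (λ x → δ (λ c → W (s ∷ c) x) us) ∼ ((- ι (length us)) • W us)
      δ-exchange W s alt [] h = ≋⇒∼ (λ x → solve 1 (λ w → con ℤ.0ℤ := :- con ℤ.0ℤ :* w) refl (W [] x))
      δ-exchange W s alt (u ∷ us) h = ∼-trans
        (≋⇒∼ (λ x → +-congˡ (trans (-‿cong (trans (δ-cong (λ c → alt x [] s u c) us) (δ-neg (λ c → W (u ∷ s ∷ c) x) us)))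
           (-‿involutive _))))
        (∼-trans (∼-⊕ (h [] u us ≡.refl) (δ-exchange (λ c → W (u ∷ c)) s (λ x as → alt x (u ∷ as)) us (λ as v bs eq → h (u ∷ as) v bs (≡.cong (u ∷_) eq))))
          (≋⇒∼ (λ x → solve 2 (λ i w → :- con ℤ.1ℤ :* w :+ :- i :* w := :- (con ℤ.1ℤ :+ i) :* w) refl (ι (length us)) (W (u ∷ us) x))))

      map-transpose-∉ : ∀ {T i j} → i ∉ T → j ∉ T → map (PC.transpose i j) T ≡ T
      map-transpose-∉ i∉ j∉ = map-id-local (All.tabulate λ k∈ → swap-other (λ { ≡.refl → i∉ k∈ }) (λ { ≡.refl → j∉ k∈ }))

      alternant-fixed : ∀ {T i j} → Column T → i ≢ j → i ∈ a → j ∈ a → i ∉ T → j ∉ T → Hᴬ (alternant T)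
      alternant-fixed {T} cT i≢j i∈ j∈ i∉ j∉ = H-fixed i≢j i∈ j∈ (U-alternant cT)
        (λ x → reflexive (≡.cong V (≡.trans (map-∘ T) (≡.cong (map x) (map-transpose-∉ i∉ j∉)))))

      replace-entry : ∀ {s t us} → Column (s ∷ us) → (∀ {i} → i ∈ s ∷ us → i ∈ a) → t ∉ a →
        alternant (s ∷ us) ∼ (ι (suc l) • alternant (t ∷ us))
      replace-entry {s} {t} {us} c@(column u len) ⊆a t∉ = ∼-trans
        (≋⇒∼ λ x → begin
          alternant (s ∷ us) x
            ≈⟨ solve 3 (λ a b d → a := (a :- (b :- d)) :+ (b :+ :- con ℤ.1ℤ :* d)) refl _ _ (δ (λ c → W (s ∷ c) x) us) ⟩
          δ (λ T → alternant T x) (t ∷ s ∷ us) + (W us x + - 1# * δ (λ c → W (s ∷ c) x) us)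
            ≈⟨ +-congʳ (trans (reflexive (δ-map V x (t ∷ s ∷ us))) (δ-V (x t) (x s) (map x us))) ⟩
          0# + (W us x + - 1# * δ (λ c → W (s ∷ c) x) us)
            ≈⟨ +-identityˡ _ ⟩
          W us x + - 1# * δ (λ c → W (s ∷ c) x) us ∎)
        (∼-trans (∼-⊕ (≋⇒∼ {W us} (λ _ → refl)) (∼-• (- 1#) (δ-exchange W s (λ x as → alternant-alternating x (t ∷ as)) us exchange)))
          (≋⇒∼ λ x → trans (solve 2 (λ w i → w :+ :- con ℤ.1ℤ :* (:- i :* w) := (con ℤ.1ℤ :+ i) :* w) refl (W us x) (ι (length us)))
             (*-congʳ (reflexive (≡.cong ι len)))))
        where
        W : List (Fin n) → Fun n
        W T = alternant (t ∷ T)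
        exchange : ∀ as v bs → us ≡ as ++ v ∷ bs → W (as ++ s ∷ bs) ∼ ((- 1#) • W (as ++ v ∷ bs))
        exchange as v bs ≡.refl = ∼-trans (alternant-transpose col s≢v (⊆a (here ≡.refl)) (⊆a (there (∈-insert as))))
          (≋⇒∼ λ x → reflexive (≡.cong (λ T → - 1# * alternant T x) moved))
          where
          p : s ∷ as ++ v ∷ bs ↭ s ∷ v ∷ as ++ bs
          p = Perm.prep s (shift v as bs)
          u′ : Unique (s ∷ v ∷ as ++ bs)
          u′ = Unique-resp-↭ p u
          s≢v : s ≢ v
          s≢v ≡.refl = Unique-∉ u′ (here ≡.refl)
          s∉ : s ∉ as ++ bs
          s∉ s∈ = Unique-∉ u′ (there s∈)
          v∉ : v ∉ as ++ bs
          v∉ with _ ∷ u″ ← u′ = Unique-∉ u″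
          u‴ : Unique (s ∷ as ++ bs)
          u‴ with _ ∷ _ ∷ u″ ← u′ = ∉-Unique s∉ u″
          t∉T : t ∉ as ++ s ∷ bs
          t∉T t∈ with ∈-resp-↭ (shift s as bs) t∈
          ... | here ≡.refl = t∉ (⊆a (here ≡.refl))
          ... | there t∈′ = t∉ (⊆a (∈-resp-↭ (↭-sym p) (there (there t∈′))))
          col : Column (t ∷ as ++ s ∷ bs)
          col = column (∉-Unique t∉T (Unique-resp-↭ (↭-sym (shift s as bs)) u‴))
            (≡.trans (≡.cong suc (≡.trans (length-++ as) (≡.sym (length-++ as)))) len)
          moved : map (PC.transpose s v) (t ∷ as ++ s ∷ bs) ≡ t ∷ as ++ v ∷ bs
          moved = ≡.cong₂ _∷_ (swap-other (λ { ≡.refl → t∉ (⊆a (here ≡.refl)) }) (λ { ≡.refl → t∉ (⊆a (there (∈-insert as))) }))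
            (≡.trans (map-++ (PC.transpose s v) as (s ∷ bs)) (≡.cong₂ _++_ (map-transpose-∉ (s∉ ∘ ∈-++⁺ˡ) (v∉ ∘ ∈-++⁺ˡ))
              (≡.cong₂ _∷_ (swap-left s v) (map-transpose-∉ (s∉ ∘ ∈-++⁺ʳ as) (v∉ ∘ ∈-++⁺ʳ as)))))

      codimension-1-alternant : ∀ {T} → Column T → ∃[ k ] alternant T ∼ (k • alternant a)
      codimension-1-alternant {T} cT = cases left right xs↭ ys↭ left∉ right∉
        where
        open Overlap (compare Fin._≟_ (distinct cT) (distinct ca))
        lengths : ∀ left right → T ↭ left ++ both → a ↭ both ++ right → length left ≡ length right
        lengths left right p q = ℕ.+-cancelʳ-≡ (length both) _ _ (≡.trans (≡.sym (length-++ left)) (≡.trans (≡.sym (↭-length p))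
          (≡.trans (height cT) (≡.trans (≡.sym (height ca)) (≡.trans (↭-length q) (≡.trans (length-++ both) (ℕ.+-comm (length both) _)))))))
        cases : ∀ left right → T ↭ left ++ both → a ↭ both ++ right → (∀ {x} → x ∈ left → x ∉ a) → (∀ {x} → x ∈ right → x ∉ T) →
          ∃[ k ] alternant T ∼ (k • alternant a)
        cases [] (_ ∷ _) p q _ _ = contradiction (lengths [] _ p q) λ ()
        cases (t ∷ left) [] p q _ _ = contradiction (lengths (t ∷ left) [] p q) λ ()
        cases (t ∷ t′ ∷ left) (_ ∷ []) p q _ _ = contradiction (lengths (t ∷ t′ ∷ left) _ p q) λ ()
        cases [] [] p q _ _ = sign r , ≋⇒∼ (alternant-↭ r)
          where
          r : T ↭ a
          r = ↭-trans p (↭-sym (≡.subst (a ↭_) (++-identityʳ both) q))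
        cases (_ ∷ _) (i ∷ j ∷ right) p q _ ∉T = 0# , H⇒∼0 (alternant a) (alternant-fixed cT i≢j (∈a (here ≡.refl)) (∈a (there (here ≡.refl)))
            (∉T (here ≡.refl)) (∉T (there (here ≡.refl))))
          where
          ∈a : ∀ {k} → k ∈ i ∷ j ∷ right → k ∈ a
          ∈a k∈ = ∈-resp-↭ (↭-sym q) (∈-++⁺ʳ both k∈)
          i≢j : i ≢ j
          i≢j ≡.refl = tail-unique both (Unique-resp-↭ q (distinct ca)) (here ≡.refl)
            where
            tail-unique : ∀ both → Unique (both ++ i ∷ j ∷ right) → i ∉ j ∷ right
            tail-unique [] u = Unique-∉ u
            tail-unique (_ ∷ both) (_ ∷ u) = tail-unique both u
        cases (t ∷ []) (s ∷ []) p q t∉ _ with ι⁻¹ , inverse , _ ← #⇒invertible (char l) =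
          sign p * (ι⁻¹ * sign r) , ∼-trans (≋⇒∼ (alternant-↭ p)) (∼-trans (∼-• (sign p)
            (∼-trans (≋⇒∼ λ x → trans (sym (*-identityˡ _)) (trans (*-congʳ (trans (sym inverse) (*-congˡ (x-0≈x _)))) (*-assoc _ _ _)))
            (∼-trans (∼-• ι⁻¹ (∼-sym (replace-entry (column-↭ r ca) (∈-resp-↭ (↭-sym r)) (t∉ (here ≡.refl)))))
            (≋⇒∼ λ x → begin
               ι⁻¹ * alternant (s ∷ both) x ≈⟨ *-congˡ (*-identityˡ _) ⟨
               ι⁻¹ * (1# * alternant (s ∷ both) x) ≈⟨ *-congˡ (*-congʳ (sign-² r)) ⟨
               ι⁻¹ * (sign r * sign r * alternant (s ∷ both) x) ≈⟨ *-congˡ (trans (*-assoc _ _ _) (*-congˡ (sym (alternant-↭ r x)))) ⟩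
               ι⁻¹ * (sign r * alternant a x) ∎))))
            (≋⇒∼ λ x → solve 4 (λ p i r w → p :* (i :* (r :* w)) := (p :* (i :* r)) :* w) refl _ _ _ _))
          where
          r : a ↭ s ∷ both
          r = ↭-trans q (↭-trans (shift s both []) (Perm.prep s (Perm.↭-reflexive (++-identityʳ both))))

      ∼⇒φ : ∀ {f g} → f ∼ g → φ f a ≈ φ g a
      ∼⇒φ {f} {g} f∼g = begin
        φ f a                                       ≈⟨ solve 2 (λ f g → f := (f :+ :- con ℤ.1ℤ :* g) :+ g) refl _ (φ g a) ⟩
        (φ f a + - 1# * φ g a) + φ g a              ≈⟨ +-congʳ (trans (φ-⊕ f ((- 1#) • g) a) (+-congˡ (φ-• (- 1#) g a))) ⟨
        φ (f ⊕ ((- 1#) • g)) a + φ g a              ≈⟨ +-congʳ (H⇒φ f∼g) ⟩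
        0# + φ g a                                  ≈⟨ +-identityˡ _ ⟩
        φ g a                                       ∎

      codimension-1 : ∀ {f} → U f → ∃[ k ] f ∼ (k • alternant a)
      codimension-1 = U-elim (λ f → ∃[ k ] f ∼ (k • alternant a))
        (λ f≋g (k , p) → k , ∼-trans (∼-sym (≋⇒∼ f≋g)) p)
        (0# , H⇒∼0 (alternant a) H-0)
        (λ (k , p) (k′ , q) → k + k′ , ∼-trans (∼-⊕ p q) (≋⇒∼ λ x → sym (distribʳ _ k k′)))
        (λ k (k′ , p) → k * k′ , ∼-trans (∼-• k p) (≋⇒∼ λ x → sym (*-assoc k k′ _)))
        codimension-1-alternant

      φ⇒H : ∀ {f} → U f → φ f a ≈ 0# → Hᴬ f
      φ⇒H {f} Uf φ≈0 = vanish (codimension-1 Uf)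
        where
        vanish : ∃[ k ] f ∼ (k • alternant a) → Hᴬ f
        vanish (k , p) = H-resp (λ x → trans (+-congˡ (trans (*-congˡ (trans (*-congʳ k≈0) (zeroˡ _))) (zeroʳ _))) (+-identityʳ _)) p
          where
          k≈0 : k ≈ 0#
          k≈0 = #-cancel (φ-alternant (distinct ca) (height ca)) (trans (*-comm _ k)
            (trans (sym (φ-• k (alternant a) a)) (trans (sym (∼⇒φ p)) φ≈0)))

      multiplicity : ∀ {T} → Column T → Agreement T a → ∃[ m ] (ι (suc l) • alternant T) ∼ (ι m • alternant a)
      multiplicity cT equal = suc l , ≋⇒∼ (λ _ → refl)
      multiplicity {T} cT (one {as} {s} {t} {bs} t∉) = 1 , ∼-sym (∼-trans
        (≋⇒∼ λ x → trans (trans (*-congʳ (+-identityʳ 1#)) (*-identityˡ _)) (alternating-shift {w = λ T → alternant T x} (alternant-alternating x) as s bs))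
        (∼-trans (∼-• (parity as) (replace-entry (column-↭ r ca) (∈-resp-↭ (↭-sym r)) t∉))
        (≋⇒∼ λ x → trans (solve 3 (λ p i w → p :* (i :* w) := i :* (p :* w)) refl (parity as) (ι (suc l)) _)
          (*-congˡ (sym (alternating-shift {w = λ T → alternant T x} (alternant-alternating x) as t bs))))))
        where
        r : a ↭ s ∷ as ++ bs
        r = shift s as bs
      multiplicity cT (two i≢j i∈ j∈ i∉ j∉) = 0 , ∼-trans (∼-• (ι (suc l)) (H⇒∼0 (alternant a) (alternant-fixed cT i≢j i∈ j∈ i∉ j∉)))
        (≋⇒∼ λ x → solve 2 (λ i w → i :* (con ℤ.0ℤ :* w) := con ℤ.0ℤ :* w) refl (ι (suc l)) (alternant a x))

      +-multiplicity : ∀ {f g m m′} → (ι (suc l) • f) ∼ (ι m • alternant a) → (ι (suc l) • g) ∼ (ι m′ • alternant a) →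
        (ι (suc l) • (f ⊕ g)) ∼ (ι (m ℕ.+ m′) • alternant a)
      +-multiplicity {m = m} {m′} p q = ∼-trans (≋⇒∼ λ x → distribˡ _ _ _) (∼-trans (∼-⊕ p q)
        (≋⇒∼ λ x → trans (sym (distribʳ _ _ _)) (*-congʳ (sym (ι-+ m m′)))))

      multiplicity-sum : ∀ Ts → (∀ {T} → T ∈ Ts → Column T × Agreement T a) →
        ∃[ m ] (ι (suc l) • alternant-sum Ts) ∼ (ι m • alternant a)
      multiplicity-sum [] _ = 0 , ≋⇒∼ (λ x → trans (zeroʳ _) (sym (zeroˡ _)))
      multiplicity-sum (T ∷ Ts) h = let m , p = multiplicity (proj₁ (h (here ≡.refl))) (proj₂ (h (here ≡.refl)))
                                        m′ , q = multiplicity-sum Ts (h ∘ there)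
                                    in m ℕ.+ m′ , +-multiplicity {m = m} {m′} p q

      multiplicity-positive : ∀ Ts → (∀ {T} → T ∈ Ts → Column T × Agreement T a) → a ∈ Ts →
        ∃[ m ] (ι (suc l) • alternant-sum Ts) ∼ (ι (suc m) • alternant a)
      multiplicity-positive (T ∷ Ts) h (here ≡.refl) = let m , p = multiplicity-sum Ts (h ∘ there)
        in l ℕ.+ m , +-multiplicity {m = suc l} {m} (≋⇒∼ (λ _ → refl)) p
      multiplicity-positive (T ∷ Ts) h (there a∈) =
        let m , p = multiplicity (proj₁ (h (here ≡.refl))) (proj₂ (h (here ≡.refl)))
            m′ , q = multiplicity-positive Ts (h ∘ there) a∈
        in m ℕ.+ m′ , ∼-trans (+-multiplicity {m = m} {suc m′} p q) (≋⇒∼ λ x → reflexive (≡.cong (λ k → ι k * alternant a x) (ℕ.+-suc m m′)))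

      alternant-sum-∉H : ∀ Ts → (∀ {T} → T ∈ Ts → Column T × Agreement T a) → a ∈ Ts → ¬ Hᴬ (alternant-sum Ts)
      alternant-sum-∉H Ts h a∈ H∋ = let m , p = multiplicity-positive Ts h a∈ in
        #-irrefl {0#} refl (#-congʳ (begin
          ι (suc m) * φ (alternant a) a      ≈⟨ φ-• (ι (suc m)) (alternant a) a ⟨
          φ (ι (suc m) • alternant a) a      ≈⟨ ∼⇒φ p ⟨
          φ (ι (suc l) • alternant-sum Ts) a ≈⟨ φ-• (ι (suc l)) (alternant-sum Ts) a ⟩
          ι (suc l) * φ (alternant-sum Ts) a ≈⟨ trans (*-congˡ (H⇒φ H∋)) (zeroʳ _) ⟩
          0#                                 ∎) (x#0y#0→xy#0 (char m) (φ-alternant (distinct ca) (height ca))))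

    sets : List (Subset n)
    sets = subsetsOfSize (suc l) n

    m : ℕ
    m = length sets

    set : Fin m → Subset n
    set = lookup sets

    set-column : ∀ i → Column (elements (set i))
    set-column i = column (elements-unique (set i)) (≡.trans (length-elements (set i))
      (proj₂ (∈-filter⁻ (λ A → Subset.∣ A ∣ ℕ.≟ suc l) {xs = allSubsets n} (∈-lookup i))))

    set-index : ∀ {T} → Column T → ∃[ i ] (∀ {x} → x ∈ T → x ∈ₛ set i) × (∀ {x} → x ∈ₛ set i → x ∈ T)
    set-index {T} (column u len) = index A∈
      , (λ x∈ → ≡.subst (_ ∈ₛ_) (lookup-index A∈) (∈-select⁺ ∈T? x∈))
      , (λ x∈ → ∈-select⁻ ∈T? (≡.subst (_ ∈ₛ_) (≡.sym (lookup-index A∈)) x∈))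
      where
      ∈T? : ∀ x → Dec (x ∈ T)
      ∈T? x = DecPropositional._∈?_ Fin._≟_ x T
      A∈ : select ∈T? ∈ sets
      A∈ = ∈-filter⁺ (λ A → Subset.∣ A ∣ ℕ.≟ suc l) (∈-allSubsets _) (≡.trans (∣select-∈∣ ∈T? u) len)

    𝓐 : Arrangement (Fun n) (c ⊔ ℓ₁)
    𝓐 = record { space = U ; size = m ; hyperplane = λ i → H U (blocks (set i)) }

    open Arrangement 𝓐 using (hyperplane)

    module Hᵢ i = Hyperplane {set i} {elements (set i)} (set-column i) ∈-elements⁻ ∈-elements⁺

    φᵢ : Fin m → Fun n → Carrier
    φᵢ i f = φ f (elements (set i))

    module _ {F : Subset m} where

      ⋂-⊕ : ∀ {f g} → ⋂ 𝓐 F f → ⋂ 𝓐 F g → ⋂ 𝓐 F (f ⊕ g)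
      ⋂-⊕ (Uf , p) (Ug , q) = U-⊕ Uf Ug , λ j j∈ → Hᵢ.H-⊕ j (p j j∈) (q j j∈)

      ⋂-• : ∀ {f} k → ⋂ 𝓐 F f → ⋂ 𝓐 F (k • f)
      ⋂-• k (Uf , p) = U-• k Uf , λ j j∈ → Hᵢ.H-• j k (p j j∈)

    ⋂-antitone : ∀ {F G} → F ⊆ₛ G → ∀ {f} → ⋂ 𝓐 G f → ⋂ 𝓐 F f
    ⋂-antitone F⊆G (Uf , p) = Uf , λ j j∈ → p j (F⊆G j∈)

    ⊤-flat : IsFlat 𝓐 ⊤
    ⊤-flat i _ = ∈⊤

    ∩-flat : ∀ {F G} → IsFlat 𝓐 F → IsFlat 𝓐 G → IsFlat 𝓐 (F ∩ G)
    ∩-flat {F} {G} flat-F flat-G i h = x∈p∩q⁺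
      ( flat-F i (λ x p → h x (⋂-antitone {F ∩ G} {F} (proj₁ ∘ x∈p∩q⁻ F G) p))
      , flat-G i (λ x p → h x (⋂-antitone {F ∩ G} {G} (proj₂ ∘ x∈p∩q⁻ F G) p)))

    module Flatness {L : List (Subset m)} (isLattice : IsLatticeOfFlats 𝓐 L) where

      open IsLatticeOfFlats isLattice

      flat⇒∈ : ∀ {F} → IsFlat 𝓐 F → F ∈ L
      flat⇒∈ = Equivalence.from (complete _)

      ∈⇒flat : ∀ {F} → F ∈ L → IsFlat 𝓐 F
      ∈⇒flat = Equivalence.to (complete _)

      open Lattice {m} {L} unique (flat⇒∈ ⊤-flat) (λ F∈ G∈ → flat⇒∈ (∩-flat (∈⇒flat F∈) (∈⇒flat G∈))) public

      Implied : Subset m → Fin m → Fin m → Set _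
      Implied F e i = ∀ f → ⋂ 𝓐 F f → hyperplane e f → hyperplane i f

      implied-of-closure : ∀ {F e b} → b ∈ₛ closure F e → ¬ ¬ Implied F e b
      implied-of-closure {F} {e} {b} b∈ k = ¬¬-∀ (λ i → ¬¬-excluded-middle {A = Implied F e i}) λ dec →
        let C = select dec
            ⋂C : ∀ f → ⋂ 𝓐 F f → hyperplane e f → ⋂ 𝓐 C f
            ⋂C f p q = proj₁ p , λ j j∈ → ∈-select⁻ dec j∈ f p q
            C∈ : C ∈ L
            C∈ = flat⇒∈ λ i h → ∈-select⁺ dec λ f p q → h f (⋂C f p q)
        in k (∈-select⁻ dec (closure-⊆ C∈ (λ {i} i∈F → ∈-select⁺ dec λ f p _ → proj₂ p i i∈F) (∈-select⁺ dec λ _ _ q → q) b∈))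

      -- In the direction of w the hyperplane of e is transversal to every f.
      exchange : ∀ {F e b} → F ∈ L → b ∉ₛ F → b ∈ₛ closure F e → e ∈ₛ closure F b
      exchange {F} {e} {b} F∈ b∉F b∈ = ∈-closure λ {X} X∈ F⊆X b∈X → decidable-stable (e ∈ₛ? X) λ e∉X →
        implied-of-closure b∈ λ implied → e∉X (∈⇒flat X∈ e λ w w∈ → Hᵢ.φ⇒H e (proj₁ w∈) (proj₁ (tight _ _) λ φw#0 →
          b∉F (∈⇒flat F∈ b λ v v∈ → project implied (⋂-antitone F⊆X w∈) (proj₂ w∈ b b∈X) φw#0 v∈)))
        where
        project : Implied F e b → ∀ {w} → ⋂ 𝓐 F w → hyperplane b w → φᵢ e w # 0# → ∀ {v} → ⋂ 𝓐 F v → hyperplane b v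
        project implied {w} w∈ Hw φw#0 {v} v∈ = correct (#⇒invertible φw#0)
          where
          correct : ∃[ k ] k * (φᵢ e w - 0#) ≈ 1# × (φᵢ e w - 0#) * k ≈ 1# → hyperplane b v
          correct (k , inverse , _) = Hᵢ.H-resp b (λ x → solve 2 (λ v t → (v :+ :- t) :+ t := v) refl (v x) (t * w x))
              (Hᵢ.H-⊕ b (Hᵢ.H-resp b (λ x → +-congˡ (sym (-‿distribˡ-* t (w x)))) Hv′) (Hᵢ.H-• b t Hw))
            where
            t = φᵢ e v * k
            v′ = v ⊕ ((- t) • w)
            v′∈ : ⋂ 𝓐 F v′
            v′∈ = ⋂-⊕ v∈ (⋂-• (- t) w∈)
            φv′≈0 : φᵢ e v′ ≈ 0#
            φv′≈0 = begin
              φᵢ e v′                               ≈⟨ trans (φ-⊕ v ((- t) • w) (elements (set e))) (+-congˡ (φ-• (- t) w (elements (set e)))) ⟩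
              φᵢ e v + - t * φᵢ e w                 ≈⟨ solve 3 (λ a k b → a :+ :- (a :* k) :* b := a :+ :- (a :* (k :* (b :- con ℤ.0ℤ)))) refl (φᵢ e v) k (φᵢ e w) ⟩
              φᵢ e v - φᵢ e v * (k * (φᵢ e w - 0#)) ≈⟨ +-congˡ (-‿cong (trans (*-congˡ inverse) (*-identityʳ _))) ⟩
              φᵢ e v - φᵢ e v                       ≈⟨ -‿inverseʳ _ ⟩
              0#                                    ∎
            Hv′ : hyperplane b v′
            Hv′ = implied v′ v′∈ (Hᵢ.φ⇒H e (proj₁ v′∈) φv′≈0)

      open Matroid exchange public

      module Colouring (colour : Fin n → Fin (suc l)) where

        transversals : List (Fin (suc l)) → List (List (Fin n))
        transversals [] = [] ∷ []
        transversals (k ∷ ks) = cartesianProductWith _∷_ (filter (λ x → colour x Fin.≟ k) (allFin n)) (transversals ks)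

        ∈-transversals⁺ : ∀ T → T ∈ transversals (map colour T)
        ∈-transversals⁺ [] = here ≡.refl
        ∈-transversals⁺ (t ∷ T) = ∈-cartesianProductWith⁺ _∷_
          (∈-filter⁺ (λ x → colour x Fin.≟ colour t) (∈-allFin t) ≡.refl) (∈-transversals⁺ T)

        ∈-transversals⁻ : ∀ {ks T} → T ∈ transversals ks → map colour T ≡ ks
        ∈-transversals⁻ {[]} (here ≡.refl) = ≡.refl
        ∈-transversals⁻ {k ∷ ks} T∈ with t , T , t∈ , T∈′ , ≡.refl ← ∈-cartesianProductWith⁻ _∷_ (filter (λ x → colour x Fin.≟ k) (allFin n)) (transversals ks) T∈ =
          ≡.cong₂ _∷_ (proj₂ (∈-filter⁻ (λ x → colour x Fin.≟ k) {xs = allFin n} t∈)) (∈-transversals⁻ T∈′)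

        transversals-unique : ∀ ks → Unique (transversals ks)
        transversals-unique [] = [] ∷ []
        transversals-unique (k ∷ ks) = cartesianProductWith⁺ _∷_ ∷-injective
          (filter⁺ (λ x → colour x Fin.≟ k) (allFin⁺ n)) (transversals-unique ks)

        palette : List (Fin (suc l))
        palette = allFin (suc l)

        Transversal : List (Fin n) → Set
        Transversal T = map colour T ≡ palette

        colours-unique : ∀ {T} → Transversal T → Unique (map colour T)
        colours-unique eq = ≡.subst Unique (≡.sym eq) (allFin⁺ (suc l))

        transversal-column : ∀ {T} → Transversal T → Column T
        transversal-column {T} eq = column (map⁻-unique (colours-unique eq))
          (≡.trans (≡.sym (length-map colour T)) (≡.trans (≡.cong length eq) (length-tabulate id)))

        agreement : ∀ {T a} → map colour T ≡ map colour a → Unique (map colour a) → Agreement T a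
        agreement {[]} {[]} _ _ = equal
        agreement {t ∷ T} {s ∷ a} eq u@(_ ∷ u′) with t≡s , T≡a ← ∷-injective eq with t Fin.≟ s | agreement T≡a u′
        ... | yes ≡.refl | equal = equal
        ... | yes ≡.refl | one {as} {t = t′} t′∉ = one {s ∷ as} λ { (here ≡.refl) → Unique-∉ u (≡.subst (colour s ∈_) T≡a (∈-map⁺ colour (∈-insert as))) ; (there t∈) → t′∉ t∈ }
        ... | yes ≡.refl | two i≢j i∈ j∈ i∉ j∉ = two i≢j (there i∈) (there j∈)
                (λ { (here ≡.refl) → Unique-∉ u (∈-map⁺ colour i∈) ; (there i∈) → i∉ i∈ })
                (λ { (here ≡.refl) → Unique-∉ u (∈-map⁺ colour j∈) ; (there j∈) → j∉ j∈ })
        ... | no t≢s | equal = one {[]} λ { (here t≡s) → t≢s t≡s ; (there t∈) → Unique-∉ u (≡.subst (_∈ map colour T) t≡s (∈-map⁺ colour t∈)) }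
        ... | no t≢s | one {as} {s′} {t′} {bs} t′∉ = two s≢s′ (here ≡.refl) (there (∈-insert as))
                (λ { (here s≡t) → t≢s (≡.sym s≡t) ; (there s∈) → Unique-∉ u (≡.subst (colour s ∈_) T≡a (∈-map⁺ colour s∈)) })
                (λ { (here ≡.refl) → Unique-∉ u (≡.subst (_∈ map colour (as ++ s′ ∷ bs)) t≡s (∈-map⁺ colour (∈-insert as)))
                   ; (there s′∈) → s′∉ s′∈ })
          where
          s≢s′ : s ≢ s′
          s≢s′ ≡.refl = Unique-∉ u (∈-map⁺ colour (∈-insert as))
          s′∉ : s′ ∉ as ++ t′ ∷ bs
          s′∉ s′∈ with ∈-resp-↭ (shift t′ as bs) s′∈
          ... | here ≡.refl = t′∉ (∈-insert as)
          ... | there s′∈′ = Unique-∉ (Unique-resp-↭ (shift s′ as bs) (map⁻-unique u′)) s′∈′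
        ... | no t≢s | two i≢j i∈ j∈ i∉ j∉ = two i≢j (there i∈) (there j∈) (new i∈ i∉) (new j∈ j∉)
          where
          new : ∀ {i} → i ∈ a → i ∉ T → i ∉ t ∷ T
          new i∈ i∉ (here ≡.refl) = Unique-∉ u (≡.subst (_∈ map colour a) t≡s (∈-map⁺ colour i∈))
          new i∈ i∉ (there i∈T) = i∉ i∈T

        Monochromatic : Fin m → Set
        Monochromatic i = ∃[ x ] ∃[ y ] x ≢ y × x ∈ₛ set i × y ∈ₛ set i × colour x ≡ colour y

        monochromatic? : ∀ i → Dec (Monochromatic i)
        monochromatic? i = Fin.any? λ x → Fin.any? λ y → ¬? (x Fin.≟ y) ×-dec (x ∈ₛ? set i) ×-dec (y ∈ₛ? set i) ×-dec (colour x Fin.≟ colour y)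

        coatom : Subset m
        coatom = select monochromatic?

        v : Fun n
        v = alternant-sum (transversals palette)

        v-fixed : ∀ {x y} → colour x ≡ colour y → (transpose x y · v) ≋ v
        v-fixed {x} {y} eq p = trans (reflexive (alternant-sum-map τ (transversals palette) p)) (sym (alternant-sum-↭ permuted p))
          where
          τ = PC.transpose x y
          colour-τ : ∀ k → colour (τ k) ≡ colour k
          colour-τ k with k Fin.≟ x
          ... | yes ≡.refl = ≡.sym eq
          ... | no _ with k Fin.≟ y
          ...   | yes ≡.refl = eq
          ...   | no _ = ≡.refl
          permuted : transversals palette ↭ map (map τ) (transversals palette)
          permuted = Unique-⊆-≥⇒↭
            (Unique-map-∈ (map τ) (λ _ _ → map-injective (τ-injective (swap-involutive x y))) (transversals-unique palette))
            (λ T∈′ → let T , T∈ , T≡ = ∈-map⁻ (map τ) T∈′ in ≡.subst (_∈ transversals palette) (≡.sym T≡)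
              (≡.subst (λ ks → map τ T ∈ transversals ks)
                (≡.trans (≡.sym (map-∘ T)) (≡.trans (map-cong colour-τ T) (∈-transversals⁻ {palette} T∈))) (∈-transversals⁺ (map τ T))))
            (ℕ.≤-reflexive (≡.sym (length-map (map τ) (transversals palette))))

        U-v : U v
        U-v = U-alternant-sum (transversals palette) (transversal-column ∘ ∈-transversals⁻)

        v∈H : ∀ {i} → Monochromatic i → hyperplane i v
        v∈H {i} (x , y , x≢y , x∈ , y∈ , eq) = Hᵢ.H-fixed i x≢y (∈-elements⁺ x∈) (∈-elements⁺ y∈) U-v (v-fixed eq)

        arrange : ∀ {i} → ¬ Monochromatic i → ∃[ a ] Transversal a × elements (set i) ↭ a
        arrange {i} ¬mono = let a , eq , p = ↭-map-inv colour (↭-sym (Unique-⊆-≥⇒↭ {ys = palette} unique-colours (λ {k} _ → ∈-allFin k)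
                                  (ℕ.≤-reflexive (≡.trans (length-tabulate id) (≡.sym (≡.trans (length-map colour e) (height (set-column i)))))))) in
                            a , ≡.sym eq , p
          where
          e = elements (set i)
          unique-colours : Unique (map colour e)
          unique-colours = Unique-map-∈ colour (λ {x} {y} x∈ y∈ eq → decidable-stable (x Fin.≟ y) λ x≢y →
            ¬mono (x , y , x≢y , ∈-elements⁻ x∈ , ∈-elements⁻ y∈ , eq)) (elements-unique (set i))

        v∉H : ∀ {i} → ¬ Monochromatic i → ¬ hyperplane i v
        v∉H {i} ¬mono = let a , transversal , p = arrange ¬mono in
          Hyperplane.alternant-sum-∉H {set i} {a} (transversal-column transversal)
            (∈-elements⁻ ∘ ∈-resp-↭ (↭-sym p)) (∈-resp-↭ p ∘ ∈-elements⁺) (transversals palette)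
            (λ T∈ → transversal-column (∈-transversals⁻ T∈) , agreement (≡.trans (∈-transversals⁻ T∈) (≡.sym transversal)) (colours-unique transversal))
            (≡.subst (λ ks → a ∈ transversals ks) transversal (∈-transversals⁺ a))

        coatom-flat : IsFlat 𝓐 coatom
        coatom-flat i h = ∈-select⁺ monochromatic? (decidable-stable (monochromatic? i) λ ¬mono →
          v∉H ¬mono (h v (U-v , λ j j∈ → v∈H (∈-select⁻ monochromatic? j∈))))

        recolour : (w : List (Fin n) → Carrier) → ∀ {ks} →
          (∀ pre s t post → map colour (pre ++ s ∷ post) ≡ ks → colour t ≡ colour s → w (pre ++ s ∷ post) ≈ 0# → w (pre ++ t ∷ post) ≈ 0#) →
          ∀ {T T′} → map colour T ≡ ks → map colour T′ ≡ ks → w T ≈ 0# → w T′ ≈ 0#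
        recolour w step {[]} {[]} _ _ w≈0 = w≈0
        recolour w step {[]} {_ ∷ _} ≡.refl () w≈0
        recolour w step {t ∷ T} {t′ ∷ T′} ≡.refl eq w≈0 = recolour (λ c → w (t′ ∷ c)) {map colour T}
          (λ pre s u post eq′ same → step (t′ ∷ pre) s u post (≡.cong₂ _∷_ (∷-injectiveˡ eq) eq′) same)
          ≡.refl (∷-injectiveʳ eq) (step [] t t′ T ≡.refl (∷-injectiveˡ eq) w≈0)

        zero-on-transversals : ∀ {f} → ⋂ 𝓐 coatom f → ∀ {T T′} → Transversal T → Transversal T′ → φ f T ≈ 0# → φ f T′ ≈ 0#
        zero-on-transversals {f} f∈ = recolour (φ f) step
          where
          -- A face containing both s and t is monochromatic.
          face : ∀ {s t x c u} → s ≢ t → colour s ≡ colour t → Unique u → length u ≡ suc (suc l) → u ↭ x ∷ c → s ∈ c → t ∈ c → φ f c ≈ 0#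
          face {s} {t} {c = c} s≢t eq uu len p s∈ t∈ with _ ∷ uc ← Unique-resp-↭ p uu =
            Hyperplane.H⇒φ {set i} {c} col ⊆set set⊆ (proj₂ f∈ i (∈-select⁺ monochromatic? (s , t , s≢t , ⊆set s∈ , ⊆set t∈ , eq)))
            where
            col : Column c
            col = column uc (ℕ.suc-injective (≡.trans (≡.sym (↭-length p)) len))
            i = proj₁ (set-index col)
            ⊆set = proj₁ (proj₂ (set-index col))
            set⊆ = proj₂ (proj₂ (set-index col))
          step : ∀ pre s t post → map colour (pre ++ s ∷ post) ≡ palette → colour t ≡ colour s → φ f (pre ++ s ∷ post) ≈ 0# → φ f (pre ++ t ∷ post) ≈ 0#
          step pre s t post transversal eq φ≈0 with s Fin.≟ t
          ... | yes ≡.refl = φ≈0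
          ... | no s≢t = trans (δ-adjacent pre post pre-face post-face (φ-φ f (pre ++ s ∷ t ∷ post))) φ≈0
            where
            col : Column (pre ++ s ∷ post)
            col = transversal-column transversal
            t∉ : t ∉ pre ++ s ∷ post
            t∉ t∈ = s≢t (Unique-map-injective colour (colours-unique transversal) (∈-insert pre) t∈ (≡.sym eq))
            q : t ∷ pre ++ s ∷ post ↭ pre ++ s ∷ t ∷ post
            q = ↭-trans (↭-sym (shift t pre (s ∷ post))) (++⁺ˡ pre (Perm.swap t s Perm.refl))
            uu : Unique (pre ++ s ∷ t ∷ post)
            uu = Unique-resp-↭ q (∉-Unique t∉ (distinct col))
            len : length (pre ++ s ∷ t ∷ post) ≡ suc (suc l)
            len = ≡.trans (≡.sym (↭-length q)) (≡.cong suc (height col))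
            pre-face : ∀ as x bs → pre ≡ as ++ x ∷ bs → φ f (as ++ bs ++ s ∷ t ∷ post) ≈ 0#
            pre-face as x bs ≡.refl = face s≢t (≡.sym eq) uu len
              (≡.subst (_↭ x ∷ as ++ bs ++ s ∷ t ∷ post) (≡.sym (++-assoc as (x ∷ bs) _)) (shift x as (bs ++ s ∷ t ∷ post)))
              (∈-++⁺ʳ as (∈-++⁺ʳ bs (here ≡.refl))) (∈-++⁺ʳ as (∈-++⁺ʳ bs (there (here ≡.refl))))
            post-face : ∀ as x bs → post ≡ as ++ x ∷ bs → φ f (pre ++ s ∷ t ∷ as ++ bs) ≈ 0#
            post-face as x bs ≡.refl = face s≢t (≡.sym eq) uu len
              (↭-trans (++⁺ˡ pre (Perm.prep s (Perm.prep t (shift x as bs))))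
                (↭-trans (++⁺ˡ pre (↭-trans (Perm.prep s (Perm.swap t x Perm.refl)) (Perm.swap s x Perm.refl))) (shift x pre (s ∷ t ∷ as ++ bs))))
              (∈-++⁺ʳ pre (here ≡.refl)) (∈-++⁺ʳ pre (there (here ≡.refl)))

        coatom-maximal : ∀ {F} → F ∈ L → coatom ⊂ₛ F → F ≡ ⊤
        coatom-maximal {F} F∈ (coatom⊆F , i , i∈F , i∉) = ⊆-antisym ⊆⊤ λ {j} _ → ∈⇒flat F∈ j (contained j)
          where
          contained : ∀ j f → ⋂ 𝓐 F f → hyperplane j f
          contained j f f∈ with monochromatic? j
          ... | yes mono = proj₂ f∈ j (coatom⊆F (∈-select⁺ monochromatic? mono))
          ... | no ¬mono = let a , transversal , p = arrange (i∉ ∘ ∈-select⁺ monochromatic?)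
                               b , transversal′ , q = arrange ¬mono in
            Hyperplane.φ⇒H {set j} {b} (transversal-column transversal′) (∈-elements⁻ ∘ ∈-resp-↭ (↭-sym q)) (∈-resp-↭ q ∘ ∈-elements⁺) (proj₁ f∈)
              (zero-on-transversals (⋂-antitone coatom⊆F f∈) transversal transversal′
                (Hyperplane.H⇒φ {set i} {a} (transversal-column transversal) (∈-elements⁻ ∘ ∈-resp-↭ (↭-sym p)) (∈-resp-↭ p ∘ ∈-elements⁺) (proj₂ f∈ i i∈F)))

        transversal-∉ : ∀ {T} → Transversal T → ∃[ i ] ¬ Monochromatic i × (∀ {x} → x ∈ T → x ∈ₛ set i)
        transversal-∉ {T} transversal = let i , ⊆set , set⊆ = set-index (transversal-column transversal) in
          i , (λ (x , y , x≢y , x∈ , y∈ , eq) → x≢y (Unique-map-injective colour (colours-unique transversal) (set⊆ x∈) (set⊆ y∈) eq)) , ⊆set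

        module _ (surjective : ∀ k → ∃[ x ] colour x ≡ k) where

          choice-transversal : (pick : Fin (suc l) → Fin n) → (∀ k → colour (pick k) ≡ k) → Transversal (map pick palette)
          choice-transversal pick eq = ≡.trans (≡.sym (map-∘ palette)) (map-id-local (All.tabulate λ {k} _ → eq k))

          coatom⊂⊤ : coatom ⊂ₛ ⊤
          coatom⊂⊤ = let i , ¬mono , _ = transversal-∉ (choice-transversal (proj₁ ∘ surjective) (proj₂ ∘ surjective)) in
            ⊆⊤ , i , ∈⊤ , ¬mono ∘ ∈-select⁻ monochromatic?

          separating : ∀ {x y} → colour x ≢ colour y → ∃[ i ] ¬ Monochromatic i × x ∈ₛ set i × y ∈ₛ set i
          separating {x} {y} x≢y = let i , ¬mono , ⊆set = transversal-∉ (choice-transversal pick pick-colour) in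
            i , ¬mono , ⊆set (≡.subst (_∈ map pick palette) pick-x (∈-map⁺ pick (∈-allFin (colour x))))
                      , ⊆set (≡.subst (_∈ map pick palette) pick-y (∈-map⁺ pick (∈-allFin (colour y))))
            where
            pick : Fin (suc l) → Fin n
            pick k with k Fin.≟ colour x
            ... | yes _ = x
            ... | no _ with k Fin.≟ colour y
            ...   | yes _ = y
            ...   | no _ = proj₁ (surjective k)
            pick-colour : ∀ k → colour (pick k) ≡ k
            pick-colour k with k Fin.≟ colour x
            ... | yes eq = ≡.sym eq
            ... | no _ with k Fin.≟ colour y
            ...   | yes eq = ≡.sym eq
            ...   | no _ = proj₂ (surjective k)
            pick-x : pick (colour x) ≡ x
            pick-x with colour x Fin.≟ colour x
            ... | yes _ = ≡.refl
            ... | no x≢x = contradiction ≡.refl x≢x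
            pick-y : pick (colour y) ≡ y
            pick-y with colour y Fin.≟ colour x
            ... | yes y≡x = contradiction (≡.sym y≡x) x≢y
            ... | no _ with colour y Fin.≟ colour y
            ...   | yes _ = ≡.refl
            ...   | no y≢y = contradiction ≡.refl y≢y

      coatom-kernel : ∀ {colour colour′ : Fin n → Fin (suc l)} → (∀ k → ∃[ x ] colour′ x ≡ k) →
        Colouring.coatom colour ≡ Colouring.coatom colour′ → ∀ {x y} → colour x ≡ colour y → colour′ x ≡ colour′ y
      coatom-kernel {colour} {colour′} surjective′ eq {x} {y} same with x Fin.≟ y
      ... | yes ≡.refl = ≡.refl
      ... | no x≢y = decidable-stable (colour′ x Fin.≟ colour′ y) λ different →
        let i , ¬mono , x∈ , y∈ = Colouring.separating colour′ surjective′ different in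
        ¬mono (∈-select⁻ (Colouring.monochromatic? colour′) (≡.subst (i ∈ₛ_) eq
          (∈-select⁺ (Colouring.monochromatic? colour) (x , y , x≢y , x∈ , y∈ , same))))

-- Tableaux of hook shape

applyUpTo-const : ∀ {a} {A : Set a} {f : ℕ → A} {x} k → (∀ j → j < k → f j ≡ x) → applyUpTo f k ≡ replicate k x
applyUpTo-const zero _ = ≡.refl
applyUpTo-const (suc k) eq = ≡.cong₂ _∷_ (eq 0 (s≤s z≤n)) (applyUpTo-const k λ j j<k → eq (suc j) (s≤s j<k))

conjugate-hook : ∀ l k → conjugate (suc k ∷ replicate l 1) ≡ suc l ∷ replicate k 1
conjugate-hook l k = ≡.trans (≡.cong (λ r → map parts (upTo r)) longest) (≡.cong₂ _∷_ first
  (≡.trans (map-applyUpTo suc parts k) (applyUpTo-const k other)))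
  where
  ones : List ℕ
  ones = replicate l 1
  parts : ℕ → ℕ
  parts j = length (filter (j ℕ.<?_) (suc k ∷ ones))
  longest : max 0 (suc k ∷ ones) ≡ suc k
  longest = ℕ.≤-antisym (max≤v⁺ z≤n (ℕ.≤-refl ∷ All.replicate⁺ l (s≤s z≤n))) (v≤max⁺ 0 (suc k ∷ ones) (inj₂ (here ℕ.≤-refl)))
  first : parts 0 ≡ suc l
  first = ≡.cong suc (all l)
    where
    all : ∀ l → length (filter (0 ℕ.<?_) (replicate l 1)) ≡ l
    all zero = ≡.refl
    all (suc l) = ≡.cong suc (all l)
  other : ∀ j → j < k → parts (suc j) ≡ 1
  other j j<k = ≡.trans (≡.cong length (filter-accept (suc j ℕ.<?_) {suc k} {ones} (s≤s j<k)))
    (≡.cong (suc ∘ length) (filter-none (suc j ℕ.<?_) (All.replicate⁺ l λ { (s≤s ()) })))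

∸-suc-< : ∀ {l n} → l < n → n ∸ l ≡ suc (n ∸ suc l)
∸-suc-< {zero} (s≤s _) = ≡.refl
∸-suc-< {suc l} (s≤s l<n) = ∸-suc-< l<n

lookup-injective : ∀ {a} {A : Set a} {xs : List A} → Unique xs → ∀ {i j} → lookup xs i ≡ lookup xs j → i ≡ j
lookup-injective {xs = x ∷ xs} u {zero} {zero} eq = ≡.refl
lookup-injective {xs = x ∷ xs} u {zero} {suc j} eq = contradiction (≡.subst (_∈ xs) (≡.sym eq) (∈-lookup j)) (Unique-∉ u)
lookup-injective {xs = x ∷ xs} u {suc i} {zero} eq = contradiction (≡.subst (_∈ xs) eq (∈-lookup i)) (Unique-∉ u)
lookup-injective {xs = x ∷ xs} (_ ∷ u) {suc i} {suc j} eq = ≡.cong suc (lookup-injective u eq)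

-- Cells of a diagram whose columns all have length one are entries of a list.
module UnitColumns {a} {A : Set a} where

  UnitCell : List A → Set
  UnitCell zs = Σ[ j ∈ Fin (length (replicate (length zs) 1)) ] Fin (lookup (replicate (length zs) 1) j)

  entry : (zs : List A) → Fin (length (replicate (length zs) 1)) → A
  entry (z ∷ zs) zero = z
  entry (z ∷ zs) (suc j) = entry zs j

  entry-∈ : ∀ zs j → entry zs j ∈ zs
  entry-∈ (z ∷ zs) zero = here ≡.refl
  entry-∈ (z ∷ zs) (suc j) = there (entry-∈ zs j)

  position : ∀ {zs x} → x ∈ zs → UnitCell zs
  position {_ ∷ _} (here _) = zero , zero
  position {_ ∷ _} (there x∈) = let j , i = position x∈ in suc j , i

  entry-position : ∀ {zs x} (x∈ : x ∈ zs) → entry zs (proj₁ (position x∈)) ≡ x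
  entry-position {_ ∷ _} (here eq) = ≡.sym eq
  entry-position {_ ∷ _} (there x∈) = entry-position x∈

  entry-injective : ∀ {zs} → Unique zs → ∀ {i j} → entry zs i ≡ entry zs j → i ≡ j
  entry-injective {z ∷ zs} u {zero} {zero} eq = ≡.refl
  entry-injective {z ∷ zs} u {zero} {suc j} eq = contradiction (≡.subst (_∈ zs) (≡.sym eq) (entry-∈ zs j)) (Unique-∉ u)
  entry-injective {z ∷ zs} u {suc i} {zero} eq = contradiction (≡.subst (_∈ zs) eq (entry-∈ zs i)) (Unique-∉ u)
  entry-injective {z ∷ zs} (_ ∷ u) {suc i} {suc j} eq = ≡.cong suc (entry-injective u eq)

unit-length : ∀ k j → lookup (replicate k 1) j ≡ 1
unit-length (suc k) zero = ≡.refl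
unit-length (suc k) (suc j) = unit-length k j

Fin1-unique : ∀ {k} → k ≡ 1 → (i j : Fin k) → i ≡ j
Fin1-unique ≡.refl zero zero = ≡.refl

module Tableaux {c ℓ₁ ℓ₂} (K : HeytingField c ℓ₁ ℓ₂) (char : Representations.CharacteristicZero K) {n : ℕ} (l : ℕ) where

  open Representations K
  open HeytingField K using (heytingCommutativeRing)
  open CommutativeRing (HeytingCommutativeRing.commutativeRing heytingCommutativeRing) hiding (zero)
  open Alternants K
  open Evaluation char {n} l using (alternant)
  open Hyperplanes K char {n} l using (Column; column)
  open RawMonoidOps *-rawMonoid using () renaming (sum to ∏)

  ∏-difference : ∀ {k} y (z : Vector Carrier k) → ∏ (λ j → y - z j) ≡ difference-product y (tabulate z)
  ∏-difference {zero} y z = ≡.refl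
  ∏-difference {suc k} y z = ≡.cong (_*_ (y - head z)) (∏-difference y (tail z))

  Δ-V : ∀ {k} (y : Vector Carrier k) → Δ y ≡ V (tabulate y)
  Δ-V {zero} y = ≡.refl
  Δ-V {suc k} y = ≡.cong₂ _*_ (∏-difference (head y) (tail y)) (Δ-V (tail y))

  Δ-1 : ∀ {k} → k ≡ 1 → (y : Vector Carrier k) → Δ y ≈ 1#
  Δ-1 ≡.refl y = *-identityˡ 1#

  ∏-1 : ∀ {k} {y : Vector Carrier k} → (∀ j → y j ≈ 1#) → ∏ y ≈ 1#
  ∏-1 {zero} _ = refl
  ∏-1 {suc k} eq = trans (*-cong (eq zero) (∏-1 (eq ∘ suc))) (*-identityˡ 1#)

  columns : (ν : List ℕ) → Cell ν ↔ Fin n → Fun n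
  columns ν t x = ∏ λ j → Δ λ i → x (Inverse.to t (j , i))

  first-column : ∀ {h k} → Cell (h ∷ replicate k 1) ↔ Fin n → List (Fin n)
  first-column t = tabulate λ i → Inverse.to t (zero , i)

  columns-alternant : ∀ {h k} (t : Cell (h ∷ replicate k 1) ↔ Fin n) → columns (h ∷ replicate k 1) t ≋ alternant (first-column t)
  columns-alternant {h} {k} t x = trans (*-cong
      (reflexive (≡.trans (Δ-V (λ i → x (Inverse.to t (zero , i)))) (≡.cong V (≡.sym (map-tabulate (λ i → Inverse.to t (zero , i)) x)))))
      (∏-1 {length (replicate k 1)} (λ j → Δ-1 (unit-length k j) (λ i → x (Inverse.to t (suc j , i))))))
    (*-identityʳ _)

  first-column-unique : ∀ {h k} (t : Cell (h ∷ replicate k 1) ↔ Fin n) → Unique (first-column t)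
  first-column-unique {h} {k} t = tabulate⁺ λ eq → cell-injective (Injection.injective (↔⇒↣ t) eq)
    where
    cell-injective : ∀ {i i′ : Fin h} → _≡_ {A = Cell (h ∷ replicate k 1)} (zero , i) (zero , i′) → i ≡ i′
    cell-injective ≡.refl = ≡.refl

  complete-tableau : ∀ {T zs} → Unique (T ++ zs) → (∀ x → x ∈ T ++ zs) → Cell (length T ∷ replicate (length zs) 1) ↔ Fin n
  complete-tableau {T} {zs} u complete = mk↔ₛ′ to from to-from (λ cell → to-injective (to-from (to cell)))
    where
    open UnitColumns {A = Fin n}
    uT : Unique T
    uT = Unique-++ˡ T u
    uzs : Unique zs
    uzs = Unique-++ʳ T u
    to : Cell (length T ∷ replicate (length zs) 1) → Fin n
    to (zero , i) = lookup T i
    to (suc j , _) = entry zs j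
    locate : ∀ x → x ∈ T ⊎ x ∈ zs → Cell (length T ∷ replicate (length zs) 1)
    locate x (inj₁ x∈) = zero , index x∈
    locate x (inj₂ x∈) = let j , i = position x∈ in suc j , i
    to-locate : ∀ x p → to (locate x p) ≡ x
    to-locate x (inj₁ x∈) = ≡.sym (lookup-index x∈)
    to-locate x (inj₂ x∈) = entry-position x∈
    from : Fin n → Cell (length T ∷ replicate (length zs) 1)
    from x = locate x (∈-++⁻ T (complete x))
    to-from : ∀ x → to (from x) ≡ x
    to-from x = to-locate x (∈-++⁻ T (complete x))
    to-injective : ∀ {p q} → to p ≡ to q → p ≡ q
    to-injective {zero , i} {zero , i′} eq = ≡.cong (zero ,_) (lookup-injective uT eq)
    to-injective {zero , i} {suc j , _} eq = contradiction (≡.subst (_∈ zs) (≡.sym eq) (entry-∈ zs j)) (++-disjoint T u (∈-lookup i))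
    to-injective {suc j , _} {zero , i} eq = contradiction (≡.subst (_∈ zs) eq (entry-∈ zs j)) (++-disjoint T u (∈-lookup i))
    to-injective {suc j , i} {suc j′ , i′} eq with entry-injective uzs {j} {j′} eq
    ... | ≡.refl = ≡.cong (suc j ,_) (Fin1-unique (unit-length (length zs) j) i i′)

  tableau-with-column : ∀ {T} → Column T → ∃[ t ] columns (suc l ∷ replicate (n ∸ suc l) 1) t ≋ alternant T
  tableau-with-column {T} (column uT lenT) with zs , p ← Unique-⊆-↭ {ys = allFin n} uT (λ {x} _ → ∈-allFin x) =
    ≡.subst (λ ν → ∃[ t ] columns ν t ≋ alternant T) (≡.cong₂ (λ h k → h ∷ replicate k 1) lenT zs-length)
      (t , λ x → trans (columns-alternant t x) (reflexive (≡.cong (λ T → alternant T x) (tabulate-lookup T))))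
    where
    t : Cell (length T ∷ replicate (length zs) 1) ↔ Fin n
    t = complete-tableau {T} {zs} (Unique-resp-↭ p (allFin⁺ n)) (λ x → ∈-resp-↭ p (∈-allFin x))
    zs-length : length zs ≡ n ∸ suc l
    zs-length = ≡.trans (≡.sym (ℕ.m+n∸m≡n (suc l) (length zs))) (≡.cong {A = ℕ} {B = ℕ} (λ k → k ∸ suc l)
      (≡.trans {j = length T ℕ.+ length zs} (≡.cong (ℕ._+ length zs) (≡.sym lenT)) (≡.trans (≡.sym (length-++ T)) (≡.trans (≡.sym (↭-length p)) (length-tabulate {n = n} id)))))

  module _ (l<n : l < n) where

    conjugate-≡ : conjugate (hook l n) ≡ suc l ∷ replicate (n ∸ suc l) 1
    conjugate-≡ = ≡.trans (≡.cong (λ k → conjugate (k ∷ replicate l 1)) (∸-suc-< l<n)) (conjugate-hook l (n ∸ suc l))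

    specht-column : (t : Tableau (hook l n) n) → ∃[ T ] Column T × specht (hook l n) t ≋ alternant T
    specht-column = ≡.subst (λ ν → (t : Cell ν ↔ Fin n) → ∃[ T ] Column T × columns ν t ≋ alternant T) (≡.sym conjugate-≡)
      (λ t → first-column t , column (first-column-unique t) (length-tabulate (λ i → Inverse.to t (zero , i))) , columns-alternant t)

    column-specht : ∀ {T} → Column T → ∃[ t ] specht (hook l n) t ≋ alternant T
    column-specht {T} cT = ≡.subst (λ ν → ∃[ t ] columns ν t ≋ alternant T) (≡.sym conjugate-≡) (tableau-with-column cT)

    S : Pred (Fun n) (c ⊔ ℓ₁)
    S = Specht (hook l n) n

    S-• : ∀ {f} k → S f → S (k • f)
    S-• = Sums.sum-• K λ { k (k′ , eq) → k * k′ , λ x → trans (*-congˡ (eq x)) (sym (*-assoc k k′ _)) }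

    S-alternant : ∀ {T} → Column T → S (alternant T)
    S-alternant cT = let t , eq = column-specht cT in Sums.sum-∋ K t (1# , λ x → trans (sym (eq x)) (sym (*-identityˡ _)))

    S-elim : ∀ {q} (Q : Pred (Fun n) q) → (∀ {f g} → f ≋ g → Q f → Q g) → Q 0ᶠ → (∀ {f g} → Q f → Q g → Q (f ⊕ g)) →
      (∀ {f} k → Q f → Q (k • f)) → (∀ {T} → Column T → Q (alternant T)) → ∀ {f} → S f → Q f
    S-elim Q resp Q0 Q⊕ Q• QT = Sums.sum-elim K Q resp Q0 Q⊕ λ { {t} (k , eq) → let T , cT , eq′ = specht-column t in
      resp (λ x → trans (*-congˡ (sym (eq′ x))) (sym (eq x))) (Q• k (QT cT)) }

    module Specht-module = Hyperplanes.SpechtModule K char l {S} (Sums.sum-0 K) (Sums.sum-⊕ K) S-• S-alternant S-elim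

open import Data.Nat.Base using (_+_; _*_; _^_; _!)
open import Data.Rational.Base as ℚ using (ℚ; 0ℚ; 1ℚ; _/_; ∣_∣; toℚᵘ; ↧ₙ_)
open ≡ using (refl; sym; trans; cong; cong₂; subst; subst₂)

-- Partitions into blocks

stirling : ℕ → ℕ → ℕ
stirling zero zero = 1
stirling zero (suc k) = 0
stirling (suc n) zero = 0
stirling (suc n) (suc k) = suc k * stirling n (suc k) + stirling n k

choose : ℕ → ℕ → ℕ
choose n zero = 1
choose zero (suc k) = 0
choose (suc n) (suc k) = choose n (suc k) + choose n k

-- One colouring for each partition of the positions into k nonempty blocks: a
-- position is either coloured like a later one or opens the block 0.
colourings : ∀ n k → List (Vec (Fin k) n)
colourings zero zero = [] ∷ []
colourings zero (suc k) = []
colourings (suc n) zero = []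
colourings (suc n) (suc k) =
  cartesianProductWith _∷_ (allFin (suc k)) (colourings n (suc k)) ++ map (λ c → zero ∷ Vec.map suc c) (colourings n k)

length-cartesianProductWith : ∀ {a b c} {A : Set a} {B : Set b} {C : Set c} (f : A → B → C) xs ys →
  length (cartesianProductWith f xs ys) ≡ length xs * length ys
length-cartesianProductWith f [] ys = refl
length-cartesianProductWith f (x ∷ xs) ys = trans (length-++ (map (f x) ys))
  (cong₂ _+_ (length-map (f x) ys) (length-cartesianProductWith f xs ys))

length-colourings : ∀ n k → length (colourings n k) ≡ stirling n k
length-colourings zero zero = refl
length-colourings zero (suc k) = refl
length-colourings (suc n) zero = refl
length-colourings (suc n) (suc k) = trans (length-++ (cartesianProductWith _∷_ (allFin (suc k)) (colourings n (suc k))))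
  (cong₂ _+_ (trans (length-cartesianProductWith _∷_ (allFin (suc k)) (colourings n (suc k)))
                (cong₂ _*_ (length-tabulate {n = suc k} id) (length-colourings n (suc k))))
             (trans (length-map (λ c → zero ∷ Vec.map suc c) (colourings n k)) (length-colourings n k)))

data NewOrOld {n k} (c : Vec (Fin (suc k)) (suc n)) : Set where
  old : ∀ {x d} → d ∈ colourings n (suc k) → c ≡ x ∷ d → NewOrOld c
  new : ∀ {d} → d ∈ colourings n k → c ≡ zero ∷ Vec.map suc d → NewOrOld c

new-or-old : ∀ {n k c} → c ∈ colourings (suc n) (suc k) → NewOrOld c
new-or-old {n} {k} c∈ with ∈-++⁻ (cartesianProductWith _∷_ (allFin (suc k)) (colourings n (suc k))) c∈
... | inj₁ c∈′ = let x , d , _ , d∈ , eq = ∈-cartesianProductWith⁻ _∷_ (allFin (suc k)) (colourings n (suc k)) c∈′ in old d∈ eq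
... | inj₂ c∈′ = let d , d∈ , eq = ∈-map⁻ (λ c → zero ∷ Vec.map suc c) c∈′ in new d∈ eq

colouring-surjective : ∀ {n k c} → c ∈ colourings n k → ∀ j → ∃[ i ] Vec.lookup c i ≡ j
colouring-surjective {zero} {zero} _ ()
colouring-surjective {suc n} {suc k} c∈ j with new-or-old c∈
... | old d∈ refl = let i , eq = colouring-surjective d∈ j in suc i , eq
colouring-surjective {suc n} {suc k} c∈ zero | new d∈ refl = zero , refl
colouring-surjective {suc n} {suc k} c∈ (suc j) | new {d} d∈ refl =
  let i , eq = colouring-surjective d∈ j in suc i , trans (lookup-map i suc d) (cong suc eq)

Kernel⊆ : ∀ {n k} → Vec (Fin k) n → Vec (Fin k) n → Set
Kernel⊆ c d = ∀ i j → Vec.lookup c i ≡ Vec.lookup c j → Vec.lookup d i ≡ Vec.lookup d j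

old-≢-new : ∀ {n k x} {c : Vec (Fin (suc k)) n} {d} → c ∈ colourings n (suc k) → Kernel⊆ (x ∷ c) (zero ∷ Vec.map suc d) → (∀ {a} {A : Set a} → A)
old-≢-new {x = x} {c} {d} c∈ ker with i , eq ← colouring-surjective c∈ x =
  contradiction (trans (ker zero (suc i) (sym eq)) (lookup-map i suc d)) λ ()

kernel-injective : ∀ {n k c d} → c ∈ colourings n k → d ∈ colourings n k → Kernel⊆ c d → Kernel⊆ d c → c ≡ d
kernel-injective {zero} {zero} {[]} {[]} _ _ _ _ = refl
kernel-injective {suc n} {suc k} c∈ d∈ c⊆d d⊆c with new-or-old c∈ | new-or-old d∈
... | old {x} {c} c∈′ refl | old {y} {d} d∈′ refl
      with refl ← kernel-injective c∈′ d∈′ (λ i j → c⊆d (suc i) (suc j)) (λ i j → d⊆c (suc i) (suc j))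
      = let i , eq = colouring-surjective c∈′ x in cong (_∷ c) (sym (trans (c⊆d zero (suc i) (sym eq)) eq))
... | old c∈′ refl | new {d} _ refl = old-≢-new {d = d} c∈′ c⊆d
... | new {c} _ refl | old d∈′ refl = old-≢-new {d = c} d∈′ d⊆c
... | new {c} c∈′ refl | new {d} d∈′ refl = cong (λ c → zero ∷ Vec.map suc c) (kernel-injective c∈′ d∈′ (lower {c} {d} c⊆d) (lower {d} {c} d⊆c))
  where
  lower : ∀ {c d} → Kernel⊆ (zero ∷ Vec.map suc c) (zero ∷ Vec.map suc d) → Kernel⊆ c d
  lower {c} {d} ker i j eq = Fin.suc-injective (trans (sym (lookup-map i suc d)) (trans
    (ker (suc i) (suc j) (trans (lookup-map i suc c) (trans (cong suc eq) (sym (lookup-map j suc c))))) (lookup-map j suc d)))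

colourings-unique : ∀ n k → Unique (colourings n k)
colourings-unique zero zero = [] ∷ []
colourings-unique zero (suc k) = []
colourings-unique (suc n) zero = []
colourings-unique (suc n) (suc k) = ++⁺ (cartesianProductWith⁺ _∷_ Vec.∷-injective (allFin⁺ (suc k)) (colourings-unique n (suc k)))
  (Unique-map-∈ (λ c → zero ∷ Vec.map suc c) (λ _ _ → map-suc-injective ∘ proj₂ ∘ Vec.∷-injective) (colourings-unique n k))
  λ (c∈ , c∈′) → let x , d , _ , d∈ , eq = ∈-cartesianProductWith⁻ _∷_ (allFin (suc k)) (colourings n (suc k)) c∈
                     d′ , _ , eq′ = ∈-map⁻ (λ c → zero ∷ Vec.map suc c) c∈′ in
    old-≢-new {d = d′} d∈ (subst (λ c → Kernel⊆ (x ∷ d) c) (trans (sym eq) eq′) (λ _ _ → id))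
  where
  map-suc-injective : ∀ {n k} {c d : Vec (Fin k) n} → Vec.map suc c ≡ Vec.map suc d → c ≡ d
  map-suc-injective {c = []} {[]} _ = refl
  map-suc-injective {c = _ ∷ _} {_ ∷ _} eq = let p , q = Vec.∷-injective eq in cong₂ _∷_ (Fin.suc-injective p) (map-suc-injective q)

length-filter-map : ∀ {a b p q} {A : Set a} {B : Set b} {P : B → Set p} {Q : A → Set q} (P? : ∀ y → Dec (P y)) (Q? : ∀ x → Dec (Q x)) (f : A → B) →
  (∀ x → P (f x) → Q x) → (∀ x → Q x → P (f x)) → ∀ xs → length (filter P? (map f xs)) ≡ length (filter Q? xs)
length-filter-map P? Q? f P⇒Q Q⇒P [] = refl
length-filter-map P? Q? f P⇒Q Q⇒P (x ∷ xs) with P? (f x) | Q? x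
... | yes _ | yes _ = cong suc (length-filter-map P? Q? f P⇒Q Q⇒P xs)
... | no _ | no _ = length-filter-map P? Q? f P⇒Q Q⇒P xs
... | yes Pfx | no ¬Qx = contradiction (P⇒Q x Pfx) ¬Qx
... | no ¬Pfx | yes Qx = contradiction (Q⇒P x Qx) ¬Pfx

length-subsetsOfSize : ∀ k n → length (subsetsOfSize k n) ≡ choose n k
length-subsetsOfSize zero zero = refl
length-subsetsOfSize (suc k) zero = refl
length-subsetsOfSize k (suc n) = trans (cong length (filter-++ size? (map (outside ∷_) (allSubsets n)) (map (inside ∷_) (allSubsets n))))
  (trans (length-++ (filter size? (map (outside ∷_) (allSubsets n)))) (cases k))
  where
  size? : (A : Subset (suc n)) → Dec (Subset.∣ A ∣ ≡ k)
  size? A = Subset.∣ A ∣ ℕ.≟ k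
  cases : ∀ k → length (filter (λ A → Subset.∣ A ∣ ℕ.≟ k) (map (outside ∷_) (allSubsets n))) + length (filter (λ A → Subset.∣ A ∣ ℕ.≟ k) (map (inside ∷_) (allSubsets n))) ≡ choose (suc n) k
  cases zero = cong₂ _+_ (trans (length-filter-map (λ A → Subset.∣ A ∣ ℕ.≟ 0) (λ A → Subset.∣ A ∣ ℕ.≟ 0) (outside ∷_) (λ _ → id) (λ _ → id) (allSubsets n))
                           (length-subsetsOfSize 0 n))
                         (none (allSubsets n))
    where
    none : ∀ (As : List (Subset n)) → length (filter (λ A → Subset.∣ A ∣ ℕ.≟ 0) (map (inside ∷_) As)) ≡ 0
    none [] = refl
    none (A ∷ As) = none As
  cases (suc k) = cong₂ _+_ (trans (length-filter-map (λ A → Subset.∣ A ∣ ℕ.≟ suc k) (λ A → Subset.∣ A ∣ ℕ.≟ suc k) (outside ∷_) (λ _ → id) (λ _ → id) (allSubsets n))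
                              (length-subsetsOfSize (suc k) n))
                            (trans (length-filter-map (λ A → Subset.∣ A ∣ ℕ.≟ suc k) (λ A → Subset.∣ A ∣ ℕ.≟ k) (inside ∷_) (λ _ → ℕ.suc-injective) (λ _ → cong suc) (allSubsets n))
                              (length-subsetsOfSize k n))

stirling-0 : ∀ {n k} → n < k → stirling n k ≡ 0
stirling-0 {zero} {suc k} _ = refl
stirling-0 {suc n} {suc k} (s≤s n<k) rewrite stirling-0 n<k | stirling-0 (ℕ.m<n⇒m<1+n n<k) = cong (_+ 0) (ℕ.*-zeroʳ k)

choose-0 : ∀ {n k} → n < k → choose n k ≡ 0
choose-0 {zero} {suc k} _ = refl
choose-0 {suc n} {suc k} (s≤s n<k) rewrite choose-0 n<k | choose-0 (ℕ.m<n⇒m<1+n n<k) = refl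

n≤stirling-2+stirling-1 : ∀ n → n ≤ stirling n 2 + stirling n 1
n≤stirling-2+stirling-1 zero = z≤n
n≤stirling-2+stirling-1 (suc zero) = s≤s z≤n
n≤stirling-2+stirling-1 (suc n@(suc n′)) = begin
  suc n                 ≤⟨ s≤s (ℕ.m≤m+n n n′) ⟩
  suc (n + n′)          ≡⟨ ℕ.+-suc n n′ ⟨
  n + n                 ≤⟨ ℕ.+-mono-≤ (n≤stirling-2+stirling-1 n) (n≤stirling-2+stirling-1 n) ⟩
  (stirling n 2 + stirling n 1) + (stirling n 2 + stirling n 1) ≡⟨ arith (stirling n 2) (stirling n 1) ⟩
  (2 * stirling n 2 + stirling n 1) + (1 * stirling n 1 + 0) ∎
  where
  open ℕ.≤-Reasoning
  arith : ∀ a b → (a + b) + (a + b) ≡ (2 * a + b) + (1 * b + 0)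
  arith = solve-∀

choose-1 : ∀ n → choose n 1 ≡ n
choose-1 zero = refl
choose-1 (suc n) = trans (cong (_+ 1) (choose-1 n)) (ℕ.+-comm n 1)

choose-≤-stirling : ∀ n k → choose n (2 + k) ≤ stirling n (2 + k)
choose-≤-stirling zero k = z≤n
choose-≤-stirling (suc n) zero = begin
  choose n 2 + choose n 1                      ≡⟨ cong (_+_ (choose n 2)) (choose-1 n) ⟩
  choose n 2 + n                               ≤⟨ ℕ.+-mono-≤ (choose-≤-stirling n 0) (n≤stirling-2+stirling-1 n) ⟩
  stirling n 2 + (stirling n 2 + stirling n 1) ≡⟨ arith (stirling n 2) (stirling n 1) ⟩
  2 * stirling n 2 + stirling n 1              ∎
  where
  open ℕ.≤-Reasoning
  arith : ∀ a b → a + (a + b) ≡ 2 * a + b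
  arith = solve-∀
choose-≤-stirling (suc n) (suc k) = ℕ.+-mono-≤
  (ℕ.≤-trans (choose-≤-stirling n (suc k)) (ℕ.m≤m+n _ _)) (choose-≤-stirling n k)

-- The limit

falling : ℕ → ℕ → ℕ
falling x zero = 1
falling zero (suc j) = 0
falling (suc x) (suc j) = suc x * falling x j

falling-suc : ∀ x j → j * falling x j + falling x (suc j) ≡ x * falling x j
falling-suc zero zero = refl
falling-suc zero (suc j) = cong (_+ 0) (ℕ.*-zeroʳ j)
falling-suc (suc x) zero = refl
falling-suc (suc x) (suc j) = begin
  suc j * (suc x * f) + suc x * f′   ≡⟨ left x j f f′ ⟩
  suc x * f + suc x * (j * f + f′)   ≡⟨ cong (λ p → suc x * f + suc x * p) (falling-suc x j) ⟩
  suc x * f + suc x * (x * f)        ≡⟨ right x f ⟩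
  suc x * (suc x * f)                ∎
  where
  open ≡.≡-Reasoning
  f = falling x j
  f′ = falling x (suc j)
  left : ∀ x j p q → suc j * (suc x * p) + suc x * q ≡ suc x * p + suc x * (j * p + q)
  left = solve-∀
  right : ∀ x p → suc x * p + suc x * (x * p) ≡ suc x * (suc x * p)
  right = solve-∀

falling-self : ∀ x → falling x x ≡ x !
falling-self zero = refl
falling-self (suc x) = cong (suc x *_) (falling-self x)

falling-0 : ∀ x → falling x (suc x) ≡ 0
falling-0 zero = refl
falling-0 (suc x) = trans (cong (suc x *_) (falling-0 x)) (ℕ.*-zeroʳ x)

-- A map from n points to x points is a partition into j blocks together with
-- an injective labelling of the blocks.
expansion : ℕ → ℕ → ℕ → ℕ
expansion x n zero = stirling n zero
expansion x n (suc j) = expansion x n j + stirling n (suc j) * falling x (suc j)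

expansion-suc : ∀ x n j → expansion x (suc n) j + stirling n j * falling x (suc j) ≡ x * expansion x n j
expansion-suc zero n zero = ℕ.*-zeroʳ (stirling n 0)
expansion-suc (suc x) n zero = arith x (stirling n 0)
  where
  arith : ∀ x s → s * (suc x * 1) ≡ suc x * s
  arith = solve-∀
expansion-suc x n (suc j) = begin
  (expansion x (suc n) j + (suc j * s′ + s) * f) + s′ * f′ ≡⟨ arith (expansion x (suc n) j) j s s′ f f′ ⟩
  (expansion x (suc n) j + s * f) + s′ * (suc j * f + f′) ≡⟨ cong₂ (λ p q → p + s′ * q) (expansion-suc x n j) (falling-suc x (suc j)) ⟩
  x * expansion x n j + s′ * (x * f)                       ≡⟨ arith′ x (expansion x n j) s′ f ⟩
  x * (expansion x n j + s′ * f)                           ∎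
  where
  open ≡.≡-Reasoning
  s = stirling n j
  s′ = stirling n (suc j)
  f = falling x (suc j)
  f′ = falling x (suc (suc j))
  arith : ∀ e j s s′ f f′ → (e + (suc j * s′ + s) * f) + s′ * f′ ≡ (e + s * f) + s′ * (suc j * f + f′)
  arith = solve-∀
  arith′ : ∀ x e s f → x * e + s * (x * f) ≡ x * (e + s * f)
  arith′ = solve-∀

expansion-^ : ∀ x n → expansion x n x ≡ x ^ n
expansion-^ x zero = constant x
  where
  constant : ∀ j → expansion x 0 j ≡ 1
  constant zero = refl
  constant (suc j) = trans (ℕ.+-identityʳ _) (constant j)
expansion-^ x (suc n) = begin
  expansion x (suc n) x                                 ≡⟨ ℕ.+-identityʳ _ ⟨
  expansion x (suc n) x + 0                             ≡⟨ cong (_+_ _) (trans (cong (stirling n x *_) (falling-0 x)) (ℕ.*-zeroʳ (stirling n x))) ⟨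
  expansion x (suc n) x + stirling n x * falling x (suc x) ≡⟨ expansion-suc x n x ⟩
  x * expansion x n x                                   ≡⟨ cong (x *_) (expansion-^ x n) ⟩
  x * x ^ n                                             ∎
  where open ≡.≡-Reasoning

stirling-term : ∀ n k → stirling n k * falling k k ≤ k ^ n
stirling-term n zero = ℕ.≤-reflexive (trans (ℕ.*-identityʳ _) (expansion-^ 0 n))
stirling-term n (suc k) = subst (stirling n (suc k) * falling (suc k) (suc k) ≤_) (expansion-^ (suc k) n) (ℕ.m≤n+m _ _)

stirling-! : ∀ n k → stirling n k * k ! ≤ k ^ n
stirling-! n k = subst (λ f → stirling n k * f ≤ k ^ n) (falling-self k) (stirling-term n k)

stirling-≤ : ∀ n k → stirling n k ≤ k ^ n
stirling-≤ n k = ℕ.≤-trans (ℕ.m≤m*n (stirling n k) (k !) {{ℕ.>-nonZero (ℕ.1≤n! k)}}) (stirling-! n k)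

falling-sum : ℕ → ℕ → ℕ
falling-sum x zero = 1
falling-sum x (suc j) = falling-sum x j + falling x (suc j)

expansion-≤ : ∀ x n q j → j ≤ q → expansion x n j ≤ q ^ n * falling-sum x j
expansion-≤ x n q zero _ = ℕ.≤-trans (stirling-≤ n 0) (subst (0 ^ n ≤_) (sym (ℕ.*-identityʳ _)) (ℕ.^-monoˡ-≤ n z≤n))
expansion-≤ x n q (suc j) j<q = subst (expansion x n (suc j) ≤_) (sym (ℕ.*-distribˡ-+ (q ^ n) (falling-sum x j) (falling x (suc j))))
  (ℕ.+-mono-≤ (expansion-≤ x n q j (ℕ.<⇒≤ j<q)) (ℕ.*-monoˡ-≤ (falling x (suc j)) (ℕ.≤-trans (stirling-≤ n (suc j)) (ℕ.^-monoˡ-≤ n j<q))))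

^-≤-stirling : ∀ q n → suc q ^ n ≤ q ^ n * falling-sum (suc q) q + stirling n (suc q) * suc q !
^-≤-stirling q n = begin
  suc q ^ n                                  ≡⟨ expansion-^ (suc q) n ⟨
  expansion (suc q) n q + stirling n (suc q) * falling (suc q) (suc q) ≤⟨ ℕ.+-mono-≤ (expansion-≤ (suc q) n q q ℕ.≤-refl)
                                                  (ℕ.≤-reflexive (cong (stirling n (suc q) *_) (falling-self (suc q)))) ⟩
  q ^ n * falling-sum (suc q) q + stirling n (suc q) * suc q ! ∎
  where open ℕ.≤-Reasoning

choose-absorption : ∀ n k → suc k * choose n (suc k) + k * choose n k ≡ n * choose n k
choose-absorption zero zero = refl
choose-absorption zero (suc k) = cong₂ _+_ (ℕ.*-zeroʳ k) (ℕ.*-zeroʳ k)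
choose-absorption (suc n) zero = trans (arith (choose n 1)) (cong suc (choose-absorption n zero))
  where
  arith : ∀ c → 1 * (c + 1) + 0 ≡ suc (1 * c + 0)
  arith = solve-∀
choose-absorption (suc n) (suc k) = begin
  suc (suc k) * (c₂ + c₁) + suc k * (c₁ + c₀)                      ≡⟨ left k c₀ c₁ c₂ ⟩
  (suc (suc k) * c₂ + suc k * c₁) + (suc k * c₁ + k * c₀) + c₁ + c₀ ≡⟨ cong₂ (λ p q → p + q + c₁ + c₀) (choose-absorption n (suc k)) (choose-absorption n k) ⟩
  n * c₁ + n * c₀ + c₁ + c₀                                        ≡⟨ right n c₀ c₁ ⟩
  suc n * (c₁ + c₀)                                                ∎
  where
  open ≡.≡-Reasoning
  c₀ = choose n k
  c₁ = choose n (suc k)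
  c₂ = choose n (suc (suc k))
  left : ∀ k c₀ c₁ c₂ → suc (suc k) * (c₂ + c₁) + suc k * (c₁ + c₀) ≡ (suc (suc k) * c₂ + suc k * c₁) + (suc k * c₁ + k * c₀) + c₁ + c₀
  left = solve-∀
  right : ∀ n c₀ c₁ → n * c₁ + n * c₀ + c₁ + c₀ ≡ suc n * (c₁ + c₀)
  right = solve-∀

choose-≤-2^ : ∀ n k → choose n k ≤ 2 ^ n
choose-≤-2^ n zero = ℕ.m^n>0 2 n
choose-≤-2^ zero (suc k) = z≤n
choose-≤-2^ (suc n) (suc k) = ℕ.+-mono-≤ (choose-≤-2^ n (suc k)) (ℕ.≤-trans (choose-≤-2^ n k) (ℕ.m≤m+n _ 0))

choose-negligible : ∀ B k n → B * suc k + k ≤ n → B * choose n k ≤ 2 ^ n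
choose-negligible B k n le = ℕ.≤-trans (ℕ.*-cancelˡ-≤ (suc k) (ℕ.+-cancelʳ-≤ (k * choose n k) _ _ (begin
  suc k * (B * choose n k) + k * choose n k ≡⟨ arith B k (choose n k) ⟩
  (B * suc k + k) * choose n k              ≤⟨ ℕ.*-monoˡ-≤ (choose n k) le ⟩
  n * choose n k                            ≡⟨ choose-absorption n k ⟨
  suc k * choose n (suc k) + k * choose n k ∎))) (choose-≤-2^ n (suc k))
  where
  open ℕ.≤-Reasoning
  arith : ∀ B k c → suc k * (B * c) + k * c ≡ (B * suc k + k) * c
  arith = solve-∀

bernoulli : ∀ q n → q ^ n * (q + n) ≤ q * suc q ^ n
bernoulli q zero = ℕ.≤-reflexive (arith q)
  where
  arith : ∀ q → 1 * (q + 0) ≡ q * 1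
  arith = solve-∀
bernoulli q (suc n) = begin
  (q * q ^ n) * (q + suc n)         ≤⟨ ℕ.m≤m+n _ (q ^ n * n) ⟩
  (q * q ^ n) * (q + suc n) + q ^ n * n ≡⟨ arith q n (q ^ n) ⟩
  suc q * (q ^ n * (q + n))         ≤⟨ ℕ.*-monoʳ-≤ (suc q) (bernoulli q n) ⟩
  suc q * (q * suc q ^ n)           ≡⟨ arith′ q (suc q ^ n) ⟩
  q * (suc q * suc q ^ n)           ∎
  where
  open ℕ.≤-Reasoning
  arith : ∀ q n p → (q * p) * (q + suc n) + p * n ≡ suc q * (p * (q + n))
  arith = solve-∀
  arith′ : ∀ q p → suc q * (q * p) ≡ q * (suc q * p)
  arith′ = solve-∀

^-negligible : ∀ B q n → suc q * B ≤ n → B * suc q ^ n ≤ suc (suc q) ^ n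
^-negligible B q n le = ℕ.*-cancelˡ-≤ (suc q) (begin
  suc q * (B * suc q ^ n)      ≡⟨ arith (suc q) B (suc q ^ n) ⟩
  suc q ^ n * (suc q * B)      ≤⟨ ℕ.*-monoʳ-≤ (suc q ^ n) (ℕ.≤-trans le (ℕ.m≤n+m n (suc q))) ⟩
  suc q ^ n * (suc q + n)      ≤⟨ bernoulli (suc q) n ⟩
  suc q * suc (suc q) ^ n      ∎)
  where
  open ℕ.≤-Reasoning
  arith : ∀ q B p → q * (B * p) ≡ p * (q * B)
  arith = solve-∀

bound : ℕ → ℕ → ℕ
bound l n = stirling n (suc l) ∸ choose n (suc l)

bound-≤ : ∀ l n → bound l n * suc l ! ≤ suc l ^ n
bound-≤ l n = ℕ.≤-trans (ℕ.*-monoˡ-≤ (suc l !) (ℕ.m∸n≤m (stirling n (suc l)) (choose n (suc l)))) (stirling-! n (suc l))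

^-≤-bound : ∀ q n → suc q ^ n ≤ bound q n * suc q ! + (q ^ n * falling-sum (suc q) q + suc q ! * choose n (suc q))
^-≤-bound q n = begin
  suc q ^ n                                                   ≤⟨ ^-≤-stirling q n ⟩
  P + s * f                                                   ≤⟨ ℕ.+-monoʳ-≤ P (ℕ.*-monoˡ-≤ f (ℕ.m≤n+m∸n s c)) ⟩
  P + (c + bound q n) * f                                     ≡⟨ arith P c (bound q n) f ⟩
  bound q n * f + (P + f * c)                                 ∎
  where
  open ℕ.≤-Reasoning
  P = q ^ n * falling-sum (suc q) q
  s = stirling n (suc q)
  c = choose n (suc q)
  f = suc q !
  arith : ∀ P c b f → P + (c + b) * f ≡ b * f + (P + f * c)
  arith = solve-∀

error-negligible : ∀ B q → ∃[ N ] ∀ n → N ≤ n → B * (suc (suc q) ^ n ∸ bound (suc q) n * suc (suc q) !) ≤ suc (suc q) ^ n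
error-negligible B q = N₁ + N₂ , λ n le → ℕ.*-cancelˡ-≤ 2 (begin
  2 * (B * (k ^ n ∸ bound (suc q) n * k !))        ≤⟨ ℕ.*-monoʳ-≤ 2 (ℕ.*-monoʳ-≤ B (ℕ.m≤n+o⇒m∸n≤o (k ^ n) (bound (suc q) n * k !) (^-≤-bound (suc q) n))) ⟩
  2 * (B * (suc q ^ n * M + k ! * choose n k))     ≡⟨ arith B (suc q ^ n) M (k !) (choose n k) ⟩
  (2 * B * M) * suc q ^ n + (2 * B * k !) * choose n k ≤⟨ ℕ.+-mono-≤ (^-negligible (2 * B * M) q n (ℕ.≤-trans (ℕ.m≤m+n N₁ N₂) le))
                                                        (ℕ.≤-trans (choose-negligible (2 * B * k !) k n (ℕ.≤-trans (ℕ.m≤n+m N₂ N₁) le)) (ℕ.^-monoˡ-≤ n (s≤s (s≤s z≤n)))) ⟩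
  k ^ n + k ^ n                                    ≡⟨ cong (_+_ (k ^ n)) (sym (ℕ.+-identityʳ _)) ⟩
  2 * k ^ n                                        ∎)
  where
  open ℕ.≤-Reasoning
  k = suc (suc q)
  M = falling-sum k (suc q)
  N₁ = suc q * (2 * B * M)
  N₂ = (2 * B * k !) * suc k + k
  arith : ∀ B P M f c → 2 * (B * (P * M + f * c)) ≡ (2 * B * M) * P + (2 * B * f) * c
  arith = solve-∀

toℚᵘ-/ : ∀ X Y → toℚᵘ (+ X / suc Y) ℚᵘ.≃ mkℚᵘ (+ X) Y
toℚᵘ-/ X Y = ℚ.toℚᵘ-fromℚᵘ (mkℚᵘ (+ X) Y)

∣X/Y-1∣<ε : ∀ X Y .{{_ : ℕ.NonZero Y}} (ε : ℚ) → 0ℚ ℚ.< ε → X ≤ Y → suc (↧ₙ ε) * (Y ∸ X) ≤ Y → ∣ + X / Y ℚ.- 1ℚ ∣ ℚ.< ε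
∣X/Y-1∣<ε X (suc Y) ε 0<ε X≤Y small = ℚ.toℚᵘ-cancel-< (ℚᵘ.<-respˡ-≃ (ℚᵘ.≃-sym simplify) (strict ε 0<ε small))
  where
  p : ℚᵘ
  p = mkℚᵘ (+ X) Y ℚᵘ.- ℚᵘ.1ℚᵘ
  simplify : toℚᵘ ∣ + X / suc Y ℚ.- 1ℚ ∣ ℚᵘ.≃ ℚᵘ.∣ p ∣
  simplify = ℚᵘ.≃-trans (ℚ.toℚᵘ-homo-∣-∣ (+ X / suc Y ℚ.- 1ℚ)) (ℚᵘ.∣-∣-cong
    (ℚᵘ.≃-trans (ℚ.toℚᵘ-homo-+ (+ X / suc Y) (ℚ.- 1ℚ)) (ℚᵘ.+-congˡ (toℚᵘ (ℚ.- 1ℚ)) (toℚᵘ-/ X Y))))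
  strict : ∀ ε → 0ℚ ℚ.< ε → suc (↧ₙ ε) * (suc Y ∸ X) ≤ suc Y → ℚᵘ.∣ p ∣ ℚᵘ.< toℚᵘ ε
  strict (ℚ.mkℚ (+ zero) b-1 _) (ℚ.*<* (+<+ ())) _
  strict (ℚ.mkℚ -[1+ _ ] b-1 _) (ℚ.*<* ()) _
  strict (ℚ.mkℚ (+ suc a) b-1 _) _ small = *<* (subst₂ ℤ._<_ (trans (ℤ.pos-* (suc Y ∸ X) (suc b-1)) (cong (λ e → + e ℤ.* + suc b-1) (sym numerator)))
      (ℤ.pos-* (suc a) (suc Y * 1)) (+<+ (ℕ.<-≤-trans (below (suc Y ∸ X) small)
        (ℕ.≤-trans (ℕ.≤-reflexive (sym (ℕ.*-identityʳ (suc Y)))) (ℕ.m≤m+n (suc Y * 1) (a * (suc Y * 1)))))))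
    where
    numerator : ℤ.∣ + X ℤ.* + 1 ℤ.+ -[1+ 0 ] ℤ.* + suc Y ∣ ≡ suc Y ∸ X
    numerator = trans (cong ℤ.∣_∣ (cong₂ ℤ._+_ (ℤ.*-identityʳ (+ X)) (ℤ.-1*i≡-i (+ suc Y)))) (ℤ.∣⊖∣-≤ X≤Y)
    below : ∀ e → suc (suc b-1) * e ≤ suc Y → e * suc b-1 < suc Y
    below zero _ = s≤s z≤n
    below (suc e) le = ℕ.<-≤-trans (subst (_< suc (suc b-1) * suc e) (ℕ.*-comm (suc b-1) (suc e)) (ℕ.m<n+m _ (s≤s z≤n))) le

-- The lower bound

module LowerBound {c ℓ₁ ℓ₂} (K : HeytingField c ℓ₁ ℓ₂) (char : Representations.CharacteristicZero K) (l n : ℕ) (1≤l : 1 ≤ l) where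

  open Representations K

  arrangement : Pred (Fun n) (c ⊔ ℓ₁) → Arrangement (Fun n) (c ⊔ ℓ₁)
  arrangement U = record
    { space = U
    ; size = length (subsetsOfSize (suc l) n)
    ; hyperplane = λ i → H U (blocks (lookup (subsetsOfSize (suc l) n) i))
    }

  Sλ-≡ : l < n → Sλ l n ≡ Specht (hook l n) n
  Sλ-≡ l<n with l ℕ.<? n
  ... | yes _ = refl
  ... | no l≮n = contradiction l<n l≮n

  bound-≡ : + bound l n ≡ + stirling n (suc l) ℤ.- + choose n (suc l)
  bound-≡ = trans (sym (ℤ.⊖-≥ (choose≤stirling 1≤l))) (sym (ℤ.m-n≡m⊖n (stirling n (suc l)) (choose n (suc l))))
    where
    choose≤stirling : ∀ {l} → 1 ≤ l → choose n (suc l) ≤ stirling n (suc l)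
    choose≤stirling {suc l} _ = choose-≤-stirling n l

  bound-0 : stirling n (suc l) ≡ 0 → + bound l n ≡ 0ℤ
  bound-0 eq = cong +_ (trans (cong (_∸ choose n (suc l)) eq) (ℕ.0∸n≡0 (choose n (suc l))))

  module _ (l<n : l < n) where

    open Tableaux.Specht-module K char {n} l l<n

    specht-bound : (p : Poly) → IsKLPolynomial 𝓐 p → + bound l n ℤ.≤ p 1
    specht-bound p kl = subst (+ bound l n ℤ.≤_) (sym (value 1)) (by-rank (rk bottom ⊤) refl)
      where
      open IsKLPolynomial kl
      open Flatness isLattice
      open Flats flats using (rk)
      open IsLatticeOfFlats isLattice using (unique)

      coatom : Vec (Fin (suc l)) n → Subset m
      coatom c = Colouring.coatom (Vec.lookup c)

      coatoms : List (Subset m)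
      coatoms = map coatom (colourings n (suc l))

      coatoms-length : length coatoms ≡ stirling n (suc l)
      coatoms-length = trans (length-map coatom (colourings n (suc l))) (length-colourings n (suc l))

      coatoms-unique : Unique coatoms
      coatoms-unique = Unique-map-∈ coatom
        (λ {c} {d} c∈ d∈ eq → kernel-injective c∈ d∈
          (λ i j → coatom-kernel {Vec.lookup c} {Vec.lookup d} (colouring-surjective d∈) eq)
          (λ i j → coatom-kernel {Vec.lookup d} {Vec.lookup c} (colouring-surjective c∈) (sym eq)))
        (colourings-unique n (suc l))

      coatom-∈ : ∀ c → coatom c ∈ flats
      coatom-∈ c = flat⇒∈ (Colouring.coatom-flat (Vec.lookup c))

      coatom-⊂ : ∀ {c} → c ∈ colourings n (suc l) → coatom c Subset.⊂ ⊤
      coatom-⊂ {c} c∈ = Colouring.coatom⊂⊤ (Vec.lookup c) (colouring-surjective c∈)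

      by-rank : ∀ r → rk bottom ⊤ ≡ r → + bound l n ℤ.≤ family bottom 1
      by-rank zero eq = ℤ.≤-reflexive (trans (bound-0 (trans (sym (length-colourings n (suc l))) (no-colouring (colourings n (suc l)) coatom-⊂)))
        (sym (Flats.IsKLFamily.rank-0 isKLFamily bottom∈ eq 1)))
        where
        no-colouring : ∀ cs → (∀ {c} → c ∈ cs → coatom c Subset.⊂ ⊤) → length cs ≡ 0
        no-colouring [] _ = refl
        no-colouring (c ∷ _) h = contradiction (subst (0 <_) eq
          (rk-pos bottom∈ (flat⇒∈ ⊤-flat) (⊆-⊂-trans (bottom⊆ (coatom-∈ c)) (h (here refl))))) ℕ.n≮0
      by-rank (suc r) eq = subst (ℤ._≤ family bottom 1)
        (trans (cong₂ (λ a b → + a ℤ.- + b) coatoms-length (length-subsetsOfSize (suc l) n)) (sym bound-≡))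
        (first-coefficient-≥ isKLFamily bottom∈ bottom⊆ eq coatoms-unique coatom-properties)
        where
        coatom-properties : ∀ {G} → G ∈ coatoms → G ∈ flats × rk G ⊤ ≡ 1 × r ≤ rk bottom G
        coatom-properties G∈ with c , c∈ , refl ← ∈-map⁻ coatom G∈ =
          coatom-∈ c , rk-1 , ℕ.≤-pred (subst (_≤ suc (rk bottom (coatom c))) eq (rk-coatom bottom∈ (coatom-∈ c) (bottom⊆ (coatom-∈ c)) rk-1))
          where
          rk-1 : rk (coatom c) ⊤ ≡ 1
          rk-1 = rk-coatom-1 (coatom-∈ c) (coatom-⊂ c∈) (Colouring.coatom-maximal (Vec.lookup c))

  rank-zero-bound : ∀ {U} → n ≤ l → (p : Poly) → IsKLPolynomial (arrangement U) p → + bound l n ℤ.≤ p 1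
  rank-zero-bound n≤l p kl = ℤ.≤-reflexive (trans (bound-0 (stirling-0 (s≤s n≤l)))
    (sym (trans (value 1) (Flats.IsKLFamily.rank-0 isKLFamily bottom∈ (rk-0 no-hyperplane) 1))))
    where
    open IsKLPolynomial kl
    no-hyperplane : Subset.∣ ⊤ {length (subsetsOfSize (suc l) n)} ∣ ≡ 0
    no-hyperplane = trans (∣⊤∣≡n _) (trans (length-subsetsOfSize (suc l) n) (choose-0 (s≤s n≤l)))
    rk-0 : Subset.∣ ⊤ {length (subsetsOfSize (suc l) n)} ∣ ≡ 0 → Flats.rk flats bottom ⊤ ≡ 0
    rk-0 eq rewrite eq = refl

  first-coefficient : (p : Poly) → IsKLPolynomial (intrinsicArrangement l n) p → + bound l n ℤ.≤ p 1
  first-coefficient p kl = by-size (l ℕ.<? n)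
    where
    specht-case : (l<n : l < n) → ∀ {U} → U ≡ Specht (hook l n) n → IsKLPolynomial (arrangement U) p → + bound l n ℤ.≤ p 1
    specht-case l<n refl = specht-bound l<n p
    by-size : Dec (l < n) → + bound l n ℤ.≤ p 1
    by-size (yes l<n) = specht-case l<n (Sλ-≡ l<n) kl
    by-size (no l≮n) = rank-zero-bound {Sλ l n} (ℕ.≮⇒≥ l≮n) p kl

theorem1p5 : ∀ {c ℓ₁ ℓ₂ : Level} (K : HeytingField c ℓ₁ ℓ₂) →
    let open Representations K in
    CharacteristicZero →
    (l : ℕ) → 1 ≤ l →
    Σ[ f ∈ (ℕ → ℕ) ]
    ((n : ℕ) (p : Poly) → IsKLPolynomial (intrinsicArrangement l n) p → + f n ℤ.≤ p 1)
    × ((ε : ℚ) → 0ℚ ℚ.< ε → Σ[ N ∈ ℕ ] ((n : ℕ) → N ≤ n →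
    ∣ _/_ (+ (f n * ((suc l) !))) (suc l ^ n) {{m^n≢0 (suc l) n}} ℚ.- 1ℚ ∣ ℚ.< ε))
theorem1p5 K char (suc l) 1≤l = bound (suc l)
  , (λ n → LowerBound.first-coefficient K char (suc l) n 1≤l)
  , λ ε 0<ε → let N , small = error-negligible (suc (ℚ.↧ₙ ε)) l in
    N , λ n N≤n → ∣X/Y-1∣<ε (bound (suc l) n * (suc (suc l)) !) (suc (suc l) ^ n) {{m^n≢0 (suc (suc l)) n}} ε 0<ε (bound-≤ (suc l) n) (small n N≤n)
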